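{- Let $I$ be any facet of the subword complex $\mathcal{S}(Q)$, $Q=\mathbf{c}\,\mathbf{w}_\circ(c)$, and let $S(I)$ be the corresponding cluster seed of $\mathcal{A}(W,c)$. Then for every $i\in I$ the $c$-vector of $S(I)$ at $i$ equals the root function: $$\mathbf{c}(I,i)=r(I,i).$$ In particular each $\mathbf{c}(I,i)$ lies in $\Phi$ and is sign-coherent (lies in $\mathbb{Z}_{\ge 0}\Delta$ or in $\mathbb{Z}_{\le 0}\Delta$), and $\{\mathbf{c}(I,i): i\in I\}$ is a lattice basis of the root lattice $\mathbb{Z}\Delta$.
   Context: Let $(W,\mathcal{S})$ be a finite crystallographic Coxeter system of rank $n$ acting essentially on a Euclidean space $V$ with inner product $\langle\cdot,\cdot\rangle$. Its simple roots are $\Delta=\{\alpha_s\}$ and its simple coroots are $\alpha_s^\vee=2\alpha_s/\langle\alpha_s,\alpha_s\rangle$. The Cartan matrix is $a_{st}=\langle\alpha_t,\alpha_s^\vee\rangle$. The fundamental weights $\omega_s$ and fundamental coweights $\omega_s^\vee$ are defined by $\langle\omega_s,\alpha_t^\vee\rangle=\langle\alpha_s,\omega_t^\vee\rangle=\delta_{s=t}$. Let $\Phi=W(\Delta)$, $\Phi^+=\Phi\cap\mathbb{Z}_{\ge0}\Delta$, $N=|\Phi^+|$, and let $w_\circ$ be the longest element. Fix a Coxeter element $c$ with reduced word $\mathbf{c}=s_1\cdots s_n$, and write $\alpha_i=\alpha_{s_i}$. Let $\mathbf{w}_\circ(c)=q_1\cdots q_N$ be the lexicographically first subword of $\mathbf{c}\mathbf{c}\mathbf{c}\cdots$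 that is a reduced word for $w_\circ$. Let $Q=Q_1\cdots Q_{n+N}$ be the concatenation $s_1\cdots s_nq_1\cdots q_N$. The facets of the subword complex $\mathcal{S}(Q)$ are the $n$-subsets $I\subseteq[n+N]$ such that deleting the letters of $Q$ at the positions in $I$ leaves a reduced word for $w_\circ$. For a facet $I$ and $k\in[n+N]$, let $\Pi_{I,k}$ be the product of the $Q_x$ for $x\in[k-1]\setminus I$, taken in the order of $Q$. The root function is $r(I,k)=\Pi_{I,k}(\alpha_{Q_k})$. Cluster algebra: $\mathcal{A}(W,c)$ is the cluster algebra with principal coefficients and initial seed $\big(\begin{bmatrix}B_c\\ \mathrm{Id}_n\end{bmatrix},(x_1,\dots,x_n),(y_1,\dots,y_n)\big)$. Here $B_c=(b_{ij})$ has $b_{ij}=-a_{s_is_j}$ if $i<j$, $b_{ij}=a_{s_is_j}$ if $i>j$, and $b_{ii}=0$; mutations are the usual Fomin–Zelevinsky ones. Every cluster variable $u$ has the form $p(\mathbf{x},\mathbf{y})/x_1^{d_1}\cdots x_n^{d_n}$, and its $d$-vector is $\sum d_i\alpha_i$. It is known that $u\mapsto$ ($d$-vector of $u$) is a bijection from cluster variables onto $\Phi^+\sqcup-\Delta$. Define $\psi:[n+N]\to\Phi^+\sqcup-\Delta$ by $\psi(k)=-\alpha_k$ for $k\le n$ and $\psi(n+k)=q_1\cdots q_{k-1}(\alpha_{q_k})$. This $\psi$ is a bijection, and it is known that $I\mapsto\{$cluster variables with $d$-vectors in $\psi(I)\}$ is a bijection from facets of $\mathcal{S}(Q)$ to clusters.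 Let $S(I)$ be the seed of this cluster, with extended exchange matrix $\begin{bmatrix}M^{pr}(I)\\ M^{ex}(I)\end{bmatrix}$. Its columns are indexed by $i\in I$ (the cluster variable with $d$-vector $\psi(i)$), and the rows of $M^{ex}(I)$ are indexed by $1,\dots,n$. The $c$-vector at $i\in I$ is $\mathbf{c}(I,i)=\sum_{j=1}^n[M^{ex}(I)]_{ji}\alpha_j$. -}

module Defs where

open import Data.Nat as ℕ using (ℕ; zero; suc; _<ᵇ_; _≤ᵇ_)
open import Data.Integer as ℤ using (ℤ; +_; -[1+_]; 0ℤ; 1ℤ; _≤_; _<_)
open import Data.Fin using (Fin; toℕ; _≟_)
import Data.Fin as Fin
open import Data.List using (List; []; _∷_; _++_; map; length; lookup; allFin; filterᵇ; concatMap; foldr; foldl; upTo)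
open import Data.Bool using (Bool; true; false; not; _∧_; if_then_else_)
open import Data.Product using (Σ; ∃; _×_; _,_; proj₁; proj₂)
open import Data.Sum using (_⊎_)
open import Relation.Nullary using (¬_; yes; no)
open import Relation.Nullary.Decidable using (⌊_⌋)
open import Relation.Binary.PropositionalEquality using (_≡_; _≢_; _≗_)

∑ : ∀ {n} → (Fin n → ℤ) → ℤ
∑ {zero}  f = 0ℤ
∑ {suc n} f = f Fin.zero ℤ.+ ∑ (λ i → f (Fin.suc i))

-- vectors of the root lattice ℤΔ, in coordinates w.r.t. the simple roots
Vect : ℕ → Set
Vect n = Fin n → ℤ

-- A matrix with entries a s t = a_{st} = ⟨α_t, α_s^∨⟩
CartanMatrix : ℕ → Set
CartanMatrix n = Fin n → Fin n → ℤ

-- Cartan matrix of a finite crystallographic root system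
-- (a_ss = 2, a_st ≤ 0 for s ≠ t, symmetrizable by positive d_s with
--  d_s a_st = ⟨α_s,α_t⟩ (up to a common scalar) positive definite)
record IsFiniteCartan {n : ℕ} (a : CartanMatrix n) : Set where
  field
    diag    : ∀ s → a s s ≡ + 2
    offdiag : ∀ s t → s ≢ t → a s t ≤ 0ℤ
    d       : Fin n → ℕ
    d-pos   : ∀ s → 0 ℕ.< d s
    symm    : ∀ s t → (+ d s) ℤ.* a s t ≡ (+ d t) ℤ.* a t s
    posdef  : ∀ (v : Vect n) → (∃ λ s → v s ≢ 0ℤ) →
              0ℤ < ∑ (λ s → ∑ (λ t → v s ℤ.* ((+ d s) ℤ.* a s t) ℤ.* v t))

module _ {n : ℕ} (a : CartanMatrix n) where

  e : Fin n → Vect n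
  e t u = if ⌊ u ≟ t ⌋ then 1ℤ else 0ℤ

  -- simple reflection s_t (v) = v - ⟨v, α_t^∨⟩ α_t
  refl : Fin n → Vect n → Vect n
  refl t v u = if ⌊ u ≟ t ⌋ then v u ℤ.- ∑ (λ w → a t w ℤ.* v w) else v u

  Word : Set
  Word = List (Fin n)

  act : Word → Vect n → Vect n
  act []      v = v
  act (q ∷ w) v = refl q (act w v)

  -- two words represent the same element of W (W acts faithfully)
  SameElt : Word → Word → Set
  SameElt u w = ∀ v → act u v ≗ act w v

  Reduced : Word → Set
  Reduced w = ∀ u → SameElt u w → length w ℕ.≤ length u

  ReducedLongest : Word → Set
  ReducedLongest w = Reduced w × (∀ u → Reduced u → length u ℕ.≤ length w)

  InPhi : Vect n → Set
  InPhi v = ∃ λ (w : Word) → ∃ λ t → act w (e t) ≗ v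

-- The word w∘(c) and Q = c w∘(c), with c = s₁ ⋯ s_n (labels = positions in c)

-- position (in c c c ⋯, 0-based) of the letter j in the r-th copy of c
pos : ∀ {n} → ℕ × Fin n → ℕ
pos {n} (r , j) = r ℕ.* n ℕ.+ toℕ j

Increasing : List ℕ → Set
Increasing []            = Data.Unit.⊤ where import Data.Unit
Increasing (x ∷ [])      = Data.Unit.⊤ where import Data.Unit
Increasing (x ∷ y ∷ xs)  = (x ℕ.< y) × Increasing (y ∷ xs)

LexLeq : List ℕ → List ℕ → Set
LexLeq []       ys       = Data.Unit.⊤ where import Data.Unit
LexLeq (x ∷ xs) []       = Data.Empty.⊥ where import Data.Empty
LexLeq (x ∷ xs) (y ∷ ys) = (x ℕ.< y) ⊎ ((x ≡ y) × LexLeq xs ys)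

module _ {n : ℕ} (a : CartanMatrix n) where

  -- a subword of c^∞ (given by its positions) which is a reduced word for w∘
  IsWoSubword : List (ℕ × Fin n) → Set
  IsWoSubword ps = Increasing (map pos ps) × ReducedLongest a (map proj₂ ps)

  IsWoC : List (ℕ × Fin n) → Set
  IsWoC ps = IsWoSubword ps × (∀ ps' → IsWoSubword ps' → LexLeq (map pos ps) (map pos ps'))

  Qword : List (ℕ × Fin n) → Word a
  Qword ps = allFin n ++ map proj₂ ps

  module _ (Q : Word a) where
    L : ℕ
    L = length Q

    Face : Set
    Face = Fin L → Bool

    card : Face → ℕ
    card I = length (filterᵇ I (allFin L))

    IsFacet : Face → Set
    IsFacet I = (card I ≡ n) ×
                ReducedLongest a (map (lookup Q) (filterᵇ (λ x → not (I x)) (allFin L)))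

    Pi : Face → Fin L → Word a
    Pi I k = map (lookup Q) (filterᵇ (λ x → (toℕ x <ᵇ toℕ k) ∧ not (I x)) (allFin L))

    rootFn : Face → Fin L → Vect n
    rootFn I k = act a (Pi I k) (e a (lookup Q k))

    -- ψ : [n+N] → Φ⁺ ⊔ -Δ
    ψ : Fin L → Vect n
    ψ k = if toℕ k <ᵇ n
          then (λ u → ℤ.- e a (lookup Q k) u)
          else act a (map (lookup Q) (filterᵇ (λ x → (n ≤ᵇ toℕ x) ∧ (toℕ x <ᵇ toℕ k)) (allFin L)))
                     (e a (lookup Q k))

-- monomial: exponents of the x's and of the y's
Mono : ℕ → Set
Mono n = (Fin n → ℕ) × (Fin n → ℕ)

-- polynomial with ℕ coefficients as a formal sum of terms
Poly : ℕ → Set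
Poly n = List (ℕ × Mono n)

module _ {n : ℕ} where

  mono1 : Mono n
  mono1 = (λ _ → 0) , (λ _ → 0)

  monoMul : Mono n → Mono n → Mono n
  monoMul (a , b) (c , d) = (λ i → a i ℕ.+ c i) , (λ i → b i ℕ.+ d i)

  pOne : Poly n
  pOne = (1 , mono1) ∷ []

  _⊕_ : Poly n → Poly n → Poly n
  p ⊕ q = p ++ q

  _⊗_ : Poly n → Poly n → Poly n
  p ⊗ q = concatMap (λ s → map (λ t → (proj₁ s ℕ.* proj₁ t , monoMul (proj₂ s) (proj₂ t))) q) p

  xVar : Fin n → Poly n
  xVar i = (1 , ((λ j → if ⌊ j ≟ i ⌋ then 1 else 0) , (λ _ → 0))) ∷ []

  yVar : Fin n → Poly n
  yVar i = (1 , ((λ _ → 0) , (λ j → if ⌊ j ≟ i ⌋ then 1 else 0))) ∷ []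

  -- order of vanishing in x_i: minimum exponent of x_i among the terms
  -- with nonzero coefficient (no cancellation occurs: coefficients are in ℕ)
  ordx : Fin n → Poly n → ℕ
  ordx i p = go (filterᵇ (λ t → not (proj₁ t ℕ.≡ᵇ 0)) p)
    where
    go : Poly n → ℕ
    go []            = 0
    go (t ∷ [])      = proj₁ (proj₂ t) i
    go (t ∷ t' ∷ ts) = proj₁ (proj₂ t) i ℕ.⊓ go (t' ∷ ts)

Frac : ℕ → Set
Frac n = Poly n × Poly n

module _ {n : ℕ} where

  fOne : Frac n
  fOne = pOne , pOne

  fMul : Frac n → Frac n → Frac n
  fMul (a , b) (c , d) = (a ⊗ c) , (b ⊗ d)

  fAdd : Frac n → Frac n → Frac n
  fAdd (a , b) (c , d) = ((a ⊗ d) ⊕ (c ⊗ b)) , (b ⊗ d)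

  fDiv : Frac n → Frac n → Frac n
  fDiv (a , b) (c , d) = (a ⊗ d) , (b ⊗ c)

  fPow : Frac n → ℕ → Frac n
  fPow f zero    = fOne
  fPow f (suc k) = fMul f (fPow f k)

  fProd : (Fin n → Frac n) → Frac n
  fProd f = foldr (λ i acc → fMul (f i) acc) fOne (allFin n)

  -- d-vector: d_i = - ord_{x_i}(u), i.e. u = p / x₁^{d₁} ⋯ x_n^{d_n}
  dvec : Frac n → Vect n
  dvec (p , q) i = (+ ordx i q) ℤ.- (+ ordx i p)

record Seed (n : ℕ) : Set where
  field
    B  : Fin n → Fin n → ℤ     -- principal part (rows 1..n of the extended matrix)
    C  : Fin n → Fin n → ℤ     -- coefficient part M^ex (rows n+1..2n)
    x  : Fin n → Frac n

open Seed public

[_]₊ : ℤ → ℕ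
[ + m ]₊     = m
[ -[1+ m ] ]₊ = 0

module _ {n : ℕ} where

  initialSeed : CartanMatrix n → Seed n
  B (initialSeed a) i j with toℕ i ℕ.<? toℕ j | toℕ j ℕ.<? toℕ i
  ... | yes _ | _     = ℤ.- a i j
  ... | no _  | yes _ = a i j
  ... | no _  | no _  = 0ℤ
  C (initialSeed a) i j = if ⌊ i ≟ j ⌋ then 1ℤ else 0ℤ
  x (initialSeed a) i = xVar i , pOne

  mutEntry : ℤ → ℤ → ℤ → ℤ
  mutEntry bij bik bkj = bij ℤ.+ (+ ([ bik ]₊ ℕ.* [ bkj ]₊)) ℤ.- (+ ([ ℤ.- bik ]₊ ℕ.* [ ℤ.- bkj ]₊))

  mutate : Fin n → Seed n → Seed n
  B (mutate k S) i j =
    if ⌊ i ≟ k ⌋ ∨ ⌊ j ≟ k ⌋ then ℤ.- B S i j else mutEntry (B S i j) (B S i k) (B S k j)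
    where open import Data.Bool using (_∨_)
  C (mutate k S) i j =
    if ⌊ j ≟ k ⌋ then ℤ.- C S i j else mutEntry (C S i j) (C S i k) (B S k j)
  x (mutate k S) i =
    if ⌊ i ≟ k ⌋
    then fDiv (fAdd (fMul (fProd (λ l → fPow (x S l) [ B S l k ]₊))
                          (fProd (λ l → fPow (yVar l , pOne) [ C S l k ]₊)))
                    (fMul (fProd (λ l → fPow (x S l) [ ℤ.- B S l k ]₊))
                          (fProd (λ l → fPow (yVar l , pOne) [ ℤ.- C S l k ]₊))))
              (x S k)
    else x S i

  seedAfter : CartanMatrix n → List (Fin n) → Seed n
  seedAfter a ks = foldl (λ S k → mutate k S) (initialSeed a) ks

  cvec : Seed n → Fin n → Vect n
  cvec S j l = C S l j

SignCoherent : ∀ {n} → Vect n → Set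
SignCoherent v = (∀ t → 0ℤ ≤ v t) ⊎ (∀ t → v t ≤ 0ℤ)

IsLatticeBasis : ∀ {n} → (Fin n → Vect n) → Set
IsLatticeBasis {n} v =
  (∀ (u : Vect n) → ∃ λ (λc : Fin n → ℤ) → ∀ t → ∑ (λ j → λc j ℤ.* v j t) ≡ u t) ×
  (∀ (λ₁ λ₂ : Fin n → ℤ) → (∀ t → ∑ (λ j → λ₁ j ℤ.* v j t) ≡ ∑ (λ j → λ₂ j ℤ.* v j t)) →
     ∀ j → λ₁ j ≡ λ₂ j)

-- The seed S reaches the cluster indexed by the facet I:
-- its cluster variables have exactly the d-vectors ψ(I)

SeedOfFacet : ∀ {n} (a : CartanMatrix n) (Q : Word a) → Face a Q → Seed n → Set
SeedOfFacet a Q I S =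
  (∀ j → ∃ λ i → (I i ≡ true) × (dvec (x S j) ≗ ψ a Q i)) ×
  (∀ i → I i ≡ true → ∃ λ j → dvec (x S j) ≗ ψ a Q i)

{-# OPTIONS --safe #-}
module Submission where

-- Write r J k for the root function of the facet J, and E for the Euler form of c. The roots r J k, k ∈ J, form an
-- exceptional sequence: E (r J k) (r J l) = 0 for k < l. This holds for the initial facet and is preserved by flips,
-- which act as Hurwitz moves. By lexicographic minimality every letter of c w∘(c) is a source of the orientation
-- reached when it is read, so the triangularity passes to all rotations of the word. In the rotation starting at k ∈ J
-- it says that the root at k is a simple root α_s and that the roots at the other positions of J have no coefficient
-- at α_s. As every root is positive or negative, the sign of ⟨ r J i , r J k ⟩ can be read off from the positions
-- i, k and j, where j is the position exchanged with i, and flipping J at i turns out to be the mutation of c-vectors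
-- for the exchange matrix (E (r J i) (r J k) − E (r J k) (r J i)) / d_i.
-- For the d-vectors, the b-th component of ψ is, in the rotation starting with the letter b and up to scaling, minus
-- the coordinate vector of α_b in the basis of rotated roots. Hence it satisfies a linear exchange relation, and the
-- sign of the rotated root decides that this is the tropical one. Finally ψ is injective, so that the d-vectors of
-- a cluster determine its facet.

open import Defs hiding (refl)
open import Data.Nat as ℕ using (ℕ; zero; suc)
import Data.Nat.Properties as ℕP
open import Data.Integer using (ℤ; -[1+_]; 0ℤ; 1ℤ; -1ℤ; _+_; _*_; -_; _-_; _⊔_; _≤_; _<_; +≤+; -≤+; +<+) renaming (+_ to int)
import Data.Integer as ℤ
import Data.Integer.Properties as ℤP
open import Data.Integer.Tactic.RingSolver using (solve-∀)
open import Data.Fin using (Fin; toℕ; _≟_)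
import Data.Fin as Fin
import Data.Fin.Properties as FinP
open import Data.List using (List; []; _∷_; _++_; length; filterᵇ; foldl; foldr; map; tabulate; allFin; lookup; take)
open import Data.List.Membership.Propositional using (_∈_)
open import Data.List.Membership.Propositional.Properties using (∈-++⁺ˡ; ∈-++⁺ʳ; ∈-++⁻; ∈-map⁺; ∈-map⁻)
open import Data.List.Relation.Unary.Any using (here; there)
import Data.List.Properties as ListP
open import Data.Bool using (Bool; true; false; not; _∧_; _∨_; _xor_; if_then_else_)
open import Data.Bool.Properties using (not-involutive; xor-comm; ∧-comm)
open import Data.Product using (∃; _×_; _,_; proj₁; proj₂; ∃₂)
open import Data.Sum using (_⊎_; inj₁; inj₂)
open import Data.Empty using (⊥; ⊥-elim)
open import Relation.Nullary using (¬_; yes; no; Dec; ofʸ; ofⁿ)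
open import Relation.Binary using (tri<; tri≈; tri>)
open import Relation.Nullary.Decidable using (⌊_⌋)
open import Relation.Binary.PropositionalEquality using (_≡_; _≢_; _≗_; refl; sym; trans; cong; cong₂; subst; subst₂; module ≡-Reasoning)
open import Function using (_∘_; case_of_)

-- Finite sums

-- Letters of the sorting word are read at sources for the following reason. A skipped letter of the
-- infinite word must already be sent to a negative root, and negativity spreads along arrows. So a
-- letter that is still used has only neighbours that are still used, and each of them recurs within
-- one round. Rotating by one letter preserves triangularity for two different reasons. Outside J
-- the letter acts by a reflection that transports E. At a position of J nothing is reflected and E
-- changes, but only by terms with a coefficient at α_s, and the other roots of J have none. One
-- flip formula, indexed by rotations, serves both halves: rotation 0 mutates c-vectors, and the
-- rotation that begins with b gives the b-th components of d-vectors. The latter are read off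
-- formal fractions with natural coefficients, where no terms cancel, so the order in x_b turns
-- products into sums and sums into maxima. Facets are carried along the mutation sequence by flips,
-- and the given I is compared with the result only at the end.

∑-cong : ∀ {n} {f g : Fin n → ℤ} → f ≗ g → ∑ f ≡ ∑ g
∑-cong {zero}  h = refl
∑-cong {suc n} h = cong₂ _+_ (h Fin.zero) (∑-cong (h ∘ Fin.suc))

∑-0 : ∀ {n} {f : Fin n → ℤ} → (∀ i → f i ≡ 0ℤ) → ∑ f ≡ 0ℤ
∑-0 {zero}  h = refl
∑-0 {suc n} h = cong₂ _+_ (h Fin.zero) (∑-0 (h ∘ Fin.suc))

interchange : ∀ a b c d → (a + b) + (c + d) ≡ (a + c) + (b + d)
interchange = solve-∀

∑-+ : ∀ {n} (f g : Fin n → ℤ) → ∑ (λ i → f i + g i) ≡ ∑ f + ∑ g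
∑-+ {zero}  f g = refl
∑-+ {suc n} f g = trans (cong (f Fin.zero + g Fin.zero +_) (∑-+ (f ∘ Fin.suc) (g ∘ Fin.suc))) (interchange (f Fin.zero) (g Fin.zero) (∑ (f ∘ Fin.suc)) (∑ (g ∘ Fin.suc)))

∑-*ˡ : ∀ {n} c (f : Fin n → ℤ) → ∑ (λ i → c * f i) ≡ c * ∑ f
∑-*ˡ {zero}  c f = sym (ℤP.*-zeroʳ c)
∑-*ˡ {suc n} c f = trans (cong (c * f Fin.zero +_) (∑-*ˡ c (f ∘ Fin.suc))) (sym (ℤP.*-distribˡ-+ c (f Fin.zero) (∑ (f ∘ Fin.suc))))

∑-swap : ∀ {m n} (f : Fin m → Fin n → ℤ) → ∑ (λ i → ∑ (f i)) ≡ ∑ (λ j → ∑ (λ i → f i j))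
∑-swap {zero}  {n} f = sym (∑-0 {n} (λ _ → refl))
∑-swap {suc m} f = trans (cong (∑ (f Fin.zero) +_) (∑-swap (f ∘ Fin.suc))) (sym (∑-+ (f Fin.zero) (λ j → ∑ (λ i → f (Fin.suc i) j))))

∑-≥0 : ∀ {n} {f : Fin n → ℤ} → (∀ i → 0ℤ ≤ f i) → 0ℤ ≤ ∑ f
∑-≥0 {zero}  h = ℤP.≤-refl
∑-≥0 {suc n} h = ℤP.+-mono-≤ (h Fin.zero) (∑-≥0 (h ∘ Fin.suc))

∑-≤0 : ∀ {n} {f : Fin n → ℤ} → (∀ i → f i ≤ 0ℤ) → ∑ f ≤ 0ℤ
∑-≤0 {zero}  h = ℤP.≤-refl
∑-≤0 {suc n} h = ℤP.+-mono-≤ (h Fin.zero) (∑-≤0 (h ∘ Fin.suc))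

δ : ∀ {n} → Fin n → Fin n → ℤ
δ t u = if ⌊ u ≟ t ⌋ then 1ℤ else 0ℤ

δ-same : ∀ {n} (t : Fin n) → δ t t ≡ 1ℤ
δ-same t with t ≟ t
... | yes _ = refl
... | no ¬p = ⊥-elim (¬p refl)

δ-diff : ∀ {n} {t u : Fin n} → u ≢ t → δ t u ≡ 0ℤ
δ-diff {t = t} {u} u≢t with u ≟ t
... | yes p = ⊥-elim (u≢t p)
... | no _  = refl

δ-suc : ∀ {n} (t u : Fin n) → δ (Fin.suc t) (Fin.suc u) ≡ δ t u
δ-suc t u with u ≟ t
... | yes _ = refl
... | no _  = refl

∑-δ : ∀ {n} (t : Fin n) (f : Fin n → ℤ) → ∑ (λ u → δ t u * f u) ≡ f t
∑-δ Fin.zero f = trans (cong₂ _+_ (ℤP.*-identityˡ (f Fin.zero)) (∑-0 (λ u → ℤP.*-zeroˡ (f (Fin.suc u))))) (ℤP.+-identityʳ (f Fin.zero))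
∑-δ (Fin.suc t) f = trans (ℤP.+-identityˡ _)
  (trans (∑-cong (λ u → cong (_* f (Fin.suc u)) (δ-suc t u))) (∑-δ t (f ∘ Fin.suc)))

-- Vectors and linear functionals

infixl 6 _+⟨_⟩_

_+⟨_⟩_ : ∀ {n} → Vect n → ℤ → Vect n → Vect n
(x +⟨ m ⟩ y) u = x u + m * y u

neg : ∀ {n} → Vect n → Vect n
neg x u = - x u

Pos Neg : ∀ {n} → Vect n → Set
Pos v = ∀ t → 0ℤ ≤ v t
Neg v = ∀ t → v t ≤ 0ℤ

≗-sym : ∀ {n} {x y : Vect n} → x ≗ y → y ≗ x
≗-sym h t = sym (h t)

≗-trans : ∀ {n} {x y z : Vect n} → x ≗ y → y ≗ z → x ≗ z
≗-trans h k t = trans (h t) (k t)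

Pos-cong : ∀ {n} {x y : Vect n} → x ≗ y → Pos x → Pos y
Pos-cong h p t = subst (0ℤ ≤_) (h t) (p t)

Neg-cong : ∀ {n} {x y : Vect n} → x ≗ y → Neg x → Neg y
Neg-cong h p t = subst (_≤ 0ℤ) (h t) (p t)

neg-Pos : ∀ {n} {x : Vect n} → Pos x → Neg (neg x)
neg-Pos p t = ℤP.neg-mono-≤ (p t)

neg-Neg : ∀ {n} {x : Vect n} → Neg x → Pos (neg x)
neg-Neg p t = ℤP.neg-mono-≤ (p t)

+⟨⟩-cong : ∀ {n} {x x' y y' : Vect n} {m m'} → x ≗ x' → m ≡ m' → y ≗ y' → (x +⟨ m ⟩ y) ≗ (x' +⟨ m' ⟩ y')
+⟨⟩-cong {m = m} h refl k t = cong₂ _+_ (h t) (cong (m *_) (k t))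

comb : ∀ {m n} → (Fin m → ℤ) → (Fin m → Vect n) → Vect n
comb c x t = ∑ (λ j → c j * x j t)

record Linear {n} (φ : Vect n → ℤ) : Set where
  field
    resp : ∀ {x y} → x ≗ y → φ x ≡ φ y
    lin  : ∀ x m y → φ (x +⟨ m ⟩ y) ≡ φ x + m * φ y

  at-neg : ∀ x → φ (neg x) ≡ - φ x
  at-neg x = trans (resp (λ t → arith (x t))) (trans (lin x (- int 2) x) (sym (arith (φ x))))
    where
    arith : ∀ z → - z ≡ z + - int 2 * z
    arith = solve-∀

  at-0 : φ (λ _ → 0ℤ) ≡ 0ℤ
  at-0 = trans (resp {y = (λ _ → 0ℤ) +⟨ -1ℤ ⟩ (λ _ → 0ℤ)} (λ _ → refl)) (trans (lin (λ _ → 0ℤ) -1ℤ (λ _ → 0ℤ)) (arith (φ (λ _ → 0ℤ))))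
    where
    arith : ∀ z → z + -1ℤ * z ≡ 0ℤ
    arith = solve-∀

  at-comb : ∀ {m} (c : Fin m → ℤ) x → φ (comb c x) ≡ ∑ (λ j → c j * φ (x j))
  at-comb {zero}  c x = at-0
  at-comb {suc m} c x = trans (resp (λ t → ℤP.+-comm (c Fin.zero * x Fin.zero t) _))
    (trans (lin (comb (c ∘ Fin.suc) (x ∘ Fin.suc)) (c Fin.zero) (x Fin.zero))
    (trans (cong (_+ c Fin.zero * φ (x Fin.zero)) (at-comb (c ∘ Fin.suc) (x ∘ Fin.suc))) (ℤP.+-comm _ (c Fin.zero * φ (x Fin.zero)))))

open Linear public

LinearMap : ∀ {n} → (Vect n → Vect n) → Set
LinearMap f = ∀ t → Linear (λ v → f v t)

coord : ∀ {n} (t : Fin n) → Linear {n} (λ v → v t)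
coord t .resp h = h t
coord t .lin x m y = refl

_∘L_ : ∀ {n} {φ : Vect n → ℤ} {f} → Linear φ → LinearMap f → Linear (λ v → φ (f v))
(L ∘L F) .resp h = resp L (λ t → resp (F t) h)
(L ∘L F) .lin x m y = trans (resp L (λ t → lin (F t) x m y)) (lin L _ m _)

-- Bilinear forms

Form : ∀ {n} → (Fin n → Fin n → ℤ) → Vect n → Vect n → ℤ
Form M x y = ∑ (λ s → ∑ (λ t → x s * M s t * y t))

Form-linʳ : ∀ {n} (M : Fin n → Fin n → ℤ) x → Linear (Form M x)
Form-linʳ M x .resp h = ∑-cong λ s → ∑-cong λ t → cong (x s * M s t *_) (h t)
Form-linʳ M x .lin y m z = begin
  ∑ (λ s → ∑ (λ t → x s * M s t * (y t + m * z t)))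
    ≡⟨ ∑-cong (λ s → ∑-cong λ t → arith (x s * M s t) (y t) m (z t)) ⟩
  ∑ (λ s → ∑ (λ t → x s * M s t * y t + m * (x s * M s t * z t)))
    ≡⟨ ∑-cong (λ s → trans (∑-+ (λ t → x s * M s t * y t) _) (cong (∑ (λ t → x s * M s t * y t) +_) (∑-*ˡ m (λ t → x s * M s t * z t)))) ⟩
  ∑ (λ s → ∑ (λ t → x s * M s t * y t) + m * ∑ (λ t → x s * M s t * z t))
    ≡⟨ trans (∑-+ (λ s → ∑ (λ t → x s * M s t * y t)) _) (cong (Form M x y +_) (∑-*ˡ m (λ s → ∑ (λ t → x s * M s t * z t)))) ⟩
  Form M x y + m * Form M x z ∎
  where
  open ≡-Reasoning
  arith : ∀ c y m z → c * (y + m * z) ≡ c * y + m * (c * z)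
  arith = solve-∀

Form-flip : ∀ {n} (M : Fin n → Fin n → ℤ) x y → Form M x y ≡ Form (λ s t → M t s) y x
Form-flip M x y = trans (∑-swap (λ s t → x s * M s t * y t)) (∑-cong λ t → ∑-cong λ s → arith (x s) (M s t) (y t))
  where
  arith : ∀ x m y → x * m * y ≡ y * m * x
  arith = solve-∀

Form-linˡ : ∀ {n} (M : Fin n → Fin n → ℤ) y → Linear (λ x → Form M x y)
Form-linˡ M y .resp {x} {x'} h = trans (Form-flip M x y) (trans (resp (Form-linʳ (λ s t → M t s) y) h) (sym (Form-flip M x' y)))
Form-linˡ M y .lin x m z = trans (Form-flip M _ y) (trans (lin (Form-linʳ (λ s t → M t s) y) x m z)
  (sym (cong₂ (λ p q → p + m * q) (Form-flip M x y) (Form-flip M z y))))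

Form-congM : ∀ {n} {M M' : Fin n → Fin n → ℤ} → (∀ s t → M s t ≡ M' s t) → ∀ x y → Form M x y ≡ Form M' x y
Form-congM h x y = ∑-cong λ s → ∑-cong λ t → cong (λ m → x s * m * y t) (h s t)

Form-+M : ∀ {n} (M M' : Fin n → Fin n → ℤ) x y → Form (λ s t → M s t + M' s t) x y ≡ Form M x y + Form M' x y
Form-+M M M' x y = trans (∑-cong λ s → trans (∑-cong λ t → arith (x s) (M s t) (M' s t) (y t)) (∑-+ (λ t → x s * M s t * y t) _))
  (∑-+ (λ s → ∑ (λ t → x s * M s t * y t)) _)
  where
  arith : ∀ x m m' y → x * (m + m') * y ≡ x * m * y + x * m' * y
  arith = solve-∀

Form-δˡ : ∀ {n} (M : Fin n → Fin n → ℤ) s y → Form M (δ s) y ≡ ∑ (λ t → M s t * y t)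
Form-δˡ M s y = trans (∑-cong λ u → trans (∑-cong λ t → ℤP.*-assoc (δ s u) (M u t) (y t)) (∑-*ˡ (δ s u) (λ t → M u t * y t)))
  (∑-δ s (λ u → ∑ (λ t → M u t * y t)))

Form-δʳ : ∀ {n} (M : Fin n → Fin n → ℤ) x t → Form M x (δ t) ≡ ∑ (λ s → M s t * x s)
Form-δʳ M x t = trans (Form-flip M x (δ t)) (Form-δˡ (λ s t → M t s) t x)

Form-rowM : ∀ {n} (s : Fin n) (c : Vect n) x y → Form (λ u t → δ s u * c t) x y ≡ x s * ∑ (λ t → c t * y t)
Form-rowM s c x y = trans (∑-cong λ u → trans (∑-cong λ t → arith (x u) (δ s u) (c t) (y t)) (∑-*ˡ (δ s u * x u) (λ t → c t * y t)))
  (trans (∑-cong λ u → ℤP.*-assoc (δ s u) (x u) _) (∑-δ s (λ u → x u * ∑ (λ t → c t * y t))))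
  where
  arith : ∀ x d c y → x * (d * c) * y ≡ d * x * (c * y)
  arith = solve-∀

Form-colM : ∀ {n} (s : Fin n) (c : Vect n) x y → Form (λ t u → δ s u * c t) x y ≡ y s * ∑ (λ t → c t * x t)
Form-colM s c x y = trans (Form-flip _ x y) (Form-rowM s c y x)

-- Signs

0≤* : ∀ {x y} → 0ℤ ≤ x → 0ℤ ≤ y → 0ℤ ≤ x * y
0≤* {int m} {int k} _ _ = subst (0ℤ ≤_) (ℤP.pos-* m k) (+≤+ ℕ.z≤n)

0≤+ : ∀ {x y} → 0ℤ ≤ x → 0ℤ ≤ y → 0ℤ ≤ x + y
0≤+ = ℤP.+-mono-≤

≤0+ : ∀ {x y} → x ≤ 0ℤ → y ≤ 0ℤ → x + y ≤ 0ℤ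
≤0+ = ℤP.+-mono-≤

0≤- : ∀ {x} → x ≤ 0ℤ → 0ℤ ≤ - x
0≤- = ℤP.neg-mono-≤

-≤0 : ∀ {x} → 0ℤ ≤ x → - x ≤ 0ℤ
-≤0 = ℤP.neg-mono-≤

*≤0 : ∀ {x y} → 0ℤ ≤ x → y ≤ 0ℤ → x * y ≤ 0ℤ
*≤0 {x} {y} p q = subst (_≤ 0ℤ) (arith x y) (-≤0 (0≤* p (0≤- q)))
  where
  arith : ∀ x y → - (x * - y) ≡ x * y
  arith = solve-∀

≤0* : ∀ {x y} → x ≤ 0ℤ → 0ℤ ≤ y → x * y ≤ 0ℤ
≤0* {x} {y} p q = subst (_≤ 0ℤ) (ℤP.*-comm y x) (*≤0 q p)

≤≥⇒≡0 : ∀ {x} → x ≤ 0ℤ → 0ℤ ≤ x → x ≡ 0ℤ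
≤≥⇒≡0 = ℤP.≤-antisym

cancel-pos : ∀ {c x y} → 0ℤ < c → c * x ≡ c * y → x ≡ y
cancel-pos {int (suc m)} {x} {y} _ h = ℤP.*-cancelˡ-≡ (int (suc m)) x y h
cancel-pos {int zero} (+<+ ()) _

cancel-≤0 : ∀ {c x} → 0ℤ < c → c * x ≤ 0ℤ → x ≤ 0ℤ
cancel-≤0 {int (suc m)} {int zero} _ h = ℤP.≤-refl
cancel-≤0 {int (suc m)} {int (suc k)} _ (+≤+ ())
cancel-≤0 {int (suc m)} { -[1+ k ]} _ h = -≤+
cancel-≤0 {int zero} (+<+ ()) _

cancel-0≤ : ∀ {c x} → 0ℤ < c → 0ℤ ≤ c * x → 0ℤ ≤ x
cancel-0≤ {int (suc m)} {int k} _ h = +≤+ ℕ.z≤n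
cancel-0≤ {int (suc m)} { -[1+ k ]} _ ()
cancel-0≤ {int zero} (+<+ ()) _

<⇒≤ : ∀ {x y : ℤ} → x < y → x ≤ y
<⇒≤ = ℤP.<⇒≤

total0 : ∀ x → 0ℤ ≤ x ⊎ x < 0ℤ
total0 (int m) = inj₁ (+≤+ ℕ.z≤n)
total0 -[1+ m ] = inj₂ ℤ.-<+

Signed : ∀ {n} → Vect n → Set
Signed v = Pos v ⊎ Neg v

Signed-cong : ∀ {n} {x y : Vect n} → x ≗ y → Signed x → Signed y
Signed-cong h (inj₁ p) = inj₁ (Pos-cong h p)
Signed-cong h (inj₂ p) = inj₂ (Neg-cong h p)

Signed-neg : ∀ {n} {x : Vect n} → Signed x → Signed (neg x)
Signed-neg (inj₁ p) = inj₂ (neg-Pos p)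
Signed-neg (inj₂ p) = inj₁ (neg-Neg p)

δ-Pos : ∀ {n} (s : Fin n) → Pos (δ s)
δ-Pos s u with u ≟ s
... | yes _ = +≤+ ℕ.z≤n
... | no _  = ℤP.≤-refl

-- Root system: invariant form, reflections, sign dichotomy and exchange

module Roots {n : ℕ} (a : CartanMatrix n) (fin : IsFiniteCartan a) where

  open IsFiniteCartan fin

  dZ : Fin n → ℤ
  dZ s = int (d s)

  0<d : ∀ s → 0ℤ < dZ s
  0<d s = +<+ (d-pos s)

  reflect : Fin n → Vect n → Vect n
  reflect = Defs.refl a

  abstract
    -- The pairing ⟨v, α_t^∨⟩ with a simple coroot. It is abstract so that it stays an atom in ring
    -- identities.
    A : Fin n → Vect n → ℤ
    A t v = ∑ (λ w → a t w * v w)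

    A-def : ∀ t v → A t v ≡ ∑ (λ w → a t w * v w)
    A-def t v = refl

    A-linear : ∀ t → Linear (A t)
    A-linear t .resp h = ∑-cong λ w → cong (a t w *_) (h w)
    A-linear t .lin x m y = trans (∑-cong λ w → arith (a t w) (x w) m (y w))
      (trans (∑-+ (λ w → a t w * x w) (λ w → m * (a t w * y w))) (cong (A t x +_) (∑-*ˡ m (λ w → a t w * y w))))
      where
      arith : ∀ c x m y → c * (x + m * y) ≡ c * x + m * (c * y)
      arith = solve-∀

    reflect-eq : ∀ t v → reflect t v ≗ (v +⟨ - A t v ⟩ δ t)
    reflect-eq t v u with u ≟ t
    ... | yes _ = arith (v u) (A t v)
      where
      arith : ∀ x y → x - y ≡ x + - y * 1ℤ
      arith = solve-∀
    ... | no _ = arith (v u) (A t v)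
      where
      arith : ∀ x y → x ≡ x + - y * 0ℤ
      arith = solve-∀

  A-δ : ∀ t s → A t (δ s) ≡ a t s
  A-δ t s = trans (A-def t (δ s)) (trans (∑-cong λ w → ℤP.*-comm (a t w) (δ s w)) (∑-δ s (a t)))

  reflect-off : ∀ {t u} v → u ≢ t → reflect t v u ≡ v u
  reflect-off {t} {u} v u≢t with u ≟ t
  ... | yes p = ⊥-elim (u≢t p)
  ... | no _ = refl

  reflect-linear : ∀ t → LinearMap (reflect t)
  reflect-linear t u .resp {x} {y} h = trans (reflect-eq t x u)
    (trans (+⟨⟩-cong {y = δ t} {y' = δ t} {m' = - A t y} h (cong -_ (resp (A-linear t) h)) (λ _ → refl) u) (sym (reflect-eq t y u)))
  reflect-linear t u .lin x m y = trans (reflect-eq t (x +⟨ m ⟩ y) u) (trans (cong (λ z → x u + m * y u + - z * δ t u) (lin (A-linear t) x m y))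
    (trans (arith (x u) m (y u) (A t x) (A t y) (δ t u)) (sym (cong₂ (λ p q → p + m * q) (reflect-eq t x u) (reflect-eq t y u)))))
    where
    arith : ∀ x m y p q e → x + m * y + - (p + m * q) * e ≡ (x + - p * e) + m * (y + - q * e)
    arith = solve-∀

  reflect-cong : ∀ t {x y} → x ≗ y → reflect t x ≗ reflect t y
  reflect-cong t h u = resp (reflect-linear t u) h

  act-linear : ∀ w → LinearMap (act a w)
  act-linear [] t = coord t
  act-linear (q ∷ w) t = reflect-linear q t ∘L act-linear w

  act-cong : ∀ w {x y} → x ≗ y → act a w x ≗ act a w y
  act-cong w h u = resp (act-linear w u) h

  act-++ : ∀ w w' v → act a (w ++ w') v ≗ act a w (act a w' v)
  act-++ [] w' v u = refl
  act-++ (q ∷ w) w' v = reflect-cong q (act-++ w w' v)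

  A-reflect : ∀ t v → A t (reflect t v) ≡ - A t v
  A-reflect t v = trans (resp (A-linear t) (reflect-eq t v)) (trans (lin (A-linear t) v (- A t v) (δ t))
    (trans (cong (λ z → A t v + - A t v * z) (trans (A-δ t t) (diag t))) (arith (A t v))))
    where
    arith : ∀ x → x + - x * int 2 ≡ - x
    arith = solve-∀

  reflect-invol : ∀ t v → reflect t (reflect t v) ≗ v
  reflect-invol t v u = trans (reflect-eq t (reflect t v) u) (trans (cong₂ (λ p q → p + - q * δ t u) (reflect-eq t v u) (A-reflect t v))
    (arith (v u) (A t v) (δ t u)))
    where
    arith : ∀ x p e → x + - p * e + - - p * e ≡ x
    arith = solve-∀

  reflect-δ : ∀ t → reflect t (δ t) ≗ neg (δ t)
  reflect-δ t u = trans (reflect-eq t (δ t) u) (trans (cong (λ z → δ t u + - z * δ t u) (trans (A-δ t t) (diag t))) (arith (δ t u)))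
    where
    arith : ∀ x → x + - int 2 * x ≡ - x
    arith = solve-∀

  unact : List (Fin n) → Vect n → Vect n
  unact [] v = v
  unact (q ∷ w) v = unact w (reflect q v)

  unact-linear : ∀ w → LinearMap (unact w)
  unact-linear [] t = coord t
  unact-linear (q ∷ w) t = unact-linear w t ∘L reflect-linear q

  unact-act : ∀ w v → unact w (act a w v) ≗ v
  unact-act [] v u = refl
  unact-act (q ∷ w) v u = trans (resp (unact-linear w u) (reflect-invol q (act a w v))) (unact-act w v u)

  act-unact : ∀ w v → act a w (unact w v) ≗ v
  act-unact [] v u = refl
  act-unact (q ∷ w) v u = trans (reflect-cong q (act-unact w (reflect q v)) u) (reflect-invol q v u)

  -- The invariant form, scaled so that ⟨α_s , α_s⟩ = 2 d_s.

  S : Fin n → Fin n → ℤ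
  S s t = dZ s * a s t

  abstract
    ⟨_,_⟩ : Vect n → Vect n → ℤ
    ⟨ x , y ⟩ = Form S x y

    ⟨⟩-def : ∀ x y → ⟨ x , y ⟩ ≡ Form S x y
    ⟨⟩-def x y = refl

    ⟨⟩-sym : ∀ x y → ⟨ x , y ⟩ ≡ ⟨ y , x ⟩
    ⟨⟩-sym x y = trans (Form-flip S x y) (Form-congM (λ s t → symm t s) y x)

    ⟨⟩-linˡ : ∀ y → Linear (λ x → ⟨ x , y ⟩)
    ⟨⟩-linˡ = Form-linˡ S

    ⟨⟩-linʳ : ∀ x → Linear ⟨ x ,_⟩
    ⟨⟩-linʳ = Form-linʳ S

  ⟨⟩-cong : ∀ {x x' y y'} → x ≗ x' → y ≗ y' → ⟨ x , y ⟩ ≡ ⟨ x' , y' ⟩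
  ⟨⟩-cong {x} {x'} {y} {y'} h k = trans (resp (⟨⟩-linˡ y) h) (resp (⟨⟩-linʳ x') k)

  ⟨δ,⟩ : ∀ s y → ⟨ δ s , y ⟩ ≡ dZ s * A s y
  ⟨δ,⟩ s y = trans (⟨⟩-def (δ s) y) (trans (Form-δˡ S s y) (trans (∑-cong λ t → ℤP.*-assoc (dZ s) (a s t) (y t))
    (trans (∑-*ˡ (dZ s) (λ t → a s t * y t)) (cong (dZ s *_) (sym (A-def s y))))))

  ⟨,δ⟩ : ∀ y s → ⟨ y , δ s ⟩ ≡ dZ s * A s y
  ⟨,δ⟩ y s = trans (⟨⟩-sym y (δ s)) (⟨δ,⟩ s y)

  reflect-isom : ∀ t x y → ⟨ reflect t x , reflect t y ⟩ ≡ ⟨ x , y ⟩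
  reflect-isom t x y = begin
    ⟨ reflect t x , reflect t y ⟩ ≡⟨ ⟨⟩-cong (reflect-eq t x) (reflect-eq t y) ⟩
    ⟨ x +⟨ - A t x ⟩ δ t , y +⟨ - A t y ⟩ δ t ⟩ ≡⟨ lin (⟨⟩-linˡ (y +⟨ - A t y ⟩ δ t)) x (- A t x) (δ t) ⟩
    ⟨ x , y +⟨ - A t y ⟩ δ t ⟩ + - A t x * ⟨ δ t , y +⟨ - A t y ⟩ δ t ⟩
      ≡⟨ cong₂ (λ p q → p + - A t x * q) (lin (⟨⟩-linʳ x) y (- A t y) (δ t)) (lin (⟨⟩-linʳ (δ t)) y (- A t y) (δ t)) ⟩
    (⟨ x , y ⟩ + - A t y * ⟨ x , δ t ⟩) + - A t x * (⟨ δ t , y ⟩ + - A t y * ⟨ δ t , δ t ⟩)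
      ≡⟨ cong₂ (λ p q → (⟨ x , y ⟩ + - A t y * p) + - A t x * q) (⟨,δ⟩ x t)
          (cong₂ (λ p q → p + - A t y * q) (⟨δ,⟩ t y) (trans (⟨δ,⟩ t (δ t)) (cong (dZ t *_) (trans (A-δ t t) (diag t))))) ⟩
    (⟨ x , y ⟩ + - A t y * (dZ t * A t x)) + - A t x * (dZ t * A t y + - A t y * (dZ t * int 2))
      ≡⟨ arith ⟨ x , y ⟩ (A t y) (dZ t) (A t x) ⟩
    ⟨ x , y ⟩ ∎
    where
    open ≡-Reasoning
    arith : ∀ f p d q → (f + - p * (d * q)) + - q * (d * p + - p * (d * int 2)) ≡ f
    arith = solve-∀

  act-isom : ∀ w x y → ⟨ act a w x , act a w y ⟩ ≡ ⟨ x , y ⟩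
  act-isom [] x y = refl
  act-isom (q ∷ w) x y = trans (reflect-isom q _ _) (act-isom w x y)

  norm-δ : ∀ s → ⟨ δ s , δ s ⟩ ≡ int 2 * dZ s
  norm-δ s = trans (⟨δ,⟩ s (δ s)) (trans (cong (dZ s *_) (trans (A-δ s s) (diag s))) (ℤP.*-comm (dZ s) (int 2)))

  -- Roots

  Root : Vect n → Set
  Root = InPhi a

  Root-δ : ∀ s → Root (δ s)
  Root-δ s = [] , s , λ _ → refl

  Root-cong : ∀ {x y} → x ≗ y → Root x → Root y
  Root-cong h (w , t , k) = w , t , ≗-trans k h

  Root-reflect : ∀ q {x} → Root x → Root (reflect q x)
  Root-reflect q (w , t , k) = q ∷ w , t , reflect-cong q k

  Root-act : ∀ w {x} → Root x → Root (act a w x)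
  Root-act [] r = r
  Root-act (q ∷ w) r = Root-reflect q (Root-act w r)

  Root-unact : ∀ w {x} → Root x → Root (unact w x)
  Root-unact [] r = r
  Root-unact (q ∷ w) r = Root-unact w (Root-reflect q r)

  Root-neg : ∀ {x} → Root x → Root (neg x)
  Root-neg {x} (w , t , k) = w ++ t ∷ [] , t , λ u → trans (act-++ w (t ∷ []) (δ t) u)
    (trans (act-cong w (reflect-δ t) u) (trans (at-neg (act-linear w u) (δ t)) (cong -_ (k u))))

  Root-norm : ∀ {x} → Root x → 0ℤ < ⟨ x , x ⟩
  Root-norm {x} (w , t , k) = subst (0ℤ <_) (sym (trans (sym (⟨⟩-cong k k)) (trans (act-isom w (δ t) (δ t)) (norm-δ t))))
    (subst (_< int 2 * dZ t) (ℤP.*-zeroʳ (int 2)) (ℤP.*-monoˡ-<-pos (int 2) (0<d t)))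

  Root-not-both : ∀ {x} → Root x → Pos x → Neg x → ⊥
  Root-not-both {x} r p q = ℤP.<-irrefl (sym (trans (⟨⟩-cong {x} {λ _ → 0ℤ} {x} {x} (λ t → ≤≥⇒≡0 (q t) (p t)) (λ _ → refl)) (at-0 (⟨⟩-linˡ x)))) (Root-norm r)

  -- Since `x` is `w` applied to a simple root, `unact w` returns that simple root as `x q` times an
  -- integral vector; hence `x q` divides 1.
  multiple-of-simple : ∀ {x q} → Root x → Pos x → (∀ t → t ≢ q → x t ≡ 0ℤ) → x ≗ δ q
  multiple-of-simple {x} {q} (w , t , k) p z = ≗-trans x≗ (λ u → trans (cong (_* δ q u) (unit (p q) prod)) (ℤP.*-identityˡ _))
    where
    x≗ : x ≗ (λ u → x q * δ q u)
    x≗ u with u ≟ q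
    ... | yes refl = sym (ℤP.*-identityʳ (x u))
    ... | no u≢q = trans (z u u≢q) (sym (ℤP.*-zeroʳ (x q)))
    scaled : (λ u → x q * δ q u) ≗ (λ _ → 0ℤ) +⟨ x q ⟩ δ q
    scaled u = sym (ℤP.+-identityˡ _)
    prod : x q * unact w (δ q) t ≡ 1ℤ
    prod = begin
      x q * unact w (δ q) t ≡⟨ sym (ℤP.+-identityˡ _) ⟩
      0ℤ + x q * unact w (δ q) t ≡⟨ cong (_+ x q * unact w (δ q) t) (sym (at-0 (unact-linear w t))) ⟩
      unact w (λ _ → 0ℤ) t + x q * unact w (δ q) t ≡⟨ sym (lin (unact-linear w t) (λ _ → 0ℤ) (x q) (δ q)) ⟩
      unact w ((λ _ → 0ℤ) +⟨ x q ⟩ δ q) t ≡⟨ sym (resp (unact-linear w t) (≗-trans k (≗-trans x≗ scaled))) ⟩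
      unact w (act a w (δ t)) t ≡⟨ unact-act w (δ t) t ⟩
      δ t t ≡⟨ δ-same t ⟩
      1ℤ ∎
      where open ≡-Reasoning
    unit : ∀ {m k} → 0ℤ ≤ m → m * k ≡ 1ℤ → m ≡ 1ℤ
    unit {int m} {k} _ h = cong int (ℕP.m*n≡1⇒m≡1 m ℤ.∣ k ∣ (trans (sym (ℤP.abs-* (int m) k)) (cong ℤ.∣_∣ h)))

  -- A simple reflection changes only its own coordinate, so a positive root that it makes negative
  -- has all other coordinates zero.
  only-simple : ∀ {x q} → Root x → Pos x → Neg (reflect q x) → x ≗ δ q
  only-simple {x} {q} r p m = multiple-of-simple r p λ t t≢q → ≤≥⇒≡0 (subst (_≤ 0ℤ) (reflect-off x t≢q) (m t)) (p t)

  -- An isometry carries the reflection in a vector to the reflection in its image; equal norms give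
  -- equal `dZ`, so the coroot pairings agree.
  conj : ∀ y {s q} → act a y (δ s) ≗ δ q → ∀ v → reflect q (act a y v) ≗ act a y (reflect s v)
  conj y {s} {q} h v u = begin
    reflect q (act a y v) u ≡⟨ reflect-eq q (act a y v) u ⟩
    act a y v u + - A q (act a y v) * δ q u ≡⟨ cong₂ (λ p r → act a y v u + - p * r) A≡ (sym (h u)) ⟩
    act a y v u + - A s v * act a y (δ s) u ≡⟨ sym (lin (act-linear y u) v (- A s v) (δ s)) ⟩
    act a y (v +⟨ - A s v ⟩ δ s) u ≡⟨ sym (act-cong y (reflect-eq s v) u) ⟩
    act a y (reflect s v) u ∎
    where
    open ≡-Reasoning
    d≡ : dZ q ≡ dZ s
    d≡ = cancel-pos {int 2} (+<+ (ℕ.s≤s ℕ.z≤n)) (trans (sym (norm-δ q)) (trans (sym (⟨⟩-cong h h)) (trans (act-isom y (δ s) (δ s)) (norm-δ s))))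
    A≡ : A q (act a y v) ≡ A s v
    A≡ = cancel-pos (0<d q) (trans (sym (⟨δ,⟩ q _)) (trans (sym (⟨⟩-cong h (λ _ → refl)))
      (trans (act-isom y (δ s) v) (trans (⟨δ,⟩ s v) (cong (_* A s v) (sym d≡))))))

  private
    -- The sign dichotomy and the exchange property rely on each other; bounding the length of words
    -- turns the circle into an induction.
    SignedUpTo : ℕ → Set
    SignedUpTo m = ∀ w s → length w ℕ.≤ m → Signed (act a w (δ s))

    -- Strip letters from the left up to the letter `q` at which the root turns negative. The word
    -- after it sends α_s to α_q, so by `conj` the letter `q` cancels against the appended `s`.
    exchange′ : ∀ w s → SignedUpTo (length w) → Neg (act a w (δ s)) →
      ∃ λ w' → (suc (length w') ≡ length w) × (∀ v → act a w (reflect s v) ≗ act a w' v)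
    exchange′ [] s H m = ⊥-elim (Root-not-both (Root-δ s) (δ-Pos s) m)
    exchange′ (q ∷ w) s H m with H w s (ℕP.n≤1+n _)
    ... | inj₁ p = w , refl , λ v u → trans (reflect-cong q (≗-sym (conj w (only-simple (Root-act w (Root-δ s)) p m) v)) u)
                                       (reflect-invol q _ u)
    ... | inj₂ m' with exchange′ w s (λ w' t l → H w' t (ℕP.m≤n⇒m≤1+n l)) m'
    ...   | w' , l , E = q ∷ w' , cong suc l , λ v → reflect-cong q (E v)

    two : ℤ → Fin n → ℤ → Fin n → Vect n
    two x s y t u = x * δ s u + y * δ t u

    two-norm : ∀ x s y t → ⟨ two x s y t , two x s y t ⟩ ≡ int 2 * (dZ s * (x * x) + dZ t * (y * y) + x * y * (dZ s * a s t))
    two-norm x s y t = trans (⟨⟩-cong eq eq) (trans (lin (⟨⟩-linˡ ((λ u → 0ℤ + x * δ s u) +⟨ y ⟩ δ t)) (λ u → 0ℤ + x * δ s u) y (δ t))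
      (trans (cong₂ (λ p q → p + y * q) (expand (λ u → 0ℤ + x * δ s u)) (expand (δ t)))
      (trans (cong₂ (λ p q → p + y * q)
        (cong₂ (λ p q → x * p + y * q) (first (δ s)) (first (δ t)))
        (cong₂ (λ p q → x * p + y * q) (⟨⟩-sym (δ t) (δ s)) (norm-δ t)))
      (trans (cong₂ (λ p q → x * (x * p) + y * (x * q) + y * (x * q + y * (int 2 * dZ t))) (norm-δ s) (trans (⟨δ,⟩ s (δ t)) (cong (dZ s *_) (A-δ s t))))
        (arith x y (dZ s) (dZ t) (a s t))))))
      where
      eq : two x s y t ≗ ((λ u → 0ℤ + x * δ s u) +⟨ y ⟩ δ t)
      eq u = cong (_+ y * δ t u) (sym (ℤP.+-identityˡ (x * δ s u)))
      first : ∀ z → ⟨ (λ u → 0ℤ + x * δ s u) , z ⟩ ≡ x * ⟨ δ s , z ⟩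
      first z = trans (lin (⟨⟩-linˡ z) (λ _ → 0ℤ) x (δ s)) (trans (cong (_+ x * ⟨ δ s , z ⟩) (at-0 (⟨⟩-linˡ z))) (ℤP.+-identityˡ (x * ⟨ δ s , z ⟩)))
      second : ∀ z → ⟨ z , (λ u → 0ℤ + x * δ s u) ⟩ ≡ x * ⟨ z , δ s ⟩
      second z = trans (⟨⟩-sym z _) (trans (first z) (cong (x *_) (⟨⟩-sym (δ s) z)))
      expand : ∀ z → ⟨ z , (λ u → 0ℤ + x * δ s u) +⟨ y ⟩ δ t ⟩ ≡ x * ⟨ z , δ s ⟩ + y * ⟨ z , δ t ⟩
      expand z = trans (lin (⟨⟩-linʳ z) (λ u → 0ℤ + x * δ s u) y (δ t)) (cong (_+ y * ⟨ z , δ t ⟩) (second z))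
      arith : ∀ x y ds dt c → x * (x * (int 2 * ds)) + y * (x * (ds * c)) + y * (x * (ds * c) + y * (int 2 * dt))
        ≡ int 2 * (ds * (x * x) + dt * (y * y) + x * y * (ds * c))
      arith = solve-∀

    -- Coefficients of opposite signs make the norm at least 2 d_s + 2 d_t.
    mixed : ∀ {x y s t} → 0ℤ < x → y < 0ℤ → s ≢ t →
      let N = int 2 * (dZ s * (x * x) + dZ t * (y * y) + x * y * (dZ s * a s t)) in
      N ≡ int 2 * dZ s ⊎ N ≡ int 2 * dZ t → ⊥
    mixed {int zero} (+<+ ())
    mixed {int (suc k)} {int l} _ (+<+ ())
    mixed {int (suc k)} { -[1+ l ]} {s} {t} _ _ s≢t h = clash h
      where
      x' y' c p ds dt : ℤ
      x' = int k
      y' = int l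
      ds = dZ s
      dt = dZ t
      c = - (ds * a s t)
      p = ds * (x' * x' + int 2 * x') + dt * (y' * y' + int 2 * y') + (1ℤ + x') * (1ℤ + y') * c
      0≤c : 0ℤ ≤ c
      0≤c = 0≤- (*≤0 (<⇒≤ (0<d s)) (offdiag s t s≢t))
      sq : ∀ m → 0ℤ ≤ int m * int m + int 2 * int m
      sq m = 0≤+ (0≤* {int m} {int m} (+≤+ ℕ.z≤n) (+≤+ ℕ.z≤n)) (0≤* {int 2} {int m} (+≤+ ℕ.z≤n) (+≤+ ℕ.z≤n))
      0≤p : 0ℤ ≤ p
      0≤p = 0≤+ (0≤+ (0≤* (<⇒≤ (0<d s)) (sq k)) (0≤* (<⇒≤ (0<d t)) (sq l))) (0≤* {(1ℤ + x') * (1ℤ + y')} (0≤* {1ℤ + x'} {1ℤ + y'} (+≤+ ℕ.z≤n) (+≤+ ℕ.z≤n)) 0≤c)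
      norm≡ : ∀ x y ds dt c → int 2 * (ds * ((1ℤ + x) * (1ℤ + x)) + dt * (- (1ℤ + y) * - (1ℤ + y)) + (1ℤ + x) * - (1ℤ + y) * c)
        ≡ int 2 * (ds + dt + (ds * (x * x + int 2 * x) + dt * (y * y + int 2 * y) + (1ℤ + x) * (1ℤ + y) * - c))
      norm≡ = solve-∀
      two>0 : 0ℤ < int 2
      two>0 = +<+ (ℕ.s≤s ℕ.z≤n)
      clash : _ → ⊥
      clash (inj₁ e) = ℤP.<-irrefl (sym (cancel-pos two>0 (trans (sym (norm≡ x' y' ds dt (ds * a s t))) e)))
        (subst₂ _<_ (ℤP.+-identityʳ ds) (sym (ℤP.+-assoc ds dt p)) (ℤP.+-monoʳ-< ds (ℤP.+-mono-<-≤ (0<d t) 0≤p)))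
      clash (inj₂ e) = ℤP.<-irrefl (sym (cancel-pos two>0 (trans (sym (norm≡ x' y' ds dt (ds * a s t))) e)))
        (subst₂ _<_ (ℤP.+-identityʳ dt) (swap ds dt p) (ℤP.+-monoʳ-< dt (ℤP.+-mono-<-≤ (0<d s) 0≤p)))
        where
        swap : ∀ x y z → y + (x + z) ≡ x + y + z
        swap = solve-∀

    -- Stands for the roots of the rank two subsystem of s and t: integral combinations with the
    -- norm of one of the two simple roots, a condition that both reflections preserve.
    InPlane : Fin n → Fin n → Vect n → Set
    InPlane s t v = (∃₂ λ x y → v ≗ two x s y t) × (⟨ v , v ⟩ ≡ int 2 * dZ s ⊎ ⟨ v , v ⟩ ≡ int 2 * dZ t)

    plane-swap : ∀ {s t v} → InPlane s t v → InPlane t s v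
    plane-swap {s} {t} ((x , y , h) , inj₁ e) = (y , x , λ u → trans (h u) (ℤP.+-comm (x * δ s u) (y * δ t u))) , inj₂ e
    plane-swap {s} {t} ((x , y , h) , inj₂ e) = (y , x , λ u → trans (h u) (ℤP.+-comm (x * δ s u) (y * δ t u))) , inj₁ e

    plane-δ : ∀ s t → InPlane s t (δ s)
    plane-δ s t = (1ℤ , 0ℤ , λ u → arith (δ s u) (δ t u)) , inj₁ (norm-δ s)
      where
      arith : ∀ x y → x ≡ 1ℤ * x + 0ℤ * y
      arith = solve-∀

    plane-reflect : ∀ {s t v} → InPlane s t v → InPlane s t (reflect s v)
    plane-reflect {s} {t} {v} ((x , y , h) , e) =
      (x - A s v , y , λ u → trans (reflect-eq s v u) (trans (cong (_+ - A s v * δ s u) (h u)) (arith x (δ s u) y (δ t u) (A s v)))) ,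
      subst (λ N → N ≡ int 2 * dZ s ⊎ N ≡ int 2 * dZ t) (sym (reflect-isom s v v)) e
      where
      arith : ∀ x p y q k → x * p + y * q + - k * p ≡ (x - k) * p + y * q
      arith = solve-∀

    plane-reflect′ : ∀ {s t v} → InPlane s t v → InPlane s t (reflect t v)
    plane-reflect′ r = plane-swap (plane-reflect (plane-swap r))

    -- By `mixed` the coefficients of `v` do not have opposite signs, so the image combines two
    -- positive vectors with coefficients of one sign.
    combine : ∀ w {s t} → s ≢ t → Pos (act a w (δ s)) → Pos (act a w (δ t)) → ∀ {v} → InPlane s t v → Signed (act a w v)
    combine w {s} {t} s≢t p q {v} ((x , y , h) , e) = Signed-cong (≗-sym image) (go x y e')
      where
      image : act a w v ≗ (λ u → x * act a w (δ s) u + y * act a w (δ t) u)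
      image u = trans (act-cong w (λ r → trans (h r) (cong (_+ y * δ t r) (sym (ℤP.+-identityˡ (x * δ s r))))) u)
        (trans (lin (act-linear w u) (λ r → 0ℤ + x * δ s r) y (δ t))
        (cong (_+ y * act a w (δ t) u) (trans (lin (act-linear w u) (λ _ → 0ℤ) x (δ s))
          (trans (cong (_+ x * act a w (δ s) u) (at-0 (act-linear w u))) (ℤP.+-identityˡ (x * act a w (δ s) u))))))
      Good : ℤ → ℤ → Set
      Good x y = let N = int 2 * (dZ s * (x * x) + dZ t * (y * y) + x * y * (dZ s * a s t)) in N ≡ int 2 * dZ s ⊎ N ≡ int 2 * dZ t
      e' : Good x y
      e' = subst (λ N → N ≡ int 2 * dZ s ⊎ N ≡ int 2 * dZ t) (trans (⟨⟩-cong h h) (two-norm x s y t)) e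
      flip-sign : ∀ x y ds dt c → int 2 * (ds * (x * x) + dt * (y * y) + x * y * c) ≡ int 2 * (ds * (- x * - x) + dt * (- y * - y) + - x * - y * c)
      flip-sign = solve-∀
      nonneg : ∀ m → 0ℤ ≤ int m
      nonneg m = +≤+ ℕ.z≤n
      go : ∀ x y → Good x y → Signed (λ u → x * act a w (δ s) u + y * act a w (δ t) u)
      go (int k) (int l) _ = inj₁ λ u → 0≤+ (0≤* (nonneg k) (p u)) (0≤* (nonneg l) (q u))
      go (int zero) -[1+ l ] _ = inj₂ λ u → ≤0+ (≤0* {0ℤ} ℤP.≤-refl (p u)) (≤0* { -[1+ l ]} -≤+ (q u))
      go (int (suc k)) -[1+ l ] g = ⊥-elim (mixed {int (suc k)} { -[1+ l ]} (+<+ (ℕ.s≤s ℕ.z≤n)) ℤ.-<+ s≢t g)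
      go -[1+ k ] (int zero) _ = inj₂ λ u → ≤0+ (≤0* { -[1+ k ]} -≤+ (p u)) (≤0* {0ℤ} ℤP.≤-refl (q u))
      go -[1+ k ] (int (suc l)) g = ⊥-elim (mixed {int (suc k)} { -[1+ l ]} (+<+ (ℕ.s≤s ℕ.z≤n)) ℤ.-<+ s≢t
        (subst (λ N → N ≡ int 2 * dZ s ⊎ N ≡ int 2 * dZ t) (flip-sign -[1+ k ] (int (suc l)) (dZ s) (dZ t) (dZ s * a s t)) g))
      go -[1+ k ] -[1+ l ] _ = inj₂ λ u → ≤0+ (≤0* { -[1+ k ]} -≤+ (p u)) (≤0* { -[1+ l ]} -≤+ (q u))

    -- The last letter moves α_s within the plane of s and that letter, which leaves a shorter word
    -- applied to a vector of a plane.
    simples : ∀ m → SignedUpTo m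
    -- If `w` keeps both simple roots positive, `combine` applies. Otherwise exchange shortens the
    -- word, at the price of reflecting `v` within its plane.
    planes : ∀ m w {s t} → length w ℕ.≤ m → s ≢ t → ∀ {v} → InPlane s t v → Signed (act a w v)

    simples m [] s _ = inj₁ (δ-Pos s)
    simples (suc m) (q ∷ w) s (ℕ.s≤s l) = Signed-cong (act-last (split-last q w)) (case-last (split-last q w))
      where
      split-last : ∀ q w → ∃₂ λ w' p → (q ∷ w ≡ w' ++ p ∷ []) × (length w' ≡ length w)
      split-last q [] = [] , q , refl , refl
      split-last q (q' ∷ w) with split-last q' w
      ... | w' , p , e , l = q ∷ w' , p , cong (q ∷_) e , cong suc l
      act-last : (L : ∃₂ λ w' p → (q ∷ w ≡ w' ++ p ∷ []) × (length w' ≡ length w)) →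
        act a (proj₁ L) (reflect (proj₁ (proj₂ L)) (δ s)) ≗ act a (q ∷ w) (δ s)
      act-last (w' , p , e , _) u = trans (sym (act-++ w' (p ∷ []) (δ s) u)) (cong (λ z → act a z (δ s) u) (sym e))
      case-last : (L : ∃₂ λ w' p → (q ∷ w ≡ w' ++ p ∷ []) × (length w' ≡ length w)) →
        Signed (act a (proj₁ L) (reflect (proj₁ (proj₂ L)) (δ s)))
      case-last (w' , p , e , l') with s ≟ p
      ... | yes refl = Signed-cong (λ u → sym (trans (act-cong w' (reflect-δ s) u) (at-neg (act-linear w' u) (δ s))))
                         (Signed-neg (simples m w' s (subst (ℕ._≤ m) (sym l') l)))
      ... | no s≢p = planes m w' (subst (ℕ._≤ m) (sym l') l) s≢p (plane-reflect′ (plane-δ s p))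

    planes m w {s} {t} l s≢t v with simples m w s l | simples m w t l
    ... | inj₁ p | inj₁ q = combine w s≢t p q v
    planes zero [] {s} l s≢t v | inj₂ p | _ = ⊥-elim (Root-not-both (Root-δ s) (δ-Pos s) p)
    planes zero [] {_} {t} l s≢t v | _ | inj₂ q = ⊥-elim (Root-not-both (Root-δ t) (δ-Pos t) q)
    planes (suc m) w {s} {t} l s≢t {v} V | inj₂ p | _
      with exchange′ w s (λ w' r l' → simples (suc m) w' r (ℕP.≤-trans l' l)) p
    ... | w' , l' , E = Signed-cong (λ u → trans (sym (E (reflect s v) u)) (act-cong w (reflect-invol s v) u))
                          (planes m w' (ℕP.≤-pred (subst (ℕ._≤ suc m) (sym l') l)) s≢t (plane-reflect V))
    planes (suc m) w {s} {t} l s≢t {v} V | inj₁ _ | inj₂ q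
      with exchange′ w t (λ w' r l' → simples (suc m) w' r (ℕP.≤-trans l' l)) q
    ... | w' , l' , E = Signed-cong (λ u → trans (sym (E (reflect t v) u)) (act-cong w (reflect-invol t v) u))
                          (planes m w' (ℕP.≤-pred (subst (ℕ._≤ suc m) (sym l') l)) s≢t (plane-reflect′ V))

  Root-Signed : ∀ {x} → Root x → Signed x
  Root-Signed (w , t , k) = Signed-cong k (simples (length w) w t ℕP.≤-refl)

  exchange : ∀ w s → Neg (act a w (δ s)) →
    ∃ λ w' → (suc (length w') ≡ length w) × (∀ v → act a w (reflect s v) ≗ act a w' v)
  exchange w s = exchange′ w s (simples (length w))

-- Reduced words and the longest element

module ReducedWords {n : ℕ} (a : CartanMatrix n) (fin : IsFiniteCartan a) where
  open Roots a fin

  unact-++ : ∀ w w' v → unact (w ++ w') v ≡ unact w' (unact w v)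
  unact-++ [] w' v = refl
  unact-++ (q ∷ w) w' v = unact-++ w w' (reflect q v)

  unact-cong : ∀ w {x y} → x ≗ y → unact w x ≗ unact w y
  unact-cong w h t = resp (unact-linear w t) h

  act-δ-Signed : ∀ w s → Signed (act a w (δ s))
  act-δ-Signed w s = Root-Signed (w , s , λ _ → refl)

  simple-expansion : ∀ (v : Vect n) → v ≗ comb v δ
  simple-expansion v t = sym (trans (∑-cong λ j → trans (ℤP.*-comm (v j) (δ j t)) (cong (_* v j) (δ-sym j t))) (∑-δ t v))
    where
    δ-sym : ∀ {n} (s t : Fin n) → δ s t ≡ δ t s
    δ-sym s t with t ≟ s | s ≟ t
    ... | yes _ | yes _ = refl
    ... | yes p | no q = ⊥-elim (q (sym p))
    ... | no p | yes q = ⊥-elim (p (sym q))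
    ... | no _ | no _ = refl

  act-Pos-Neg : ∀ w → (∀ s → Neg (act a w (δ s))) → ∀ {v} → Pos v → Neg (act a w v)
  act-Pos-Neg w m {v} p t = subst (_≤ 0ℤ) (sym (trans (act-cong w (simple-expansion v) t) (at-comb (act-linear w t) v δ)))
    (∑-≤0 λ j → *≤0 (p j) (m j t))

  -- A word `u` for the product sends α_s to a negative root, so exchange deletes a letter of `u`
  -- and leaves a word for `w`, which is at least as long as `w`.
  Reduced-snoc : ∀ w s → Reduced a w → Pos (act a w (δ s)) → Reduced a (w ++ s ∷ [])
  Reduced-snoc w s R p u same with exchange u s (λ t → subst (_≤ 0ℤ) (image t) (-≤0 (p t)))
    where
    image : ∀ t → - act a w (δ s) t ≡ act a u (δ s) t
    image t = trans (sym (trans (act-cong w (reflect-δ s) t) (at-neg (act-linear w t) (δ s))))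
      (trans (sym (act-++ w (s ∷ []) (δ s) t)) (sym (same (δ s) t)))
  ... | u' , l , E = ℕP.≤-trans (ℕP.≤-reflexive (trans (ListP.length-++ w) (ℕP.+-comm (length w) 1)))
    (subst (suc (length w) ℕ.≤_) l (ℕ.s≤s (R u' λ v t → sym (
      trans (sym (act-cong w (reflect-invol s v) t)) (trans (sym (act-++ w (s ∷ []) (reflect s v) t)) (trans (sym (same (reflect s v) t)) (E v t)))))))

  Reduced-snoc⁻ : ∀ w s → Reduced a (w ++ s ∷ []) → Pos (act a w (δ s))
  Reduced-snoc⁻ w s R with act-δ-Signed w s
  ... | inj₁ p = p
  ... | inj₂ m with exchange w s m
  ...   | w' , l , E = ⊥-elim (ℕP.<⇒≱ (ℕP.≤-trans (ℕP.≤-reflexive l) (ℕP.≤-trans (ℕP.n≤1+n _)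
            (ℕP.≤-reflexive (trans (ℕP.+-comm 1 (length w)) (sym (ListP.length-++ w))))))
            (R w' λ v t → sym (trans (act-++ w (s ∷ []) v t) (E v t))))

  Reduced-tail : ∀ q w → Reduced a (q ∷ w) → Reduced a w
  Reduced-tail q w R u same = ℕP.≤-pred (R (q ∷ u) λ v → reflect-cong q (same v))

  Reduced-init : ∀ w w' → Reduced a (w ++ w') → Reduced a w
  Reduced-init w w' R u same = ℕP.+-cancelʳ-≤ (length w') _ _ (subst₂ ℕ._≤_ (ListP.length-++ w) (ListP.length-++ u)
    (R (u ++ w') λ v t → trans (act-++ u w' v t) (trans (same (act a w' v) t) (sym (act-++ w w' v t)))))

  Reduced-transfer : ∀ w w' → Reduced a w → SameElt a w w' → length w' ≡ length w → Reduced a w'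
  Reduced-transfer w w' R same l u same' = subst (ℕ._≤ length u) (sym l) (R u λ v t → trans (same' v t) (sym (same v t)))

  longest-Neg : ∀ w → ReducedLongest a w → ∀ s → Neg (act a w (δ s))
  longest-Neg w (R , M) s with act-δ-Signed w s
  ... | inj₂ m = m
  ... | inj₁ p = ⊥-elim (ℕP.<⇒≱ (ℕP.≤-reflexive (trans (ℕP.+-comm 1 (length w)) (sym (ListP.length-++ w))))
                   (M (w ++ s ∷ []) (Reduced-snoc w s R p)))

  -- The longest element makes all positive vectors negative, so a positive preimage would make `x`
  -- negative.
  longest-unact-Neg : ∀ w → ReducedLongest a w → ∀ {x} → Root x → Pos x → Neg (unact w x)
  longest-unact-Neg w RL {x} r p with Root-Signed (Root-unact w r)
  ... | inj₂ m = m
  ... | inj₁ p' = ⊥-elim (Root-not-both r p (Neg-cong (act-unact w x) (act-Pos-Neg w (longest-Neg w RL) p')))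

  longest-transfer : ∀ w w' → ReducedLongest a w → SameElt a w w' → length w' ≡ length w → ReducedLongest a w'
  longest-transfer w w' (R , M) same l = Reduced-transfer w w' R same l , λ u R' → subst (length u ℕ.≤_) (sym l) (M u R')

-- Only the relative order of the values of κ at adjacent letters matters: it encodes an orientation of the Dynkin
-- diagram (an arrow s → t if κ s < κ t), whose Euler form is E κ.

module Euler {n : ℕ} (a : CartanMatrix n) (fin : IsFiniteCartan a) where
  open Roots a fin
  open IsFiniteCartan fin using (diag; symm)

  Adj : Fin n → Fin n → Set
  Adj s t = t ≢ s × a s t ≢ 0ℤ

  S≡0 : ∀ {s t} → a s t ≡ 0ℤ → S s t ≡ 0ℤ
  S≡0 {s} h = trans (cong (dZ s *_) h) (ℤP.*-zeroʳ (dZ s))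

  a-sym-0 : ∀ {s t} → a s t ≡ 0ℤ → a t s ≡ 0ℤ
  a-sym-0 {s} {t} h = cancel-pos (0<d t) (trans (sym (symm s t)) (trans (S≡0 h) (sym (ℤP.*-zeroʳ (dZ t)))))

  Adj-sym : ∀ {s t} → Adj s t → Adj t s
  Adj-sym (p , q) = (λ e → p (sym e)) , λ e → q (a-sym-0 e)

  Source Sink : (Fin n → ℕ) → Fin n → Set
  Source κ s = ∀ t → Adj s t → κ s ℕ.< κ t
  Sink κ s = ∀ t → Adj s t → κ t ℕ.< κ s

  abstract
    -- Half of the symmetric matrix `S`: half the diagonal, and the entries against the arrows. A
    -- tie of κ gives the entry `S s t`, which vanishes unless the letters are adjacent; this is why
    -- `E-sym` asks for `Separating`.
    EM : (Fin n → ℕ) → Fin n → Fin n → ℤ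
    EM κ s t with s ≟ t | κ s ℕ.<? κ t
    ... | yes _ | _ = dZ s
    ... | no _ | yes _ = 0ℤ
    ... | no _ | no _ = S s t

    EM-diag : ∀ κ s → EM κ s s ≡ dZ s
    EM-diag κ s with s ≟ s | κ s ℕ.<? κ s
    ... | yes _ | _ = refl
    ... | no p | _ = ⊥-elim (p refl)

    EM-resp : ∀ {κ κ' s t} → κ s ≡ κ' s → κ t ≡ κ' t → EM κ s t ≡ EM κ' s t
    EM-resp {κ} {κ'} {s} {t} h k with s ≟ t | κ s ℕ.<? κ t | κ' s ℕ.<? κ' t
    ... | yes _ | _ | _ = refl
    ... | no _ | yes _ | yes _ = refl
    ... | no _ | no _ | no _ = refl
    ... | no _ | yes p | no q = ⊥-elim (q (subst₂ ℕ._<_ h k p))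
    ... | no _ | no p | yes q = ⊥-elim (p (subst₂ ℕ._<_ (sym h) (sym k) q))

    EM-< : ∀ κ {s t} → s ≢ t → κ s ℕ.< κ t → EM κ s t ≡ 0ℤ
    EM-< κ {s} {t} s≢t l with s ≟ t | κ s ℕ.<? κ t
    ... | yes p | _ = ⊥-elim (s≢t p)
    ... | no _ | yes _ = refl
    ... | no _ | no q = ⊥-elim (q l)

    EM-> : ∀ κ {s t} → s ≢ t → κ t ℕ.< κ s → EM κ s t ≡ S s t
    EM-> κ {s} {t} s≢t l with s ≟ t | κ s ℕ.<? κ t
    ... | yes p | _ = ⊥-elim (s≢t p)
    ... | no _ | yes q = ⊥-elim (ℕP.<-asym l q)
    ... | no _ | no q = refl

    EM-0 : ∀ κ {s t} → s ≢ t → a s t ≡ 0ℤ → EM κ s t ≡ 0ℤ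
    EM-0 κ {s} {t} s≢t z with s ≟ t | κ s ℕ.<? κ t
    ... | yes p | _ = ⊥-elim (s≢t p)
    ... | no _ | yes q = refl
    ... | no _ | no q = S≡0 z

  EM-before : ∀ κ {s t} → s ≢ t → (Adj s t → κ s ℕ.< κ t) → EM κ s t ≡ 0ℤ
  EM-before κ {s} {t} s≢t h with a s t ℤ.≟ 0ℤ
  ... | yes z = EM-0 κ s≢t z
  ... | no z = EM-< κ s≢t (h ((λ e → s≢t (sym e)) , z))

  EM-after : ∀ κ {s t} → s ≢ t → (Adj s t → κ t ℕ.< κ s) → EM κ s t ≡ S s t
  EM-after κ {s} {t} s≢t h with a s t ℤ.≟ 0ℤ
  ... | yes z = trans (EM-0 κ s≢t z) (sym (S≡0 z))
  ... | no z = EM-> κ s≢t (h ((λ e → s≢t (sym e)) , z))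

  abstract
    E : (Fin n → ℕ) → Vect n → Vect n → ℤ
    E κ = Form (EM κ)

    E-def : ∀ κ x y → E κ x y ≡ Form (EM κ) x y
    E-def κ x y = refl

    E-linˡ : ∀ κ y → Linear (λ x → E κ x y)
    E-linˡ κ = Form-linˡ (EM κ)

    E-linʳ : ∀ κ x → Linear (E κ x)
    E-linʳ κ = Form-linʳ (EM κ)

  E-cong : ∀ κ {x x' y y'} → x ≗ x' → y ≗ y' → E κ x y ≡ E κ x' y'
  E-cong κ {x} {x'} {y} {y'} h k = trans (resp (E-linˡ κ y) h) (resp (E-linʳ κ x') k)

  E-δδ : ∀ κ s t → E κ (δ s) (δ t) ≡ EM κ s t
  E-δδ κ s t = trans (E-def κ (δ s) (δ t)) (trans (Form-δˡ (EM κ) s (δ t)) (trans (∑-cong λ u → ℤP.*-comm (EM κ s u) (δ t u)) (∑-δ t (EM κ s))))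

  E-source : ∀ {κ s} → Source κ s → ∀ y → E κ (δ s) y ≡ dZ s * y s
  E-source {κ} {s} src y = trans (E-def κ (δ s) y) (trans (Form-δˡ (EM κ) s y) (trans (∑-cong row) (∑-δ s (λ t → dZ s * y t))))
    where
    row : ∀ t → EM κ s t * y t ≡ δ s t * (dZ s * y t)
    row t with t ≟ s
    ... | yes refl = trans (cong (_* y t) (EM-diag κ t)) (sym (ℤP.*-identityˡ (dZ t * y t)))
    ... | no t≢s = trans (cong (_* y t) (EM-before κ (λ e → t≢s (sym e)) (src t))) (trans (ℤP.*-zeroˡ (y t)) (sym (ℤP.*-zeroˡ (dZ s * y t))))

  E-sink : ∀ {κ s} → Sink κ s → ∀ y → E κ y (δ s) ≡ dZ s * y s
  E-sink {κ} {s} snk y = trans (E-def κ y (δ s)) (trans (Form-δʳ (EM κ) y s) (trans (∑-cong row) (∑-δ s (λ t → dZ s * y t))))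
    where
    row : ∀ t → EM κ t s * y t ≡ δ s t * (dZ s * y t)
    row t with t ≟ s
    ... | yes refl = trans (cong (_* y t) (EM-diag κ t)) (sym (ℤP.*-identityˡ (dZ t * y t)))
    ... | no t≢s = trans (cong (_* y t) (EM-before κ t≢s (λ adj → snk t (Adj-sym adj)))) (trans (ℤP.*-zeroˡ (y t)) (sym (ℤP.*-zeroˡ (dZ s * y t))))

  E-sourceʳ : ∀ {κ s} → Source κ s → ∀ y → E κ y (δ s) ≡ dZ s * (A s y - y s)
  E-sourceʳ {κ} {s} src y = trans (E-def κ y (δ s)) (trans (Form-δʳ (EM κ) y s) (trans (∑-cong row)
    (trans (∑-+ (λ t → dZ s * (a s t * y t)) (λ t → - dZ s * (δ s t * y t)))
    (trans (cong₂ _+_ (∑-*ˡ (dZ s) (λ t → a s t * y t)) (∑-*ˡ (- dZ s) (λ t → δ s t * y t)))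
    (trans (cong₂ (λ p q → dZ s * p + - dZ s * q) (sym (A-def s y)) (∑-δ s y)) (arith (dZ s) (A s y) (y s)))))))
    where
    arith : ∀ d p q → d * p + - d * q ≡ d * (p - q)
    arith = solve-∀
    onDiag : ∀ d y → d * y ≡ d * (int 2 * y) + - d * (1ℤ * y)
    onDiag = solve-∀
    offDiag : ∀ d c y → d * c * y ≡ d * (c * y) + - d * (0ℤ * y)
    offDiag = solve-∀
    row : ∀ t → EM κ t s * y t ≡ dZ s * (a s t * y t) + - dZ s * (δ s t * y t)
    row t with t ≟ s
    ... | yes refl = trans (cong (_* y t) (EM-diag κ t)) (trans (onDiag (dZ t) (y t)) (cong (λ z → dZ t * (z * y t) + - dZ t * (1ℤ * y t)) (sym (diag t))))
    ... | no t≢s = trans (cong (_* y t) (trans (EM-after κ t≢s (λ adj → src t (Adj-sym adj))) (symm t s)))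
                     (offDiag (dZ s) (a s t) (y t))

  Separating : (Fin n → ℕ) → Set
  Separating κ = ∀ s t → Adj s t → κ s ≢ κ t

  E-sym : ∀ {κ} → Separating κ → ∀ x y → E κ x y + E κ y x ≡ ⟨ x , y ⟩
  E-sym {κ} sep x y = trans (cong₂ _+_ (E-def κ x y) (trans (E-def κ y x) (Form-flip (EM κ) y x)))
    (trans (sym (Form-+M (EM κ) (λ s t → EM κ t s) x y)) (trans (Form-congM entry x y) (sym (⟨⟩-def x y))))
    where
    entry : ∀ s t → EM κ s t + EM κ t s ≡ S s t
    entry s t with s ≟ t
    ... | yes refl = trans (cong₂ _+_ (EM-diag κ s) (EM-diag κ s)) (trans (double (dZ s)) (cong (dZ s *_) (sym (diag s))))
      where
      double : ∀ d → d + d ≡ d * int 2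
      double = solve-∀
    ... | no s≢t with κ s ℕ.<? κ t
    ...   | yes l = trans (cong₂ _+_ (EM-< κ s≢t l) (trans (EM-> κ (λ e → s≢t (sym e)) l) (symm t s))) (ℤP.+-identityˡ (S s t))
    ...   | no ¬l = trans (cong₂ _+_ (EM-after κ s≢t λ adj → below (Adj-sym adj)) (EM-before κ (λ e → s≢t (sym e)) below)) (ℤP.+-identityʳ (S s t))
      where
      below : Adj t s → κ t ℕ.< κ s
      below adj = ℕP.≤∧≢⇒< (ℕP.≮⇒≥ ¬l) (sep t s adj)

  -- κ records where each letter occurs next in the infinite word; once it is read, its next
  -- occurrence is one copy of c later, that is n places.
  bump : Fin n → (Fin n → ℕ) → Fin n → ℕ
  bump s κ t = if ⌊ t ≟ s ⌋ then κ t ℕ.+ n else κ t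

  bump-same : ∀ s κ → bump s κ s ≡ κ s ℕ.+ n
  bump-same s κ with s ≟ s
  ... | yes _ = refl
  ... | no p = ⊥-elim (p refl)

  bump-diff : ∀ {s t} κ → t ≢ s → bump s κ t ≡ κ t
  bump-diff {s} {t} κ t≢s with t ≟ s
  ... | yes p = ⊥-elim (t≢s p)
  ... | no _ = refl

  record Step (κ : Fin n → ℕ) (s : Fin n) : Set where
    field
      source : Source κ s
      sink   : Sink (bump s κ) s

  open Step public

  step-intro : ∀ {κ s} → (∀ t → Adj s t → κ s ℕ.< κ t × κ t ℕ.< κ s ℕ.+ n) → Step κ s
  step-intro h .source t adj = proj₁ (h t adj)
  step-intro {κ} {s} h .sink t adj = subst₂ ℕ._<_ (sym (bump-diff κ (proj₁ adj))) (sym (bump-same s κ)) (proj₂ (h t adj))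

  -- Turning a source into a sink makes the entries of row s appear and those of column s disappear,
  -- so the correction involves only the coefficients at s.
  E-bump : ∀ {κ s} → Step κ s → ∀ x y → E (bump s κ) x y ≡ E κ x y + dZ s * (x s * A s y - y s * A s x)
  E-bump {κ} {s} st x y = begin
    E κ' x y ≡⟨ E-def κ' x y ⟩
    Form (EM κ') x y ≡⟨ Form-congM entry x y ⟩
    Form (λ u t → EM κ u t + δ s u * S s t + δ s t * - S s u) x y
      ≡⟨ Form-+M (λ u t → EM κ u t + δ s u * S s t) (λ u t → δ s t * - S s u) x y ⟩
    Form (λ u t → EM κ u t + δ s u * S s t) x y + Form (λ u t → δ s t * - S s u) x y
      ≡⟨ cong₂ _+_ (Form-+M (EM κ) (λ u t → δ s u * S s t) x y) (Form-colM s (λ u → - S s u) x y) ⟩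
    Form (EM κ) x y + Form (λ u t → δ s u * S s t) x y + y s * ∑ (λ t → - S s t * x t)
      ≡⟨ cong₂ (λ p q → p + y s * q) (cong₂ _+_ (sym (E-def κ x y)) (trans (Form-rowM s (S s) x y) (cong (x s *_) (sumS y)))) (sum-S x) ⟩
    E κ x y + x s * (dZ s * A s y) + y s * (- dZ s * A s x)
      ≡⟨ arith (E κ x y) (x s) (dZ s) (A s y) (y s) (A s x) ⟩
    E κ x y + dZ s * (x s * A s y - y s * A s x) ∎
    where
    open ≡-Reasoning
    κ' : Fin n → ℕ
    κ' = bump s κ
    arith : ∀ e x d p y q → e + x * (d * p) + y * (- d * q) ≡ e + d * (x * p - y * q)
    arith = solve-∀
    neg-assoc : ∀ d c v → - (d * c) * v ≡ - d * (c * v)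
    neg-assoc = solve-∀
    sumS : ∀ v → ∑ (λ t → S s t * v t) ≡ dZ s * A s v
    sumS v = trans (∑-cong λ t → ℤP.*-assoc (dZ s) (a s t) (v t)) (trans (∑-*ˡ (dZ s) (λ t → a s t * v t)) (cong (dZ s *_) (sym (A-def s v))))
    sum-S : ∀ v → ∑ (λ t → - S s t * v t) ≡ - dZ s * A s v
    sum-S v = trans (∑-cong λ t → neg-assoc (dZ s) (a s t) (v t)) (trans (∑-*ˡ (- dZ s) (λ t → a s t * v t)) (cong (- dZ s *_) (sym (A-def s v))))
    c1 : ∀ d e → d ≡ d + 1ℤ * e + 1ℤ * - e
    c1 = solve-∀
    c2 : ∀ e m → e ≡ 0ℤ + 1ℤ * e + 0ℤ * m
    c2 = solve-∀
    c3 : ∀ e m → 0ℤ ≡ e + 0ℤ * m + 1ℤ * - e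
    c3 = solve-∀
    c4 : ∀ e m k → e ≡ e + 0ℤ * m + 0ℤ * k
    c4 = solve-∀
    entry : ∀ u t → EM κ' u t ≡ EM κ u t + δ s u * S s t + δ s t * - S s u
    entry u t with u ≟ s | t ≟ s
    ... | yes refl | yes refl = trans (EM-diag κ' u) (trans (c1 (dZ u) (S u u)) (cong (λ z → z + 1ℤ * S u u + 1ℤ * - S u u) (sym (EM-diag κ u))))
    ... | yes refl | no t≢s = trans (EM-after κ' (λ e → t≢s (sym e)) (λ adj → sink st t adj)) (trans (c2 (S u t) (- S u u))
            (cong (λ z → z + 1ℤ * S u t + 0ℤ * - S u u) (sym (EM-before κ (λ e → t≢s (sym e)) (source st t)))))
    ... | no u≢s | yes refl = trans (EM-before κ' u≢s (λ adj → sink st u (Adj-sym adj))) (trans (c3 (S t u) (S t t))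
            (cong (λ z → z + 0ℤ * S t t + 1ℤ * - S t u) (sym (trans (EM-after κ u≢s (λ adj → source st u (Adj-sym adj))) (symm u t)))))
    ... | no u≢s | no t≢s = trans same (c4 (EM κ u t) (S s t) (- S s u))
      where
      same : EM κ' u t ≡ EM κ u t
      same = EM-resp (bump-diff κ u≢s) (bump-diff κ t≢s)

  -- The shadow of the reflection functors of quiver representations on the Euler form.
  E-reflect : ∀ {κ s} → Step κ s → ∀ x y → E (bump s κ) (reflect s x) (reflect s y) ≡ E κ x y
  E-reflect {κ} {s} st x y = begin
    E (bump s κ) (reflect s x) (reflect s y) ≡⟨ E-bump st (reflect s x) (reflect s y) ⟩
    E κ (reflect s x) (reflect s y) + dZ s * (reflect s x s * A s (reflect s y) - reflect s y s * A s (reflect s x))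
      ≡⟨ cong₂ (λ p q → p + dZ s * q) expand (cong₂ _-_ (cong₂ _*_ (at-s x) (A-reflect s y)) (cong₂ _*_ (at-s y) (A-reflect s x))) ⟩
    ((E κ x y + - A s y * (dZ s * (A s x - x s))) + - A s x * (dZ s * y s + - A s y * dZ s))
      + dZ s * ((x s - A s x) * - A s y - (y s - A s y) * - A s x)
      ≡⟨ arith (E κ x y) (A s x) (A s y) (x s) (y s) (dZ s) ⟩
    E κ x y ∎
    where
    open ≡-Reasoning
    arith : ∀ e p q x y d → ((e + - q * (d * (p - x))) + - p * (d * y + - q * d)) + d * ((x - p) * - q - (y - q) * - p) ≡ e
    arith = solve-∀
    at-s : ∀ v → reflect s v s ≡ v s - A s v
    at-s v = trans (reflect-eq s v s) (trans (cong (λ z → v s + - A s v * z) (δ-same s)) (cong (v s +_) (ℤP.*-identityʳ (- A s v))))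
    expand : E κ (reflect s x) (reflect s y) ≡ (E κ x y + - A s y * (dZ s * (A s x - x s))) + - A s x * (dZ s * y s + - A s y * dZ s)
    expand = trans (E-cong κ (reflect-eq s x) (reflect-eq s y)) (trans (lin (E-linˡ κ _) x (- A s x) (δ s))
      (cong₂ (λ p q → p + - A s x * q)
        (trans (lin (E-linʳ κ x) y (- A s y) (δ s)) (cong (λ z → E κ x y + - A s y * z) (E-sourceʳ (source st) x)))
        (trans (lin (E-linʳ κ (δ s)) y (- A s y) (δ s)) (cong₂ (λ p q → p + - A s y * q) (E-source (source st) y)
          (trans (E-source (source st) (δ s)) (trans (cong (dZ s *_) (δ-same s)) (ℤP.*-identityʳ (dZ s))))))))


  Chain : (Fin n → ℕ) → List (Fin n) → Set
  Chain κ [] = Data.Unit.⊤ where import Data.Unit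
  Chain κ (s ∷ w) = Step κ s × Chain (bump s κ) w

  bumps : (Fin n → ℕ) → List (Fin n) → Fin n → ℕ
  bumps κ [] = κ
  bumps κ (s ∷ w) = bumps (bump s κ) w

  bumps-snoc : ∀ κ w s → bumps κ (w ++ s ∷ []) ≡ bump s (bumps κ w)
  bumps-snoc κ [] s = refl
  bumps-snoc κ (q ∷ w) s = bumps-snoc (bump q κ) w s

  Chain-snoc : ∀ {κ} w {s} → Chain κ w → Step (bumps κ w) s → Chain κ (w ++ s ∷ [])
  Chain-snoc [] c st = st , _
  Chain-snoc (q ∷ w) (st' , c) st = st' , Chain-snoc w c st

  E-act : ∀ {κ} w → Chain κ w → ∀ x y → E (bumps κ w) x y ≡ E κ (act a w x) (act a w y)
  E-act [] c x y = refl
  E-act {κ} (q ∷ w) (st , c) x y = trans (E-act w c x y) (trans (sym (E-cong (bump q κ) (reflect-invol q _) (reflect-invol q _)))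
    (E-reflect st (reflect q (act a w x)) (reflect q (act a w y))))

-- The sorting word: every letter is read at a source

module Sorting {n : ℕ} (a : CartanMatrix n) (fin : IsFiniteCartan a) where
  open Roots a fin
  open ReducedWords a fin
  open Euler a fin
  open IsFiniteCartan fin using (symm; offdiag)

  -- Off-diagonal Cartan entries are nonpositive, and the diagonal one meets the coefficient 0.
  A-≤0 : ∀ {q} {v : Vect n} → Pos v → v q ≡ 0ℤ → A q v ≤ 0ℤ
  A-≤0 {q} {v} p z = subst (_≤ 0ℤ) (sym (A-def q v)) (∑-≤0 term)
    where
    term : ∀ t → a q t * v t ≤ 0ℤ
    term t with t ≟ q
    ... | yes refl = ℤP.≤-reflexive (trans (cong (a t t *_) z) (ℤP.*-zeroʳ (a t t)))
    ... | no t≢q = ≤0* (offdiag q t (λ e → t≢q (sym e))) (p t)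

  E-unreflect : ∀ {κ q} → Step κ q → ∀ x y → E (bump q κ) x y ≡ E κ (reflect q x) (reflect q y)
  E-unreflect {κ} {q} st x y = trans (sym (E-cong (bump q κ) (reflect-invol q x) (reflect-invol q y))) (E-reflect st (reflect q x) (reflect q y))

  private
    -- Strip letters from the left up to the letter `q` that makes the root of s negative; there it
    -- is -α_q. As `q` is a source, the vanishing of E says that the positive root `y` of t has no
    -- coefficient at `q`. Then E y (-α_q) is minus a nonpositive number, against the strict
    -- inequality.
    spread : ∀ κ w s t → Chain κ w → Reduced a (w ++ t ∷ []) → Neg (act a w (δ s)) →
      E κ (act a w (δ s)) (act a w (δ t)) ≡ 0ℤ → E κ (act a w (δ t)) (act a w (δ s)) < 0ℤ → ⊥
    spread κ [] s t c R m _ _ = Root-not-both (Root-δ s) (δ-Pos s) m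
    spread κ (q ∷ w) s t (st , c) R m z l with act-δ-Signed w s
    ... | inj₂ m' = spread (bump q κ) w s t c (Reduced-tail q (w ++ t ∷ []) R) m'
                      (trans (E-unreflect st _ _) z) (subst (_< 0ℤ) (sym (E-unreflect st _ _)) l)
    ... | inj₁ p' = ℤP.<⇒≱ l (subst (0ℤ ≤_) (sym value) (0≤- (*≤0 (<⇒≤ (0<d q)) (A-≤0 y-Pos yq≡0))))
      where
      y : Vect n
      y = reflect q (act a w (δ t))
      y-Pos : Pos y
      y-Pos = Reduced-snoc⁻ (q ∷ w) t R
      x≗ : reflect q (act a w (δ s)) ≗ neg (δ q)
      x≗ = ≗-trans (reflect-cong q (only-simple (Root-act w (Root-δ s)) p' m)) (reflect-δ q)
      yq≡0 : y q ≡ 0ℤ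
      yq≡0 = cancel-pos (0<d q) (begin
        dZ q * y q ≡⟨ sym (E-source (source st) y) ⟩
        E κ (δ q) y ≡⟨ sym (ℤP.neg-involutive (E κ (δ q) y)) ⟩
        - - E κ (δ q) y ≡⟨ cong -_ (sym (at-neg (E-linˡ κ y) (δ q))) ⟩
        - E κ (neg (δ q)) y ≡⟨ cong -_ (trans (sym (resp (E-linˡ κ y) x≗)) z) ⟩
        0ℤ ≡⟨ sym (ℤP.*-zeroʳ (dZ q)) ⟩
        dZ q * 0ℤ ∎)
        where open ≡-Reasoning
      value : E κ y (reflect q (act a w (δ s))) ≡ - (dZ q * A q y)
      value = trans (resp (E-linʳ κ y) x≗) (trans (at-neg (E-linʳ κ y) (δ q)) (cong -_ (trans (E-sourceʳ (source st) y)
        (cong (dZ q *_) (trans (cong (λ z → A q y - z) yq≡0) (ℤP.+-identityʳ (A q y)))))))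

  -- An arrow s → t means E α_s α_t = 0 and E α_t α_s < 0. Transported by `w`, these contradict
  -- `spread` if `w` keeps α_t positive.
  Neg-spreads : ∀ {κ} w {s t} → Chain κ w → Reduced a w → Adj s t → bumps κ w s ℕ.< bumps κ w t →
    Neg (act a w (δ s)) → Neg (act a w (δ t))
  Neg-spreads {κ} w {s} {t} c R (t≢s , a≢0) l m with act-δ-Signed w t
  ... | inj₂ m' = m'
  ... | inj₁ p = ⊥-elim (spread κ w s t c (Reduced-snoc w t R p) m
        (trans (sym (E-act w c (δ s) (δ t))) (trans (E-δδ _ s t) (EM-< _ (λ e → t≢s (sym e)) l)))
        (subst (_< 0ℤ) (trans (trans (symm s t) (trans (sym (EM-> _ t≢s l)) (sym (E-δδ _ t s)))) (E-act w c (δ t) (δ s)))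
          (ℤP.≤∧≢⇒< (*≤0 (<⇒≤ (0<d s)) (offdiag s t (λ e → t≢s (sym e))))
            (λ e → a≢0 (cancel-pos (0<d s) (trans e (sym (ℤP.*-zeroʳ (dZ s)))))))))

  -- Inc has a lower bound, IncTo also a strict upper bound, so that they can be concatenated.

  Inc : ℕ → List ℕ → Set
  Inc b [] = Data.Unit.⊤ where import Data.Unit
  Inc b (x ∷ xs) = b ℕ.≤ x × Inc (suc x) xs

  IncTo : ℕ → List ℕ → ℕ → Set
  IncTo b [] c = b ℕ.≤ c
  IncTo b (x ∷ xs) c = b ℕ.≤ x × IncTo (suc x) xs c

  Inc-weaken : ∀ {b b'} xs → b ℕ.≤ b' → Inc b' xs → Inc b xs
  Inc-weaken [] _ _ = _
  Inc-weaken (x ∷ xs) l (l' , i) = ℕP.≤-trans l l' , i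

  Inc⇒Increasing : ∀ {b} xs → Inc b xs → Increasing xs
  Inc⇒Increasing [] _ = _
  Inc⇒Increasing (x ∷ []) _ = _
  Inc⇒Increasing (x ∷ y ∷ xs) (_ , l , i) = l , Inc⇒Increasing (y ∷ xs) (l , i)

  Increasing⇒Inc : ∀ xs → Increasing xs → Inc 0 xs
  Increasing⇒Inc [] _ = _
  Increasing⇒Inc (x ∷ []) _ = ℕ.z≤n , _
  Increasing⇒Inc (x ∷ y ∷ xs) (l , i) = ℕ.z≤n , l , proj₂ (Increasing⇒Inc (y ∷ xs) i)

  IncTo-snoc : ∀ {b c y} xs → IncTo b xs c → c ℕ.≤ y → IncTo b (xs ++ y ∷ []) (suc y)
  IncTo-snoc [] l l' = ℕP.≤-trans l l' , ℕP.≤-refl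
  IncTo-snoc (x ∷ xs) (l , i) l' = l , IncTo-snoc xs i l'

  IncTo-++ : ∀ {b c ys} xs → IncTo b xs c → Inc c ys → Inc b (xs ++ ys)
  IncTo-++ {ys = ys} [] l i = Inc-weaken ys l i
  IncTo-++ (x ∷ xs) (l , i) i' = l , IncTo-++ xs i i'

  Inc-delete : ∀ {b y ys} xs → Inc b (xs ++ y ∷ ys) → Inc b (xs ++ ys)
  Inc-delete {ys = ys} [] (l , i) = Inc-weaken ys (ℕP.m≤n⇒m≤1+n l) i
  Inc-delete (x ∷ xs) (l , i) = l , Inc-delete xs i

  letters : List (ℕ × Fin n) → List (Fin n)
  letters = Data.List.map proj₂ where import Data.List

  positions : List (ℕ × Fin n) → List ℕ
  positions = Data.List.map pos where import Data.List

  letters-++ : ∀ xs ys → letters (xs ++ ys) ≡ letters xs ++ letters ys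
  letters-++ = ListP.map-++ proj₂

  positions-++ : ∀ xs ys → positions (xs ++ ys) ≡ positions xs ++ positions ys
  positions-++ = ListP.map-++ pos

  Lex-contra : ∀ {x y us vs} ws → x ℕ.< y → ¬ LexLeq (ws ++ y ∷ us) (ws ++ x ∷ vs)
  Lex-contra [] l (inj₁ l') = ℕP.<-asym l l'
  Lex-contra [] l (inj₂ (e , _)) = ℕP.<-irrefl (sym e) l
  Lex-contra (w ∷ ws) l (inj₁ l') = ℕP.<-irrefl refl l'
  Lex-contra (w ∷ ws) l (inj₂ (_ , x)) = Lex-contra ws l x

  -- The sign of the root changes at some letter, and by `only-simple` the root is simple just
  -- before it.
  root-letter : ∀ ps {v} → Root v → Pos v → Neg (unact (letters ps) v) →
    ∃ λ ys → ∃₂ λ k zs → (ps ≡ ys ++ k ∷ zs) × (unact (letters ys) v ≗ δ (proj₂ k))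
  root-letter [] r p m = ⊥-elim (Root-not-both r p m)
  root-letter (k ∷ ps) {v} r p m with Root-Signed (Root-reflect (proj₂ k) r)
  ... | inj₂ m' = [] , k , ps , refl , only-simple r p m'
  ... | inj₁ p' with root-letter ps (Root-reflect (proj₂ k) r) p' m
  ...   | ys , k' , zs , e , h = k ∷ ys , k' , zs , cong (k ∷_) e , h

  module _ {ps : List (ℕ × Fin n)} (wo : IsWoC a ps) where

    private
      RL : ReducedLongest a (letters ps)
      RL = proj₂ (proj₁ wo)

    -- Otherwise exchanging a later letter of the word for the skipped one would give a lexicographically smaller word.
    skipped-Neg : ∀ p₁ k p₂ x rj → ps ≡ p₁ ++ k ∷ p₂ → IncTo 0 (positions p₁) x → x ℕ.≤ pos rj → pos rj ℕ.< pos k →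
      Inc (pos k) (positions (k ∷ p₂)) → Neg (act a (letters p₁) (δ (proj₂ rj)))
    skipped-Neg p₁ k p₂ x rj refl to l l' inc with act-δ-Signed (letters p₁) (proj₂ rj)
    ... | inj₂ m = m
    ... | inj₁ p with root-letter (k ∷ p₂) (Root-δ (proj₂ rj)) (δ-Pos (proj₂ rj)) later-Neg
      where
      j : Fin n
      j = proj₂ rj
      later-Neg : Neg (unact (letters (k ∷ p₂)) (δ j))
      later-Neg = Neg-cong (λ t → trans (cong (λ w → unact w (act a (letters p₁) (δ j)) t) (letters-++ p₁ (k ∷ p₂)))
        (trans (cong (λ v → v t) (unact-++ (letters p₁) (letters (k ∷ p₂)) (act a (letters p₁) (δ j))))
               (unact-cong (letters (k ∷ p₂)) (unact-act (letters p₁) (δ j)) t)))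
        (longest-unact-Neg (letters ps) RL (Root-act (letters p₁) (Root-δ j)) p)
    ...   | ys , k' , zs , e , h = ⊥-elim (Lex-contra (positions p₁) l'
              (subst₂ LexLeq (positions-++ p₁ (k ∷ p₂)) (positions-++ p₁ (rj ∷ ys ++ zs)) (proj₂ wo ps' (increasing , longest))))
      where
      j : Fin n
      j = proj₂ rj
      ps' : List (ℕ × Fin n)
      ps' = p₁ ++ rj ∷ ys ++ zs
      increasing : Increasing (positions ps')
      increasing = Inc⇒Increasing _ (subst (Inc 0) (sym (positions-++ p₁ (rj ∷ ys ++ zs)))
        (IncTo-++ (positions p₁) to (l , Inc-weaken (positions (ys ++ zs)) l'
          (subst (Inc (pos k)) (sym (positions-++ ys zs))
            (Inc-delete (positions ys) (subst (Inc (pos k)) (trans (cong positions e) (positions-++ ys (k' ∷ zs))) inc))))))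
      u : List (Fin n)
      u = letters ys
      -- `u` sends the simple root of `k'` to that of `j`, so prefixing `j` makes up for omitting
      -- `k'`.
      same-tail : ∀ v → reflect j (act a (letters (ys ++ zs)) v) ≗ act a (letters (k ∷ p₂)) v
      same-tail v t = begin
        reflect j (act a (letters (ys ++ zs)) v) t ≡⟨ cong (λ w → reflect j (act a w v) t) (letters-++ ys zs) ⟩
        reflect j (act a (u ++ letters zs) v) t ≡⟨ reflect-cong j (act-++ u (letters zs) v) t ⟩
        reflect j (act a u (act a (letters zs) v)) t
          ≡⟨ conj u (λ r → trans (sym (act-cong u h r)) (act-unact u (δ j) r)) (act a (letters zs) v) t ⟩
        act a u (act a (letters (k' ∷ zs)) v) t ≡⟨ sym (act-++ u (letters (k' ∷ zs)) v t) ⟩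
        act a (u ++ letters (k' ∷ zs)) v t ≡⟨ cong (λ w → act a w v t) (sym (trans (cong letters e) (letters-++ ys (k' ∷ zs)))) ⟩
        act a (letters (k ∷ p₂)) v t ∎
        where open ≡-Reasoning
      same : SameElt a (letters ps) (letters ps')
      same v t = begin
        act a (letters ps) v t ≡⟨ cong (λ w → act a w v t) (letters-++ p₁ (k ∷ p₂)) ⟩
        act a (letters p₁ ++ letters (k ∷ p₂)) v t ≡⟨ act-++ (letters p₁) (letters (k ∷ p₂)) v t ⟩
        act a (letters p₁) (act a (letters (k ∷ p₂)) v) t ≡⟨ sym (act-cong (letters p₁) (same-tail v) t) ⟩
        act a (letters p₁) (act a (letters (rj ∷ ys ++ zs)) v) t ≡⟨ sym (act-++ (letters p₁) (letters (rj ∷ ys ++ zs)) v t) ⟩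
        act a (letters p₁ ++ letters (rj ∷ ys ++ zs)) v t ≡⟨ cong (λ w → act a w v t) (sym (letters-++ p₁ (rj ∷ ys ++ zs))) ⟩
        act a (letters ps') v t ∎
        where open ≡-Reasoning
      same-length : length (letters ps') ≡ length (letters ps)
      same-length = begin
        length (letters ps') ≡⟨ ListP.length-map proj₂ ps' ⟩
        length ps' ≡⟨ ListP.length-++ p₁ ⟩
        length p₁ ℕ.+ suc (length (ys ++ zs)) ≡⟨ cong (λ m → length p₁ ℕ.+ suc m) (ListP.length-++ ys) ⟩
        length p₁ ℕ.+ suc (length ys ℕ.+ length zs) ≡⟨ cong (length p₁ ℕ.+_) (sym (ℕP.+-suc (length ys) (length zs))) ⟩
        length p₁ ℕ.+ (length ys ℕ.+ suc (length zs)) ≡⟨ cong (length p₁ ℕ.+_) (sym (trans (cong length e) (ListP.length-++ ys))) ⟩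
        length p₁ ℕ.+ length (k ∷ p₂) ≡⟨ sym (ListP.length-++ p₁) ⟩
        length ps ≡⟨ sym (ListP.length-map proj₂ ps) ⟩
        length (letters ps) ∎
        where open ≡-Reasoning
      longest : ReducedLongest a (letters ps')
      longest = longest-transfer (letters ps) (letters ps') RL same same-length

    -- The state after the first copy of c in Q. Positions in the sorting word are counted from
    -- there, which is why n is added to `pos` throughout.
    κ₁ : Fin n → ℕ
    κ₁ t = n ℕ.+ toℕ t

    private
      pos-inj : ∀ r R (t j : Fin n) → pos (r , t) ≡ pos (R , j) → t ≡ j
      pos-inj r R t j e = FinP.toℕ-injective (trans (sym (residue r t)) (trans (cong (λ m → m DM.% n) e) (residue R j)))
        where
        import Data.Nat.DivMod as DM
        instance
          n≢0 : ℕ.NonZero n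
          n≢0 = FinP.nonZeroIndex t
        residue : ∀ r t → pos (r , t) DM.% n ≡ toℕ t
        residue r t = trans (cong (DM._% n) (ℕP.+-comm (r ℕ.* n) (toℕ t)))
          (trans (DM.[m+kn]%n≡m%n (toℕ t) r n) (DM.m<n⇒m%n≡m (FinP.toℕ<n t)))

      round-unique : ∀ r R (j : Fin n) → pos (R , j) ℕ.≤ pos (r , j) → pos (r , j) ℕ.< pos (R , j) ℕ.+ n → r ≡ R
      round-unique r R j l u = ℕP.≤-antisym
        (ℕP.≤-pred (ℕP.*-cancelʳ-< n r (suc R) (ℕP.+-cancelʳ-< (toℕ j) (r ℕ.* n) (suc R ℕ.* n)
          (subst (pos (r , j) ℕ.<_) (swap (R ℕ.* n) (toℕ j) n) u))))
        (ℕP.*-cancelʳ-≤ R r n {{FinP.nonZeroIndex j}} (ℕP.+-cancelʳ-≤ (toℕ j) (R ℕ.* n) (r ℕ.* n) l))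
        where
        swap : ∀ x y z → x ℕ.+ y ℕ.+ z ≡ z ℕ.+ x ℕ.+ y
        swap x y z = trans (ℕP.+-comm (x ℕ.+ y) z) (sym (ℕP.+-assoc z x y))

      -- A letter is alive until its first occurrence in the infinite word that is skipped; κ is then its next position.
      Alive Dead : List (ℕ × Fin n) → ℕ → Fin n → Set
      Alive p x t = ∃ λ r → (bumps κ₁ (letters p) t ≡ n ℕ.+ pos (r , t)) × (x ℕ.≤ pos (r , t)) × (pos (r , t) ℕ.< x ℕ.+ n)
      Dead p x t = (bumps κ₁ (letters p) t ℕ.< n ℕ.+ x) × Neg (act a (letters p) (δ t))

      -- The invariant is that every letter is alive or dead. The letter `j` being read is alive,
      -- because the word is reduced. A dead neighbour would have the smaller κ, and by
      -- `Neg-spreads` its negativity would pass to `j`. So all neighbours are alive, with next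
      -- positions less than one round after `j`, as `Step` demands.
      go : ∀ rest p x → ps ≡ p ++ rest → IncTo 0 (positions p) x → Inc x (positions rest) → Chain κ₁ (letters p) →
        (∀ t → Alive p x t ⊎ Dead p x t) → Chain κ₁ (letters ps)
      go [] p x e to inc c state = subst (Chain κ₁ ∘ letters) (sym (trans e (ListP.++-identityʳ p))) c
      go (k ∷ rest) p x e to (l , inc) c state = go rest (p ++ k ∷ []) (suc y)
          (trans e (sym (ListP.++-assoc p (k ∷ []) rest)))
          (subst (λ z → IncTo 0 z (suc y)) (sym (positions-++ p (k ∷ []))) (IncTo-snoc (positions p) to l))
          inc (subst (Chain κ₁) (sym letters-snoc) (Chain-snoc (letters p) c step)) state'
        where
        j : Fin n
        j = proj₂ k
        y : ℕ
        y = pos k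
        κ : Fin n → ℕ
        κ = bumps κ₁ (letters p)
        letters-snoc : letters (p ++ k ∷ []) ≡ letters p ++ j ∷ []
        letters-snoc = letters-++ p (k ∷ [])
        -- Alive letters whose next position lies before y are skipped at this point and die.
        state-y : ∀ t → Alive p y t ⊎ Dead p y t
        state-y t with state t
        ... | inj₂ (b , m) = inj₂ (ℕP.≤-trans b (ℕP.+-monoʳ-≤ n l) , m)
        ... | inj₁ (r , κ≡ , lo , hi) with y ℕ.≤? pos (r , t)
        ...   | yes y≤ = inj₁ (r , κ≡ , y≤ , ℕP.≤-trans hi (ℕP.+-monoˡ-≤ n l))
        ...   | no y≰ = inj₂ (subst (ℕ._< n ℕ.+ y) (sym κ≡) (ℕP.+-monoʳ-< n (ℕP.≰⇒> y≰)) ,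
                          skipped-Neg p k rest x (r , t) e to lo (ℕP.≰⇒> y≰) (ℕP.≤-refl , inc))
        R-snoc : Reduced a (letters p ++ j ∷ [])
        R-snoc = Reduced-init (letters p ++ j ∷ []) (letters rest) (subst (Reduced a)
          (trans (cong letters e) (trans (letters-++ p (k ∷ rest)) (sym (ListP.++-assoc (letters p) (j ∷ []) (letters rest))))) (proj₁ RL))
        R-p : Reduced a (letters p)
        R-p = Reduced-init (letters p) (j ∷ []) R-snoc
        j-Pos : Pos (act a (letters p) (δ j))
        j-Pos = Reduced-snoc⁻ (letters p) j R-snoc
        not-Neg : Neg (act a (letters p) (δ j)) → ⊥
        not-Neg = Root-not-both (Root-act (letters p) (Root-δ j)) j-Pos
        κj≡ : κ j ≡ n ℕ.+ y
        κj≡ with state-y j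
        ... | inj₂ (_ , m) = ⊥-elim (not-Neg m)
        ... | inj₁ (r , κ≡ , lo , hi) = trans κ≡ (cong (λ r → n ℕ.+ pos (r , j)) (round-unique r (proj₁ k) j lo hi))
        neighbour-alive : ∀ t → Adj j t → Alive p y t
        neighbour-alive t adj with state-y t
        ... | inj₁ al = al
        ... | inj₂ (b , m) = ⊥-elim (not-Neg (Neg-spreads (letters p) c R-p (Adj-sym adj) (subst (κ t ℕ.<_) (sym κj≡) b) m))
        step : Step κ j
        step = step-intro λ t adj → bounds t (proj₁ adj) (neighbour-alive t adj)
          where
          bounds : ∀ t → t ≢ j → Alive p y t → κ j ℕ.< κ t × κ t ℕ.< κ j ℕ.+ n
          bounds t t≢j (r , κ≡ , lo , hi) =
            subst₂ ℕ._<_ (sym κj≡) (sym κ≡) (ℕP.+-monoʳ-< n (ℕP.≤∧≢⇒< lo λ e → t≢j (sym (pos-inj (proj₁ k) r j t e)))) ,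
            subst₂ ℕ._<_ (sym κ≡) (trans (sym (ℕP.+-assoc n y n)) (cong (ℕ._+ n) (sym κj≡))) (ℕP.+-monoʳ-< n hi)
        κ' : Fin n → ℕ
        κ' = bumps κ₁ (letters (p ++ k ∷ []))
        κ'≡ : ∀ t → κ' t ≡ bump j κ t
        κ'≡ t = trans (cong (λ w → bumps κ₁ w t) letters-snoc) (cong (λ f → f t) (bumps-snoc κ₁ (letters p) j))
        state' : ∀ t → Alive (p ++ k ∷ []) (suc y) t ⊎ Dead (p ++ k ∷ []) (suc y) t
        state' t with t ≟ j
        ... | yes refl = inj₁ (suc (proj₁ k) , trans (κ'≡ t) (trans (bump-same t κ) (trans (cong (ℕ._+ n) κj≡) later)) ,
                  subst (suc y ℕ.≤_) next (ℕP.m<n+m y (ℕP.≤-trans (ℕ.s≤s ℕ.z≤n) (FinP.toℕ<n t))) ,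
                  ℕP.≤-reflexive (cong suc (trans (sym next) (ℕP.+-comm n y))))
          where
          next : n ℕ.+ y ≡ pos (suc (proj₁ k) , t)
          next = sym (ℕP.+-assoc n (proj₁ k ℕ.* n) (toℕ t))
          later : n ℕ.+ y ℕ.+ n ≡ n ℕ.+ pos (suc (proj₁ k) , t)
          later = trans (ℕP.+-assoc n y n) (cong (n ℕ.+_) (trans (ℕP.+-comm y n) next))
        ... | no t≢j with state-y t
        ...   | inj₁ (r , κ≡ , lo , hi) = inj₁ (r , trans (trans (κ'≡ t) (bump-diff κ t≢j)) κ≡ ,
                  ℕP.≤∧≢⇒< lo (λ e → t≢j (sym (pos-inj (proj₁ k) r j t e))) , ℕP.m≤n⇒m≤1+n hi)
        ...   | inj₂ (b , m) = inj₂ (subst (ℕ._< n ℕ.+ suc y) (sym (trans (κ'≡ t) (bump-diff κ t≢j)))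
                    (ℕP.≤-trans b (ℕP.+-monoʳ-≤ n (ℕP.n≤1+n y))) , Neg-cong (λ u → sym (unchanged u)) m)
          where
          -- Neighbours of `j` are alive, so a dead letter is not adjacent to `j`; the new
          -- reflection fixes its simple root and the sign persists.
          ajt≡0 : a j t ≡ 0ℤ
          ajt≡0 with a j t ℤ.≟ 0ℤ
          ... | yes z = z
          ... | no nz with neighbour-alive t (t≢j , nz)
          ...   | r , κ≡ , lo , _ = ⊥-elim (ℕP.<⇒≱ b (subst (n ℕ.+ y ℕ.≤_) (sym κ≡) (ℕP.+-monoʳ-≤ n lo)))
          unchanged : act a (letters (p ++ k ∷ [])) (δ t) ≗ act a (letters p) (δ t)
          unchanged u = trans (cong (λ w → act a w (δ t) u) letters-snoc) (trans (act-++ (letters p) (j ∷ []) (δ t) u)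
            (act-cong (letters p) (λ v → trans (reflect-eq j (δ t) v) (trans (cong (λ z → δ t v + - z * δ j v) (trans (A-δ j t) ajt≡0))
              (ℤP.+-identityʳ (δ t v)))) u))

    sorting-chain : Chain κ₁ (letters ps)
    sorting-chain = go ps [] 0 refl ℕ.z≤n (Increasing⇒Inc (positions ps) (proj₁ (proj₁ wo))) _
      (λ t → inj₁ (0 , refl , ℕ.z≤n , FinP.toℕ<n t))

<ᵇ-true : ∀ {x y} → x ℕ.< y → (x ℕ.<ᵇ y) ≡ true
<ᵇ-true {x} {y} l with x ℕ.<ᵇ y | ℕP.<ᵇ-reflects-< x y
... | true | _ = refl
... | false | ofⁿ nl = ⊥-elim (nl l)

<ᵇ-false : ∀ {x y} → y ℕ.≤ x → (x ℕ.<ᵇ y) ≡ false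
<ᵇ-false {x} {y} l with x ℕ.<ᵇ y | ℕP.<ᵇ-reflects-< x y
... | false | _ = refl
... | true | ofʸ nl = ⊥-elim (ℕP.<⇒≱ nl l)

-- Root functions of sets of positions, with positions as natural numbers

module Facets {n : ℕ} (a : CartanMatrix n) (fin : IsFiniteCartan a) (q : ℕ → Fin n) where
  open Roots a fin
  open ReducedWords a fin

  move : Bool → Fin n → Vect n → Vect n
  move true  s v = v
  move false s v = reflect s v

  move-linear : ∀ b s → LinearMap (move b s)
  move-linear true  s t = coord t
  move-linear false s t = reflect-linear s t

  move-cong : ∀ b s {x y} → x ≗ y → move b s x ≗ move b s y
  move-cong b s h t = resp (move-linear b s t) h

  move-invol : ∀ b s v → move b s (move b s v) ≗ v
  move-invol true  s v t = refl
  move-invol false s v t = reflect-invol s v t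

  -- For a set J of positions, w J p is the product of the letters at the positions < p outside J, and u J p its inverse.

  u w : (ℕ → Bool) → ℕ → Vect n → Vect n
  u J zero v = v
  u J (suc p) v = move (J p) (q p) (u J p v)
  w J zero v = v
  w J (suc p) v = w J p (move (J p) (q p) v)

  u-linear : ∀ J p → LinearMap (u J p)
  u-linear J zero t = coord t
  u-linear J (suc p) t = move-linear (J p) (q p) t ∘L u-linear J p

  w-linear : ∀ J p → LinearMap (w J p)
  w-linear J zero t = coord t
  w-linear J (suc p) t = w-linear J p t ∘L move-linear (J p) (q p)

  u-cong : ∀ J p {x y} → x ≗ y → u J p x ≗ u J p y
  u-cong J p h t = resp (u-linear J p t) h

  w-cong : ∀ J p {x y} → x ≗ y → w J p x ≗ w J p y
  w-cong J p h t = resp (w-linear J p t) h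

  u-w : ∀ J p v → u J p (w J p v) ≗ v
  u-w J zero v t = refl
  u-w J (suc p) v t = trans (move-cong (J p) (q p) (u-w J p (move (J p) (q p) v)) t) (move-invol (J p) (q p) v t)

  w-u : ∀ J p v → w J p (u J p v) ≗ v
  w-u J zero v t = refl
  w-u J (suc p) v t = trans (w-cong J p (move-invol (J p) (q p) (u J p v)) t) (w-u J p v t)

  u-neg : ∀ J p v → u J p (neg v) ≗ neg (u J p v)
  u-neg J p v t = at-neg (u-linear J p t) v

  w-neg : ∀ J p v → w J p (neg v) ≗ neg (w J p v)
  w-neg J p v t = at-neg (w-linear J p t) v

  move-isom : ∀ b s x y → ⟨ move b s x , move b s y ⟩ ≡ ⟨ x , y ⟩
  move-isom true  s x y = refl
  move-isom false s x y = reflect-isom s x y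

  u-isom : ∀ J p x y → ⟨ u J p x , u J p y ⟩ ≡ ⟨ x , y ⟩
  u-isom J zero x y = refl
  u-isom J (suc p) x y = trans (move-isom (J p) (q p) _ _) (u-isom J p x y)

  Root-move : ∀ b s {x} → Root x → Root (move b s x)
  Root-move true  s r = r
  Root-move false s r = Root-reflect s r

  Root-u : ∀ J p {x} → Root x → Root (u J p x)
  Root-u J zero r = r
  Root-u J (suc p) r = Root-move (J p) (q p) (Root-u J p r)

  Root-w : ∀ J p {x} → Root x → Root (w J p x)
  Root-w J zero r = r
  Root-w J (suc p) r = Root-w J p (Root-move (J p) (q p) r)

  r : (ℕ → Bool) → ℕ → Vect n
  r J k = w J k (δ (q k))

  Root-r : ∀ J k → Root (r J k)
  Root-r J k = Root-w J k (Root-δ (q k))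

  u-r : ∀ J k → u J k (r J k) ≗ δ (q k)
  u-r J k = u-w J k (δ (q k))

  word : (ℕ → Bool) → ℕ → List (Fin n)
  word J zero = []
  word J (suc p) = if J p then word J p else word J p ++ q p ∷ []

  act-word : ∀ J p v → act a (word J p) v ≗ w J p v
  act-word J zero v t = refl
  act-word J (suc p) v t with J p
  ... | true = act-word J p v t
  ... | false = trans (act-++ (word J p) (q p ∷ []) v t) (act-word J p (reflect (q p) v) t)

  unact-word : ∀ J p v → unact (word J p) v ≗ u J p v
  unact-word J p v t = trans (unact-cong (word J p) (λ s → sym (trans (act-word J p (u J p v) s) (w-u J p v s))) t)
    (unact-act (word J p) (u J p v) t)

  word-split : ∀ J {p} m → ∃ λ rest → word J (m ℕ.+ p) ≡ word J p ++ rest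
  word-split J zero = [] , sym (ListP.++-identityʳ _)
  word-split J {p} (suc m) with word-split J {p} m
  ... | rest , e with J (m ℕ.+ p)
  ...   | true = rest , e
  ...   | false = rest ++ q (m ℕ.+ p) ∷ [] , trans (cong (_++ q (m ℕ.+ p) ∷ []) e) (ListP.++-assoc (word J p) rest _)

  word-ext : ∀ {J J'} p → (∀ k → k ℕ.< p → J k ≡ J' k) → word J p ≡ word J' p
  word-ext zero h = refl
  word-ext {J} {J'} (suc p) h rewrite h p ℕP.≤-refl = cong (λ x → if J' p then x else x ++ q p ∷ []) (word-ext p λ k l → h k (ℕP.m≤n⇒m≤1+n l))

  w-ext : ∀ {J J'} p → (∀ k → k ℕ.< p → J k ≡ J' k) → ∀ v → w J p v ≗ w J' p v
  w-ext {J} {J'} p h v t = trans (sym (act-word J p v t)) (trans (cong (λ x → act a x v t) (word-ext p h)) (act-word J' p v t))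

  -- A discrete intermediate value argument: the sign can change only at a letter outside J, and
  -- there the moved root is simple, so `x` is the root of that position.
  crossing : ∀ J {x} → Root x → ∀ p m → Pos (u J p x) → Neg (u J (m ℕ.+ p) x) →
    ∃ λ j → p ℕ.≤ j × j ℕ.< m ℕ.+ p × J j ≡ false × r J j ≗ x
  crossing J {x} rt p zero P N = ⊥-elim (Root-not-both (Root-u J p rt) P N)
  crossing J {x} rt p (suc m) P N with Root-Signed (Root-u J (m ℕ.+ p) rt)
  ... | inj₂ N' with crossing J rt p m P N'
  ...   | j , l , l' , e , h = j , l , ℕP.m≤n⇒m≤1+n l' , e , h
  crossing J {x} rt p (suc m) P N | inj₁ P' with J (m ℕ.+ p) in eq
  ... | true = ⊥-elim (Root-not-both (Root-u J (m ℕ.+ p) rt) P' N)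
  ... | false = m ℕ.+ p , ℕP.m≤n+m p m , ℕP.≤-refl , eq ,
        λ t → trans (sym (w-cong J (m ℕ.+ p) (only-simple (Root-u J (m ℕ.+ p) rt) P' N) t)) (w-u J (m ℕ.+ p) x t)

  crossing-≤ : ∀ J {x} → Root x → ∀ {p p'} → p ℕ.≤ p' → Pos (u J p x) → Neg (u J p' x) →
    ∃ λ j → p ℕ.≤ j × j ℕ.< p' × J j ≡ false × r J j ≗ x
  crossing-≤ J {x} rt {p} {p'} l P N = subst (λ z → ∃ λ j → p ℕ.≤ j × j ℕ.< z × J j ≡ false × r J j ≗ x) (ℕP.m∸n+n≡m l)
    (crossing J rt p (p' ℕ.∸ p) P (subst (λ z → Neg (u J z x)) (sym (ℕP.m∸n+n≡m l)) N))

  toggle : ℕ → (ℕ → Bool) → ℕ → Bool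
  toggle i J k = if ⌊ k ℕ.≟ i ⌋ then not (J k) else J k

  toggle-same : ∀ i J → toggle i J i ≡ not (J i)
  toggle-same i J with i ℕ.≟ i
  ... | yes _ = refl
  ... | no p = ⊥-elim (p refl)

  toggle-diff : ∀ {i k} J → k ≢ i → toggle i J k ≡ J k
  toggle-diff {i} {k} J k≢i with k ℕ.≟ i
  ... | yes p = ⊥-elim (k≢i p)
  ... | no _ = refl

  -- The reflection in the root `r J i`, as a conjugate of a simple one; `pair J i` is the pairing
  -- with its coroot.
  mirror : (ℕ → Bool) → ℕ → Vect n → Vect n
  mirror J i v = w J i (reflect (q i) (u J i v))

  pair : (ℕ → Bool) → ℕ → Vect n → ℤ
  pair J i v = A (q i) (u J i v)

  mirror-cong : ∀ J i {x y} → x ≗ y → mirror J i x ≗ mirror J i y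
  mirror-cong J i h = w-cong J i (reflect-cong (q i) (u-cong J i h))

  mirror-invol : ∀ J i v → mirror J i (mirror J i v) ≗ v
  mirror-invol J i v t = trans (w-cong J i (λ s → trans (reflect-cong (q i) (u-w J i _) s) (reflect-invol (q i) (u J i v) s)) t) (w-u J i v t)

  mirror-eq : ∀ J i v → mirror J i v ≗ (v +⟨ - pair J i v ⟩ r J i)
  mirror-eq J i v t = trans (w-cong J i (reflect-eq (q i) (u J i v)) t) (trans (lin (w-linear J i t) (u J i v) (- pair J i v) (δ (q i)))
    (cong (_+ - pair J i v * r J i t) (w-u J i v t)))

  mirror-r : ∀ J i → mirror J i (r J i) ≗ neg (r J i)
  mirror-r J i t = trans (w-cong J i (λ s → trans (reflect-cong (q i) (u-r J i) s) (reflect-δ (q i) s)) t) (w-neg J i (δ (q i)) t)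

  pair-form : ∀ J i v → dZ (q i) * pair J i v ≡ ⟨ r J i , v ⟩
  pair-form J i v = trans (sym (⟨δ,⟩ (q i) (u J i v))) (trans (sym (⟨⟩-cong (u-r J i) (λ _ → refl))) (u-isom J i (r J i) v))

  r-norm : ∀ J i → ⟨ r J i , r J i ⟩ ≡ int 2 * dZ (q i)
  r-norm J i = trans (sym (u-isom J i _ _)) (trans (⟨⟩-cong (u-r J i) (u-r J i)) (norm-δ (q i)))

  private
    2>0 : 0ℤ < int 2
    2>0 = +<+ (ℕ.s≤s ℕ.z≤n)

  neg-form : ∀ x y → ⟨ neg x , y ⟩ ≡ - ⟨ x , y ⟩
  neg-form x y = at-neg (⟨⟩-linˡ y) x

  d-unique : ∀ {J i J' j} → r J' j ≗ r J i ⊎ r J' j ≗ neg (r J i) → dZ (q j) ≡ dZ (q i)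
  d-unique {J} {i} {J'} {j} h = cancel-pos 2>0 (trans (sym (r-norm J' j)) (trans (norms h) (r-norm J i)))
    where
    norms : r J' j ≗ r J i ⊎ r J' j ≗ neg (r J i) → ⟨ r J' j , r J' j ⟩ ≡ ⟨ r J i , r J i ⟩
    norms (inj₁ h) = ⟨⟩-cong h h
    norms (inj₂ h) = trans (⟨⟩-cong h h) (trans (neg-form _ _) (trans (cong -_ (at-neg (⟨⟩-linʳ (r J i)) (r J i))) (ℤP.neg-involutive _)))

  -- A sign of the root enters once through the coroot pairing and once through the root itself, and
  -- cancels.
  mirror-unique : ∀ {J i J' j} → r J' j ≗ r J i ⊎ r J' j ≗ neg (r J i) → ∀ v → mirror J' j v ≗ mirror J i v
  mirror-unique {J} {i} {J'} {j} h v t = trans (mirror-eq J' j v t) (trans (go h) (sym (mirror-eq J i v t)))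
    where
    d≡ : dZ (q j) ≡ dZ (q i)
    d≡ = d-unique {J} {i} {J'} {j} h
    arith : ∀ x p r → x + - - p * - r ≡ x + - p * r
    arith = solve-∀
    go : r J' j ≗ r J i ⊎ r J' j ≗ neg (r J i) → v t + - pair J' j v * r J' j t ≡ v t + - pair J i v * r J i t
    go (inj₁ h) = cong₂ (λ p s → v t + - p * s) (cancel-pos (0<d (q j)) (trans (pair-form J' j v) (trans (⟨⟩-cong h (λ _ → refl))
      (trans (sym (pair-form J i v)) (cong (_* pair J i v) (sym d≡)))))) (h t)
    go (inj₂ h) = trans (cong₂ (λ p s → v t + - p * s) (cancel-pos {dZ (q j)} {pair J' j v} { - pair J i v} (0<d (q j)) (trans (pair-form J' j v)
      (trans (⟨⟩-cong h (λ _ → refl)) (trans (neg-form (r J i) v) (trans (cong -_ (sym (pair-form J i v)))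
      (trans (ℤP.neg-distribʳ-* (dZ (q i)) (pair J i v)) (cong (_* - pair J i v) (sym d≡)))))))) (h t)) (arith (v t) (pair J i v) (r J i t))

  w-toggle-≤ : ∀ {i p} J → p ℕ.≤ i → ∀ v → w (toggle i J) p v ≗ w J p v
  w-toggle-≤ J l = w-ext _ λ k k<p → toggle-diff J λ e → ℕP.<⇒≱ k<p (subst (_ ℕ.≤_) (sym e) l)

  -- Inserting or deleting the letter at i multiplies later prefixes on the left by a conjugate of
  -- that letter.
  w-toggle-> : ∀ {i p} J → i ℕ.< p → ∀ v → w (toggle i J) p v ≗ mirror J i (w J p v)
  w-toggle-> {i} {suc p} J i<p v with p ℕ.≟ i
  ... | yes refl = ≗-trans (w-toggle-≤ {i} {i} J ℕP.≤-refl (move (not (J i)) (q i) v)) (w-cong J i body)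
    where
    flip-move : ∀ b s x → move (not b) s x ≗ reflect s (move b s x)
    flip-move true  s x t = refl
    flip-move false s x t = sym (reflect-invol s x t)
    body : move (not (J i)) (q i) v ≗ reflect (q i) (u J i (w J i (move (J i) (q i) v)))
    body t = trans (flip-move (J i) (q i) v t) (sym (reflect-cong (q i) (u-w J i _) t))
  ... | no p≢i = w-toggle-> J (ℕP.≤∧≢⇒< (ℕP.≤-pred i<p) (λ e → p≢i (sym e))) (move (J p) (q p) v)

  length-toggle : ∀ {i p} J → J i ≡ true → i ℕ.< p → length (word (toggle i J) p) ≡ suc (length (word J p))
  length-toggle {i} {suc p} J Ji i<p with p ℕ.≟ i
  ... | yes refl rewrite Ji = trans (ListP.length-++ (word (toggle i J) i)) (trans (ℕP.+-comm _ 1)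
          (cong (suc ∘ length) (word-ext i λ k l → toggle-diff J λ e → ℕP.<-irrefl e l)))
  ... | no p≢i with J p
  ...   | true = length-toggle J Ji (ℕP.≤∧≢⇒< (ℕP.≤-pred i<p) (λ e → p≢i (sym e)))
  ...   | false = trans (ListP.length-++ (word (toggle i J) p)) (trans (cong (ℕ._+ 1) (length-toggle J Ji (ℕP.≤∧≢⇒< (ℕP.≤-pred i<p) (λ e → p≢i (sym e)))))
                    (cong suc (sym (ListP.length-++ (word J p)))))

  mirror-if : Bool → (ℕ → Bool) → ℕ → Vect n → Vect n
  mirror-if true  J i v = mirror J i v
  mirror-if false J i v = v

  mirror-if-cong : ∀ b J i {x y} → x ≗ y → mirror-if b J i x ≗ mirror-if b J i y
  mirror-if-cong true  J i h = mirror-cong J i h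
  mirror-if-cong false J i h = h

  mirror-if-invol : ∀ b J i v → mirror-if b J i (mirror-if b J i v) ≗ v
  mirror-if-invol true  J i v = mirror-invol J i v
  mirror-if-invol false J i v t = refl

  mirror-if-xor : ∀ b c J i v → mirror-if b J i (mirror-if c J i v) ≗ mirror-if (b xor c) J i v
  mirror-if-xor true  true  J i v = mirror-invol J i v
  mirror-if-xor true  false J i v t = refl
  mirror-if-xor false c     J i v t = refl

  -- Flips

  module _ (L : ℕ) where

    Facet : (ℕ → Bool) → Set
    Facet J = ReducedLongest a (word J L)

    facet-Pos : ∀ {J} → Facet J → ∀ {k} → k ℕ.< L → J k ≡ false → Pos (r J k)
    facet-Pos {J} (R , _) {k} k<L Jk with word-split J {suc k} (L ℕ.∸ suc k)
    ... | rest , e = Pos-cong (act-word J k (δ (q k))) (Reduced-snoc⁻ (word J k) (q k)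
          (subst (Reduced a) (cong (λ b → if b then word J k else word J k ++ q k ∷ []) Jk)
            (Reduced-init (word J (suc k)) rest (subst (Reduced a) (trans (cong (word J) (sym (ℕP.m∸n+n≡m k<L))) e) R))))

    module _ {J : ℕ → Bool} (F : Facet J) where

      -- The root turns negative at its own letter. Turning positive again at a later p would make
      -- it the negative of `r J p`, but the roots at positions outside a facet are all positive.
      inversion-Neg : ∀ {k} → k ℕ.< L → J k ≡ false → ∀ {p} → k ℕ.< p → p ℕ.≤ L → Neg (u J p (r J k))
      inversion-Neg {k} k<L Jk {suc p} k<p p<L with p ℕ.≟ k
      ... | yes refl rewrite Jk = Neg-cong (λ t → sym (trans (reflect-cong (q k) (u-r J k) t) (reflect-δ (q k) t))) (neg-Pos (δ-Pos (q k)))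
      ... | no p≢k with inversion-Neg k<L Jk (ℕP.≤∧≢⇒< (ℕP.≤-pred k<p) (λ e → p≢k (sym e))) (ℕP.<⇒≤ p<L)
      ...   | N with J p in eq
      ...     | true = N
      ...     | false with Root-Signed (Root-reflect (q p) (Root-u J p (Root-r J k)))
      ...       | inj₂ N' = N'
      ...       | inj₁ P = ⊥-elim (Root-not-both (Root-r J p) (facet-Pos F p<L eq) (Neg-cong (≗-sym rp≗) (neg-Pos (facet-Pos F k<L Jk))))
        where
        y : Vect n
        y = u J p (r J k)
        rp≗ : r J p ≗ neg (r J k)
        rp≗ t = trans (sym (w-cong J p (only-simple (Root-neg (Root-u J p (Root-r J k))) (neg-Neg N)
            (Neg-cong (λ s → sym (at-neg (reflect-linear (q p) s) y)) (neg-Pos P))) t))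
          (trans (w-neg J p y t) (cong -_ (w-u J p (r J k) t)))

      -- If it were negative earlier, an earlier position would carry the same root, and
      -- `inversion-Neg` would make it negative at k, where it is simple.
      noninversion-Pos : ∀ {k} → k ℕ.< L → J k ≡ false → ∀ {p} → p ℕ.≤ k → Pos (u J p (r J k))
      noninversion-Pos {k} k<L Jk {p} p≤k with Root-Signed (Root-u J p (Root-r J k))
      ... | inj₁ P = P
      ... | inj₂ N with crossing-≤ J (Root-r J k) {0} {p} ℕ.z≤n (facet-Pos F k<L Jk) N
      ...   | j , _ , j<p , Jj , h = ⊥-elim (Root-not-both (Root-u J k (Root-r J k)) (Pos-cong (≗-sym (u-r J k)) (δ-Pos (q k)))
                (Neg-cong (u-cong J k h) (inversion-Neg (ℕP.<-≤-trans j<p (ℕP.≤-trans p≤k (ℕP.<⇒≤ k<L))) Jj (ℕP.<-≤-trans j<p p≤k) (ℕP.<⇒≤ k<L))))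

      facet-unique : ∀ {k l} → k ℕ.< L → l ℕ.< L → J k ≡ false → J l ≡ false → r J k ≗ r J l → k ≡ l
      facet-unique {k} {l} k<L l<L Jk Jl h with ℕP.<-cmp k l
      ... | tri≈ _ e _ = e
      ... | tri< k<l _ _ = ⊥-elim (Root-not-both (Root-u J l (Root-r J l)) (Pos-cong (≗-sym (u-r J l)) (δ-Pos (q l)))
              (Neg-cong (u-cong J l h) (inversion-Neg k<L Jk k<l (ℕP.<⇒≤ l<L))))
      ... | tri> _ _ l<k = ⊥-elim (Root-not-both (Root-u J k (Root-r J k)) (Pos-cong (≗-sym (u-r J k)) (δ-Pos (q k)))
              (Neg-cong (u-cong J k (≗-sym h)) (inversion-Neg l<L Jl l<k (ℕP.<⇒≤ k<L))))

      u-L-Neg : ∀ {x} → Root x → Pos x → Neg (u J L x)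
      u-L-Neg {x} rt P = Neg-cong (unact-word J L x) (longest-unact-Neg (word J L) F rt P)

      record Flip (i j : ℕ) : Set where
        field
          i<L : i ℕ.< L
          j<L : j ℕ.< L
          Ji  : J i ≡ true
          Jj  : J j ≡ false
          dir : (i ℕ.< j × r J j ≗ r J i) ⊎ (j ℕ.< i × r J j ≗ neg (r J i))

      -- A positive root at i is simple when i is reached and negative at the end. If the root is
      -- negative, its opposite starts positive and is negative when i is reached. The sign change
      -- in between locates j.
      flip-exists : ∀ {i} → i ℕ.< L → J i ≡ true → ∃ (Flip i)
      flip-exists {i} i<L Ji with Root-Signed (Root-r J i)
      ... | inj₁ P with crossing-≤ J (Root-r J i) (ℕP.<⇒≤ i<L) (Pos-cong (≗-sym (u-r J i)) (δ-Pos (q i))) (u-L-Neg (Root-r J i) P)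
      ...   | j , i≤j , j<L , Jj , h = j , record { i<L = i<L ; j<L = j<L ; Ji = Ji ; Jj = Jj
                ; dir = inj₁ (ℕP.≤∧≢⇒< i≤j (λ e → case trans (sym Ji) (trans (cong J e) Jj) of λ ()) , h) }
      flip-exists {i} i<L Ji | inj₂ N with crossing-≤ J (Root-neg (Root-r J i)) {0} {i} ℕ.z≤n (neg-Neg N)
            (Neg-cong (λ t → sym (trans (u-neg J i _ t) (cong -_ (u-r J i t)))) (neg-Pos (δ-Pos (q i))))
      ... | j , _ , j<i , Jj , h = j , record { i<L = i<L ; j<L = ℕP.<-trans j<i i<L ; Ji = Ji ; Jj = Jj ; dir = inj₂ (j<i , h) }

    flipped : (ℕ → Bool) → ℕ → ℕ → ℕ → Bool
    flipped J i j = toggle j (toggle i J)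

    module Flipping {J : ℕ → Bool} (F : Facet J) {i j : ℕ} (fl : Flip F i j) where
      open Flip fl public

      J' : ℕ → Bool
      J' = flipped J i j

      i≢j : i ≢ j
      i≢j e = case trans (sym Ji) (trans (cong J e) Jj) of λ ()

      d-flip : dZ (q j) ≡ dZ (q i)
      d-flip with dir
      ... | inj₁ (_ , h) = d-unique {J} {i} {J} {j} (inj₁ h)
      ... | inj₂ (_ , h) = d-unique {J} {i} {J} {j} (inj₂ h)

      J'i : J' i ≡ false
      J'i = trans (toggle-diff (toggle i J) i≢j) (trans (toggle-same i J) (cong not Ji))

      J'j : J' j ≡ true
      J'j = trans (toggle-same j (toggle i J)) (cong not (trans (toggle-diff J (λ e → i≢j (sym e))) Jj))

      J'k : ∀ {k} → k ≢ i → k ≢ j → J' k ≡ J k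
      J'k k≢i k≢j = trans (toggle-diff (toggle i J) k≢j) (toggle-diff J k≢i)

      -- After the first toggle the root at j is `r J i` up to sign, so both toggles multiply by the
      -- same reflection and cancel beyond both positions.
      second-mirror : ∀ v → mirror (toggle i J) j v ≗ mirror J i v
      second-mirror = mirror-unique {J} {i} {toggle i J} {j} root
        where
        root : r (toggle i J) j ≗ r J i ⊎ r (toggle i J) j ≗ neg (r J i)
        root with dir
        ... | inj₁ (i<j , h) = inj₂ (≗-trans (w-toggle-> J i<j (δ (q j))) (≗-trans (mirror-cong J i h) (mirror-r J i)))
        ... | inj₂ (j<i , h) = inj₂ (≗-trans (w-toggle-≤ J (ℕP.<⇒≤ j<i) (δ (q j))) h)

      -- Marks the prefixes that contain exactly one of the two toggled positions, where one
      -- reflection is left over.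
      window : ℕ → Bool
      window p = (i ℕ.<ᵇ p) xor (j ℕ.<ᵇ p)

      private
        once : ∀ {i} J p v → w (toggle i J) p v ≗ mirror-if (i ℕ.<ᵇ p) J i (w J p v)
        once {i} J p v with i ℕ.<ᵇ p | ℕP.<ᵇ-reflects-< i p
        ... | true  | ofʸ l = w-toggle-> J l v
        ... | false | ofⁿ l = w-toggle-≤ J (ℕP.≮⇒≥ l) v

        second-mirror-if : ∀ b v → mirror-if b (toggle i J) j v ≗ mirror-if b J i v
        second-mirror-if true  v = second-mirror v
        second-mirror-if false v t = refl

      w-flip : ∀ p v → w J' p v ≗ mirror-if (window p) J i (w J p v)
      w-flip p v = ≗-trans (once (toggle i J) p v) (≗-trans (second-mirror-if (j ℕ.<ᵇ p) _)
        (≗-trans (mirror-if-cong (j ℕ.<ᵇ p) J i (once J p v)) (≗-trans (mirror-if-xor (j ℕ.<ᵇ p) (i ℕ.<ᵇ p) J i (w J p v))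
          (λ t → cong (λ b → mirror-if b J i (w J p v) t) (xor-comm (j ℕ.<ᵇ p) (i ℕ.<ᵇ p))))))

      u-flip : ∀ p v → u J' p v ≗ u J p (mirror-if (window p) J i v)
      u-flip p v t = trans (sym (u-w J p (u J' p v) t)) (u-cong J p (λ s → trans (sym (mirror-if-invol (window p) J i _ s))
        (mirror-if-cong (window p) J i (λ s' → trans (sym (w-flip p (u J' p v) s')) (w-u J' p v s')) s)) t)

      r-flip : ∀ k → r J' k ≗ mirror-if (window k) J i (r J k)
      r-flip k = w-flip k (δ (q k))

      facet-flip : Facet J'
      facet-flip = longest-transfer (word J L) (word J' L) F same len
        where
        same : SameElt a (word J L) (word J' L)
        same v t = trans (act-word J L v t) (sym (trans (act-word J' L v t) (trans (w-flip L v t)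
          (cong (λ b → mirror-if b J i (w J L v) t) (cong₂ _xor_ (<ᵇ-true i<L) (<ᵇ-true j<L))))))
        len : length (word J' L) ≡ length (word J L)
        len = ℕP.suc-injective (trans (sym (length-toggle J' J'j j<L)) (trans (cong length (word-ext L λ k _ → twice k)) (length-toggle J Ji i<L)))
          where
          twice : ∀ k → toggle j J' k ≡ toggle i J k
          twice k with k ℕ.≟ j
          ... | yes _ = not-involutive (toggle i J k)
          ... | no _ = refl

      r-flip-new : r J' j ≗ neg (r J i)
      r-flip-new with dir
      ... | inj₁ (i<j , h) = ≗-trans (r-flip j) (≗-trans (λ t → cong (λ b → mirror-if b J i (r J j) t) (cong₂ _xor_ (<ᵇ-true i<j) (<ᵇ-false (ℕP.≤-refl {j}))))
              (≗-trans (mirror-cong J i h) (mirror-r J i)))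
      ... | inj₂ (j<i , h) = ≗-trans (r-flip j) (≗-trans (λ t → cong (λ b → mirror-if b J i (r J j) t) (cong₂ _xor_ (<ᵇ-false (ℕP.<⇒≤ j<i)) (<ᵇ-false (ℕP.≤-refl {j})))) h)

-- Propositional tautologies, checked by truth table

BoolFun : ℕ → Set
BoolFun zero = Bool
BoolFun (suc k) = Bool → BoolFun k

check : ∀ k → BoolFun k → Bool
check zero f = f
check (suc k) f = check k (f true) ∧ check k (f false)

Valid : ∀ k → BoolFun k → Set
Valid zero f = f ≡ true
Valid (suc k) f = ∀ b → Valid k (f b)

∧-true : ∀ {x y} → x ∧ y ≡ true → x ≡ true × y ≡ true
∧-true {true} {true} _ = refl , refl

-- Reflection: the truth table is evaluated by the type checker, so a proof is `refl`.
valid : ∀ k f → check k f ≡ true → Valid k f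
valid zero f h = h
valid (suc k) f h true = valid k (f true) (proj₁ (∧-true h))
valid (suc k) f h false = valid k (f false) (proj₂ (∧-true {check k (f true)} h))

infixr 3 _⊃_
infixr 4 _⇔ᵇ_
_⊃_ _⇔ᵇ_ : Bool → Bool → Bool
b ⊃ c = not b ∨ c
b ⇔ᵇ c = not (b xor c)

⊃-elim : ∀ {b c} → (b ⊃ c) ≡ true → b ≡ true → c ≡ true
⊃-elim {true} h refl = h

⇔ᵇ-elim : ∀ {b c} → (b ⇔ᵇ c) ≡ true → b ≡ c
⇔ᵇ-elim {true} {true} _ = refl
⇔ᵇ-elim {false} {false} _ = refl

<ᵇ-trans : ∀ x y z → ((x ℕ.<ᵇ y) ∧ (y ℕ.<ᵇ z) ⊃ (x ℕ.<ᵇ z)) ≡ true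
<ᵇ-trans x y z with x ℕ.<ᵇ y | ℕP.<ᵇ-reflects-< x y | y ℕ.<ᵇ z | ℕP.<ᵇ-reflects-< y z
... | false | _ | _ | _ = refl
... | true | _ | false | _ = refl
... | true | ofʸ l | true | ofʸ l' = <ᵇ-true (ℕP.<-trans l l')

<ᵇ-cotrans : ∀ x y z → ((x ℕ.<ᵇ z) ⊃ ((x ℕ.<ᵇ y) ∨ (y ℕ.<ᵇ z))) ≡ true
<ᵇ-cotrans x y z with x ℕ.<ᵇ z | ℕP.<ᵇ-reflects-< x z | x ℕ.<ᵇ y | ℕP.<ᵇ-reflects-< x y
... | false | _ | _ | _ = refl
... | true | _ | true | _ = refl
... | true | ofʸ l | false | ofⁿ nl = <ᵇ-true (ℕP.≤-<-trans (ℕP.≮⇒≥ nl) l)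

-- Signs are Booleans, `true` being plus. Their product is `_⇔ᵇ_`, so the bookkeeping of signs
-- becomes propositional.
sg : Bool → ℤ → ℤ
sg true  x = x
sg false x = - x

sg-sg : ∀ b c x → sg b (sg c x) ≡ sg (b ⇔ᵇ c) x
sg-sg true  true  x = refl
sg-sg true  false x = refl
sg-sg false true  x = refl
sg-sg false false x = ℤP.neg-involutive x

[]₊-pos : ∀ {x} → 0ℤ ≤ x → int [ x ]₊ ≡ x
[]₊-pos {int m} _ = refl

[]₊-neg : ∀ {x} → 0ℤ ≤ x → int [ - x ]₊ ≡ 0ℤ
[]₊-neg {int zero} _ = refl
[]₊-neg {int (suc m)} _ = refl

sgV : ∀ {n} → Bool → Vect n → Vect n
sgV b v t = sg b (v t)

sg-cong : ∀ {b c x y} → b ≡ c → x ≡ y → sg b x ≡ sg c y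
sg-cong refl refl = refl

-- Iterated `bump` along Q, stated outside `Euler` so that module telescopes can mention it.
orient : ∀ {n} → CartanMatrix n → (ℕ → Fin n) → (Fin n → ℕ) → ℕ → Fin n → ℕ
orient a q κ₀ zero = κ₀
orient {n} a q κ₀ (suc p) t = if ⌊ t ≟ q p ⌋ then orient a q κ₀ p t ℕ.+ n else orient a q κ₀ p t

-- Facets as exceptional sequences: rotations, flips and tropical signs

module Frames {n : ℕ} (a : CartanMatrix n) (fin : IsFiniteCartan a) (q : ℕ → Fin n) (κ₀ : Fin n → ℕ) (L : ℕ)
  (steps : ∀ p → p ℕ.< L → Euler.Step a fin (orient a q κ₀ p) (q p)) (sep : Euler.Separating a fin κ₀) where

  open Roots a fin
  open ReducedWords a fin
  open Euler a fin
  open Sorting a fin using (A-≤0)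
  open Facets a fin q

  κ : ℕ → Fin n → ℕ
  κ = orient a q κ₀

  Triangular : (ℕ → Bool) → Set
  Triangular J = ∀ {x y} → x ℕ.< y → y ℕ.< L → J x ≡ true → J y ≡ true → E κ₀ (r J x) (r J y) ≡ 0ℤ

  -- The order of the positions after rotating the first p of them to the end.
  data Before (p x y : ℕ) : Set where
    tail  : p ℕ.≤ x → x ℕ.< y → Before p x y
    head  : x ℕ.< y → y ℕ.< p → Before p x y
    cross : p ℕ.≤ x → y ℕ.< p → Before p x y

  private
    first : ∀ {p x} → x ≢ p → Before p p x
    first {p} {x} x≢p with ℕP.<-cmp p x
    ... | tri< l _ _ = tail ℕP.≤-refl l
    ... | tri≈ _ e _ = ⊥-elim (x≢p (sym e))
    ... | tri> _ _ l = cross ℕP.≤-refl l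

    unrotate : ∀ {p x y} → x ≢ p → y ≢ p → Before (suc p) x y → Before p x y
    unrotate x≢p y≢p (tail l l') = tail (ℕP.<⇒≤ l) l'
    unrotate x≢p y≢p (head l l') = head l (ℕP.≤∧≢⇒< (ℕP.≤-pred l') y≢p)
    unrotate x≢p y≢p (cross l l') = cross (ℕP.<⇒≤ l) (ℕP.≤∧≢⇒< (ℕP.≤-pred l') y≢p)

    not-first : ∀ {p x} → ¬ Before (suc p) p x
    not-first (tail l _) = ℕP.<-irrefl refl l
    not-first (head l l') = ℕP.<⇒≱ l (ℕP.≤-pred l')
    not-first (cross l _) = ℕP.<-irrefl refl l

  module Rotations {J : ℕ → Bool} (T : Triangular J) where

    -- Outside J the letter transports E by reflection. At a position of J the roots stay, and the
    -- correction of `E-bump` vanishes by `coef`. The root at that position becomes the last one,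
    -- and its letter a sink, so that E again reads off the vanishing coefficient.
    rotated : ∀ p → p ℕ.≤ L → ∀ {x y} → x ℕ.< L → y ℕ.< L → J x ≡ true → J y ≡ true → Before p x y →
      E (κ p) (u J p (r J x)) (u J p (r J y)) ≡ 0ℤ
    -- In this rotation the root at p is the simple root of a source and comes first; its value
    -- under E with another root is `dZ` times the coefficient of that root.
    coef : ∀ {p} → p ℕ.< L → J p ≡ true → ∀ {x} → x ℕ.< L → J x ≡ true → x ≢ p → u J p (r J x) (q p) ≡ 0ℤ

    coef {p} p<L Jp x<L Jx x≢p = cancel-pos (0<d (q p)) (trans (sym (E-source (source (steps p p<L)) _))
      (trans (sym (E-cong (κ p) (u-r J p) (λ _ → refl))) (trans (rotated p (ℕP.<⇒≤ p<L) p<L x<L Jp Jx (first x≢p)) (sym (ℤP.*-zeroʳ (dZ (q p)))))))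

    rotated zero _ x<L y<L Jx Jy (tail _ l) = T l y<L Jx Jy
    rotated (suc p) p<L {x} {y} x<L y<L Jx Jy b with x ℕ.≟ p | y ℕ.≟ p
    ... | yes refl | _ = ⊥-elim (not-first b)
    ... | no x≢p | yes refl rewrite Jy = trans (E-cong (κ (suc p)) (λ _ → refl) (u-r J p)) (trans (E-sink (sink (steps p p<L)) _)
            (trans (cong (dZ (q p) *_) (coef p<L Jy x<L Jx x≢p)) (ℤP.*-zeroʳ (dZ (q p)))))
    ... | no x≢p | no y≢p with rotated p (ℕP.<⇒≤ p<L) x<L y<L Jx Jy (unrotate x≢p y≢p b) | J p in Jp
    ...   | z | false = trans (E-reflect (steps p p<L) _ _) z
    ...   | z | true = trans (E-bump (steps p p<L) _ _) (trans (cong₂ _+_ z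
              (trans (cong₂ (λ s t → dZ (q p) * (s * A (q p) Y - t * A (q p) X)) (coef p<L Jp x<L Jx x≢p) (coef p<L Jp y<L Jy y≢p))
                     (arith (dZ (q p)) (A (q p) Y) (A (q p) X)))) refl)
      where
      X Y : Vect n
      X = u J p (r J x)
      Y = u J p (r J y)
      arith : ∀ d s t → d * (0ℤ * s - 0ℤ * t) ≡ 0ℤ
      arith = solve-∀

    -- A letter at a position m of J only adds a multiple of r J m, which does not contribute by coef.
    all-letters : ∀ {k} → k ℕ.< L → J k ≡ true → ∀ {p} → p ℕ.≤ k → ∀ v →
      u (λ _ → false) k (w (λ _ → false) p v) (q k) ≡ u J k (w J p v) (q k)
    all-letters {k} k<L Jk {p} p≤k v = trans (sym (u-w J k _ (q k)))
      (trans (subst (λ m → value m ≡ value p) (ℕP.m∸n+n≡m p≤k) (constant (k ℕ.∸ p) (ℕP.≤-reflexive (ℕP.m∸n+n≡m p≤k))))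
             (u-cong J k (w-cong J p (u-w (λ _ → false) p v)) (q k)))
      where
      y : ℕ → Vect n
      y m = u (λ _ → false) m (w (λ _ → false) p v)
      value : ℕ → ℤ
      value m = u J k (w J m (y m)) (q k)
      constant : ∀ m → m ℕ.+ p ℕ.≤ k → value (m ℕ.+ p) ≡ value p
      constant zero _ = refl
      constant (suc m) l with constant m (ℕP.<⇒≤ l) | J (m ℕ.+ p) in Jm
      ... | e | false = trans (u-cong J k (w-cong J (m ℕ.+ p) (reflect-invol (q (m ℕ.+ p)) (y (m ℕ.+ p)))) (q k)) e
      ... | e | true = trans (u-cong J k (λ t → trans (w-cong J (m ℕ.+ p) (reflect-eq s z) t) (lin (w-linear J (m ℕ.+ p) t) z c (δ s))) (q k))
          (trans (lin (u-linear J k (q k)) (w J (m ℕ.+ p) z) c (r J (m ℕ.+ p)))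
          (trans (cong (λ o → u J k (w J (m ℕ.+ p) z) (q k) + c * o) (coef k<L Jk (ℕP.<-trans l k<L) Jm (ℕP.<⇒≢ l)))
          (trans (cong (u J k (w J (m ℕ.+ p) z) (q k) +_) (ℤP.*-zeroʳ c)) (trans (ℤP.+-identityʳ _) e))))
        where
        s : Fin n
        s = q (m ℕ.+ p)
        z : Vect n
        z = y (m ℕ.+ p)
        c : ℤ
        c = - A s z

  -- The root at position k after rotating the first p letters to the end; passing the end negates a root.
  ρ : (ℕ → Bool) → ℕ → ℕ → Vect n
  ρ J p k = sgV (not (k ℕ.<ᵇ p)) (u J p (r J k))

  module Mutation {J : ℕ → Bool} (F : Facet L J) (T : Triangular J) {i j : ℕ} (fl : Flip L F i j) where
    open Flipping L F fl public
    open Rotations T public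

    Aᵢ : ℕ → ℤ
    Aᵢ k = pair J i (r J k)

    -- Also the sign of `r J i`: the flip goes to the right exactly if this root is positive.
    up : Bool
    up = i ℕ.<ᵇ j

    up-dir : (up ≡ true × r J i ≗ r J j) ⊎ (up ≡ false × r J i ≗ neg (r J j))
    up-dir with dir
    ... | inj₁ (l , h) = inj₁ (<ᵇ-true l , ≗-sym h)
    ... | inj₂ (l , h) = inj₂ (<ᵇ-false (ℕP.<⇒≤ l) , λ t → sym (trans (cong -_ (h t)) (ℤP.neg-involutive _)))

    private
      form-A : ∀ k → dZ (q i) * Aᵢ k ≡ dZ (q k) * A (q k) (u J k (r J i))
      form-A k = trans (pair-form J i (r J k)) (trans (sym (u-isom J k _ _)) (trans (⟨⟩-cong (λ _ → refl) (u-r J k)) (⟨,δ⟩ _ (q k))))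

      A≤0 : ∀ {k} → k ℕ.< L → J k ≡ true → k ≢ i → Pos (u J k (r J i)) → Aᵢ k ≤ 0ℤ
      A≤0 {k} k<L Jk k≢i P = cancel-≤0 (0<d (q i)) (subst (_≤ 0ℤ) (sym (form-A k))
        (*≤0 (<⇒≤ (0<d (q k))) (A-≤0 P (coef k<L Jk i<L Ji (λ z → k≢i (sym z))))))

      0≤A : ∀ {k} → k ℕ.< L → J k ≡ true → k ≢ i → Neg (u J k (r J i)) → 0ℤ ≤ Aᵢ k
      0≤A {k} k<L Jk k≢i N = cancel-0≤ (0<d (q i)) (subst (0ℤ ≤_) (sym (form-A k))
        (0≤* (<⇒≤ (0<d (q k))) (subst (0ℤ ≤_) (trans (cong -_ (at-neg (A-linear (q k)) _)) (ℤP.neg-involutive _))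
          (0≤- (A-≤0 (neg-Neg N) (cong -_ (coef k<L Jk i<L Ji (λ z → k≢i (sym z)))))))))

      ≢j : ∀ {k} → J k ≡ true → k ≢ j
      ≢j Jk refl = case trans (sym Jk) Jj of λ ()

      from-neg : ∀ p {x y : Vect n} → x ≗ neg y → u J p x ≗ neg (u J p y)
      from-neg p {y = y} h = ≗-trans (u-cong J p h) (u-neg J p y)

    -- After the letters before k, the root at k is simple and the root at i has no coefficient
    -- there, so their pairing has the weakly opposite sign to the root at i. Up to `up` this is the
    -- root at j, which is positive until j is passed and negative afterwards.
    A-sign : ∀ {k} → k ℕ.< L → J k ≡ true → k ≢ i → 0ℤ ≤ sg (up ⇔ᵇ (j ℕ.<ᵇ k)) (Aᵢ k)
    A-sign {k} k<L Jk k≢i with ℕP.<-cmp j k | up-dir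
    ... | tri≈ _ j≡k _ | _ = ⊥-elim (≢j Jk (sym j≡k))
    ... | tri< j<k _ _ | inj₁ (up≡ , h) = subst (λ b → 0ℤ ≤ sg b (Aᵢ k)) (sym (cong₂ _⇔ᵇ_ up≡ (<ᵇ-true j<k)))
            (0≤A k<L Jk k≢i (Neg-cong (u-cong J k (≗-sym h)) (inversion-Neg L F j<L Jj j<k (ℕP.<⇒≤ k<L))))
    ... | tri< j<k _ _ | inj₂ (up≡ , h) = subst (λ b → 0ℤ ≤ sg b (Aᵢ k)) (sym (cong₂ _⇔ᵇ_ up≡ (<ᵇ-true j<k)))
            (0≤- (A≤0 k<L Jk k≢i (Pos-cong (≗-sym (from-neg k h)) (neg-Neg (inversion-Neg L F j<L Jj j<k (ℕP.<⇒≤ k<L))))))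
    ... | tri> _ _ k<j | inj₁ (up≡ , h) = subst (λ b → 0ℤ ≤ sg b (Aᵢ k)) (sym (cong₂ _⇔ᵇ_ up≡ (<ᵇ-false (ℕP.<⇒≤ k<j))))
            (0≤- (A≤0 k<L Jk k≢i (Pos-cong (u-cong J k (≗-sym h)) (noninversion-Pos L F j<L Jj (ℕP.<⇒≤ k<j)))))
    ... | tri> _ _ k<j | inj₂ (up≡ , h) = subst (λ b → 0ℤ ≤ sg b (Aᵢ k)) (sym (cong₂ _⇔ᵇ_ up≡ (<ᵇ-false (ℕP.<⇒≤ k<j))))
            (0≤A k<L Jk k≢i (Neg-cong (≗-sym (from-neg k h)) (neg-Pos (noninversion-Pos L F j<L Jj (ℕP.<⇒≤ k<j)))))

    -- The sign of the rotated root at i.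
    ε : ℕ → Bool
    ε p = up xor window p

    -- As j lies outside J, its rotated root is positive in every rotation; `ε` collects the signs
    -- by which the root at i differs from it.
    ρ-sign : ∀ {p} → p ℕ.≤ L → Pos (sgV (ε p) (ρ J p i))
    ρ-sign {p} p≤L t = subst (0ℤ ≤_) (sym same) (Cj t)
      where
      Cj : Pos (ρ J p j)
      Cj with p ℕ.≤? j
      ... | yes p≤j = subst (λ b → Pos (sgV (not b) (u J p (r J j)))) (sym (<ᵇ-false p≤j)) (noninversion-Pos L F j<L Jj p≤j)
      ... | no p≰j = subst (λ b → Pos (sgV (not b) (u J p (r J j)))) (sym (<ᵇ-true (ℕP.≰⇒> p≰j))) (neg-Neg (inversion-Neg L F j<L Jj (ℕP.≰⇒> p≰j) p≤L))
      ui : u J p (r J i) t ≡ sg up (u J p (r J j) t)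
      ui with up-dir
      ... | inj₁ (up≡ , h) = trans (u-cong J p h t) (sg-cong (sym up≡) refl)
      ... | inj₂ (up≡ , h) = trans (from-neg p h t) (sg-cong (sym up≡) refl)
      parity : ∀ b y z → (b xor (y xor z) ⇔ᵇ (not y ⇔ᵇ b)) ≡ not z
      parity b y z = ⇔ᵇ-elim (valid 3 (λ b y z → ((b xor (y xor z) ⇔ᵇ (not y ⇔ᵇ b)) ⇔ᵇ not z)) refl b y z)
      same : sg (ε p) (ρ J p i t) ≡ ρ J p j t
      same = trans (cong (λ z → sg (ε p) (sg (not (i ℕ.<ᵇ p)) z)) ui)
        (trans (cong (sg (ε p)) (sg-sg (not (i ℕ.<ᵇ p)) up _)) (trans (sg-sg (ε p) (not (i ℕ.<ᵇ p) ⇔ᵇ up) _)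
          (sg-cong (parity up (i ℕ.<ᵇ p) (j ℕ.<ᵇ p)) refl)))

    -- The entry b_ik of the exchange matrix, in terms of the facet.
    bᵢ : ℕ → ℤ
    bᵢ k = sg (not (i ℕ.<ᵇ k)) (Aᵢ k)

    -- The tropical coefficient: how often the root at i is added to the root at k by the flip, as
    -- seen in rotation p.
    m : ℕ → ℕ → ℤ
    m p k = int [ sg (ε p) (bᵢ k) ]₊

    private
      -- Tells whether the flip reflects the rotated root at k: the prefix before k and the prefix
      -- undone by the rotation contribute at most one reflection each.
      θ : ℕ → ℕ → Bool
      θ p k = window p xor window k

      -- If the root is reflected, the sign used in `m` is that of `A-sign` and the positive part is
      -- the whole pairing; if not, the signs are opposite and the positive part is 0.
      inside : ∀ p k → θ p k ≡ true → (ε p ⇔ᵇ not (i ℕ.<ᵇ k)) ≡ (up ⇔ᵇ (j ℕ.<ᵇ k))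
      inside p k h = ⇔ᵇ-elim (⊃-elim
        (valid 4 (λ e y x₁ x₂ → y xor (x₁ xor x₂) ⊃ ((e xor y) ⇔ᵇ not x₁) ⇔ᵇ (e ⇔ᵇ x₂)) refl up (window p) (i ℕ.<ᵇ k) (j ℕ.<ᵇ k)) h)

      outside : ∀ p k → θ p k ≡ false → (ε p ⇔ᵇ not (i ℕ.<ᵇ k)) ≡ (false ⇔ᵇ (up ⇔ᵇ (j ℕ.<ᵇ k)))
      outside p k h = ⇔ᵇ-elim (⊃-elim
        (valid 4 (λ e y x₁ x₂ → not (y xor (x₁ xor x₂)) ⊃ ((e xor y) ⇔ᵇ not x₁) ⇔ᵇ (false ⇔ᵇ (e ⇔ᵇ x₂))) refl up (window p) (i ℕ.<ᵇ k) (j ℕ.<ᵇ k)) (cong not h))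

      m-value : ∀ {p k} → k ℕ.< L → J k ≡ true → k ≢ i → m p k ≡ (if θ p k then sg (up ⇔ᵇ (j ℕ.<ᵇ k)) (Aᵢ k) else 0ℤ)
      m-value {p} {k} k<L Jk k≢i = trans (cong (λ z → int [ z ]₊) (sg-sg (ε p) (not (i ℕ.<ᵇ k)) (Aᵢ k))) (by (θ p k) refl)
        where
        by : ∀ b → θ p k ≡ b → int [ sg (ε p ⇔ᵇ not (i ℕ.<ᵇ k)) (Aᵢ k) ]₊ ≡ (if b then sg (up ⇔ᵇ (j ℕ.<ᵇ k)) (Aᵢ k) else 0ℤ)
        by true  h = trans (cong (λ b → int [ sg b (Aᵢ k) ]₊) (inside p k h)) ([]₊-pos (A-sign k<L Jk k≢i))
        by false h = trans (cong (λ b → int [ sg b (Aᵢ k) ]₊) (outside p k h))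
          (trans (cong (λ z → int [ z ]₊) (sym (sg-sg false (up ⇔ᵇ (j ℕ.<ᵇ k)) (Aᵢ k)))) ([]₊-neg (A-sign k<L Jk k≢i)))

      -- If k lies between i and j in the rotated order, then i and k are on the same side of j.
      side : ∀ p k → θ p k ≡ true → (k ℕ.<ᵇ p) xor (i ℕ.<ᵇ p) ≡ (up ⇔ᵇ (j ℕ.<ᵇ k))
      -- Transitivity and cotransitivity of the order for the four triples among i, j, k, p are the
      -- premises of a tautology in the six comparisons.
      side p k h = ⇔ᵇ-elim (mp (mp (mp (mp (mp (mp (mp (mp (mp table (<ᵇ-trans i j k)) (<ᵇ-cotrans i j k)) (<ᵇ-trans i k p)) (<ᵇ-cotrans i k p))
          (<ᵇ-trans j k p)) (<ᵇ-cotrans j k p)) (<ᵇ-trans i j p)) (<ᵇ-cotrans i j p)) h)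
        where
        mp : ∀ {b c} → (b ⊃ c) ≡ true → b ≡ true → c ≡ true
        mp = ⊃-elim
        table : _
        table = valid 6 (λ up x₁ x₂ y₁ y₂ z →
            (up ∧ x₂ ⊃ x₁) ⊃ (x₁ ⊃ (up ∨ x₂)) ⊃ (x₁ ∧ z ⊃ y₁) ⊃ (y₁ ⊃ (x₁ ∨ z)) ⊃
            (x₂ ∧ z ⊃ y₂) ⊃ (y₂ ⊃ (x₂ ∨ z)) ⊃ (up ∧ y₂ ⊃ y₁) ⊃ (y₁ ⊃ (up ∨ y₂)) ⊃
            (y₁ xor y₂) xor (x₁ xor x₂) ⊃ (z xor y₁) ⇔ᵇ (up ⇔ᵇ x₂))
          refl up (i ℕ.<ᵇ k) (j ℕ.<ᵇ k) (i ℕ.<ᵇ p) (j ℕ.<ᵇ p) (k ℕ.<ᵇ p)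

      ρ'-raw : ∀ p k → ρ J' p k ≗ sgV (not (k ℕ.<ᵇ p)) (u J p (mirror-if (θ p k) J i (r J k)))
      ρ'-raw p k t = cong (sg (not (k ℕ.<ᵇ p))) (trans (u-flip p (r J' k) t)
        (u-cong J p (λ s → trans (mirror-if-cong (window p) J i (r-flip k) s) (mirror-if-xor (window p) (window k) J i (r J k) s)) t))

    -- The factor is a positive part because a reflection occurs only where the signed pairing is
    -- nonnegative; at p = 0 this is the mutation rule for c-vectors.
    ρ-flip : ∀ {p k} → k ℕ.< L → J k ≡ true → k ≢ i → ρ J' p k ≗ (ρ J p k +⟨ m p k ⟩ ρ J p i)
    ρ-flip {p} {k} k<L Jk k≢i t = trans (ρ'-raw p k t) (trans (by (θ p k) refl) (cong (λ z → ρ J p k t + z * ρ J p i t) (sym (m-value {p} k<L Jk k≢i))))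
      where
      X Y : ℤ
      X = u J p (r J k) t
      Y = u J p (r J i) t
      signs : ∀ z y b → z xor y ≡ b → ∀ x y' α → sg (not z) (x + - α * y') ≡ sg (not z) x + sg b α * sg (not y) y'
      signs true  true  false refl = ring
        where
        ring : ∀ x y α → - (x + - α * y) ≡ - x + - α * - y
        ring = solve-∀
      signs true  false true  refl = ring
        where
        ring : ∀ x y α → - (x + - α * y) ≡ - x + α * y
        ring = solve-∀
      signs false true  true  refl = ring
        where
        ring : ∀ x y α → x + - α * y ≡ x + α * - y
        ring = solve-∀
      signs false false false refl = λ x y α → refl
      by : ∀ b → θ p k ≡ b → sg (not (k ℕ.<ᵇ p)) (u J p (mirror-if b J i (r J k)) t) ≡
        ρ J p k t + (if b then sg (up ⇔ᵇ (j ℕ.<ᵇ k)) (Aᵢ k) else 0ℤ) * ρ J p i t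
      by true  h = trans (cong (sg (not (k ℕ.<ᵇ p))) (trans (u-cong J p (mirror-eq J i (r J k)) t) (lin (u-linear J p t) (r J k) (- Aᵢ k) (r J i))))
        (signs (k ℕ.<ᵇ p) (i ℕ.<ᵇ p) _ (side p k h) X Y (Aᵢ k))
      by false h = sym (trans (cong (ρ J p k t +_) (ℤP.*-zeroˡ (ρ J p i t))) (ℤP.+-identityʳ (ρ J p k t)))

    ρ-flip-new : ∀ p → ρ J' p j ≗ neg (ρ J p i)
    ρ-flip-new p t = trans (cong (sg (not (j ℕ.<ᵇ p))) (trans (u-flip p (r J' j) t) (u-cong J p (mirror-if-cong (window p) J i r-flip-new) t)))
      (by (i ℕ.<ᵇ p) (j ℕ.<ᵇ p))
      where
      Y : ℤ
      Y = u J p (r J i) t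
      reflected : u J p (mirror J i (neg (r J i))) t ≡ Y
      reflected = u-cong J p (λ s → trans (at-neg (mirror-lin s) (r J i)) (trans (cong -_ (mirror-r J i s)) (ℤP.neg-involutive _))) t
        where
        mirror-lin : LinearMap (mirror J i)
        mirror-lin s = (w-linear J i s ∘L reflect-linear (q i)) ∘L u-linear J i
      by : ∀ y z → sg (not z) (u J p (mirror-if (y xor z) J i (neg (r J i))) t) ≡ - sg (not y) Y
      by true  true  = cong -_ (u-neg J p (r J i) t)
      by true  false = trans reflected (sym (ℤP.neg-involutive Y))
      by false true  = cong -_ reflected
      by false false = u-neg J p (r J i) t

    -- The Hurwitz move on the exceptional sequence given by J.

    private
      d : ℤ
      d = dZ (q i)

      only : Bool → ℤ → ℤ
      only true  x = x
      only false x = 0ℤ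

      Erᵢrᵢ : E κ₀ (r J i) (r J i) ≡ d
      Erᵢrᵢ = cancel-pos {int 2} (+<+ (ℕ.s≤s ℕ.z≤n)) (trans (double (E κ₀ (r J i) (r J i))) (trans (E-sym sep (r J i) (r J i)) (r-norm J i)))
        where
        double : ∀ x → int 2 * x ≡ x + x
        double = solve-∀

      E-both : ∀ k → E κ₀ (r J i) (r J k) + E κ₀ (r J k) (r J i) ≡ d * Aᵢ k
      E-both k = trans (E-sym sep (r J i) (r J k)) (sym (pair-form J i (r J k)))

      -- Triangularity makes one of the two values of E zero, so the other is the whole symmetric
      -- pairing.
      E-left : ∀ {k} → k ℕ.< L → J k ≡ true → k ≢ i → E κ₀ (r J k) (r J i) ≡ only (i ℕ.<ᵇ k) (d * Aᵢ k)
      E-left {k} k<L Jk k≢i with i ℕ.<ᵇ k | ℕP.<ᵇ-reflects-< i k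
      ... | true | ofʸ l = trans (sym (ℤP.+-identityˡ _)) (trans (cong (_+ E κ₀ (r J k) (r J i)) (sym (T l k<L Ji Jk))) (E-both k))
      ... | false | ofⁿ nl = T (ℕP.≤∧≢⇒< (ℕP.≮⇒≥ nl) k≢i) i<L Jk Ji

      E-right : ∀ {k} → k ℕ.< L → J k ≡ true → k ≢ i → E κ₀ (r J i) (r J k) ≡ only (not (i ℕ.<ᵇ k)) (d * Aᵢ k)
      E-right {k} k<L Jk k≢i with i ℕ.<ᵇ k | ℕP.<ᵇ-reflects-< i k
      ... | true | ofʸ l = T l k<L Ji Jk
      ... | false | ofⁿ nl = trans (sym (ℤP.+-identityʳ _)) (trans (cong (E κ₀ (r J i) (r J k) +_) (sym (T (ℕP.≤∧≢⇒< (ℕP.≮⇒≥ nl) k≢i) i<L Jk Ji))) (E-both k))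

      c : ℕ → ℤ
      c k = only (window k) (Aᵢ k)

      r'≗ : ∀ k → r J' k ≗ (r J k +⟨ - c k ⟩ r J i)
      r'≗ k t = trans (r-flip k t) (by (window k))
        where
        by : ∀ b → mirror-if b J i (r J k) t ≡ r J k t + - only b (Aᵢ k) * r J i t
        by true = mirror-eq J i (r J k) t
        by false = sym (trans (cong (r J k t +_) (ℤP.*-zeroˡ (r J i t))) (ℤP.+-identityʳ (r J k t)))

      E-r'ˡ : ∀ k y → E κ₀ (r J' k) y ≡ E κ₀ (r J k) y + - c k * E κ₀ (r J i) y
      E-r'ˡ k y = trans (E-cong κ₀ (r'≗ k) (λ _ → refl)) (lin (E-linˡ κ₀ y) (r J k) (- c k) (r J i))

      E-r'ʳ : ∀ y k → E κ₀ y (r J' k) ≡ E κ₀ y (r J k) + - c k * E κ₀ y (r J i)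
      E-r'ʳ y k = trans (E-cong κ₀ (λ _ → refl) (r'≗ k)) (lin (E-linʳ κ₀ y) (r J k) (- c k) (r J i))

      -- Whatever lies before k lies before l, which leaves nine arrangements of i and j relative to
      -- k and l, each a ring identity.
      old-old : ∀ {k l} → k ℕ.< l → k ℕ.< L → l ℕ.< L → J k ≡ true → J l ≡ true → k ≢ i → l ≢ i → E κ₀ (r J' k) (r J' l) ≡ 0ℤ
      old-old {k} {l} k<l k<L l<L Jk Jl k≢i l≢i = trans (E-r'ˡ k (r J' l)) (trans (cong₂ (λ s t → s + - c k * t) (E-r'ʳ (r J k) l) (E-r'ʳ (r J i) l))
        (trans (cong₂ (λ s t → s + - c k * t) (cong₂ (λ s t → s + - c l * t) (T k<l l<L Jk Jl) (E-left k<L Jk k≢i))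
                                              (cong₂ (λ s t → s + - c l * t) (E-right l<L Jl l≢i) Erᵢrᵢ))
          (table (i ℕ.<ᵇ k) (i ℕ.<ᵇ l) (j ℕ.<ᵇ k) (j ℕ.<ᵇ l) (mono i) (mono j) (Aᵢ k) (Aᵢ l) d)))
        where
        mono : ∀ x → ((x ℕ.<ᵇ k) ⊃ (x ℕ.<ᵇ l)) ≡ true
        mono x with x ℕ.<ᵇ k | ℕP.<ᵇ-reflects-< x k
        ... | false | _ = refl
        ... | true | ofʸ lt = <ᵇ-true (ℕP.<-trans lt k<l)
        table : ∀ x₁ y₁ x₂ y₂ → (x₁ ⊃ y₁) ≡ true → (x₂ ⊃ y₂) ≡ true → ∀ s t d →
          0ℤ + - only (y₁ xor y₂) t * only x₁ (d * s) + - only (x₁ xor x₂) s * (only (not y₁) (d * t) + - only (y₁ xor y₂) t * d) ≡ 0ℤ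
        table true  true  true  true  _ _ = ring
          where
          ring : ∀ s t d → 0ℤ + - 0ℤ * (d * s) + - 0ℤ * (0ℤ + - 0ℤ * d) ≡ 0ℤ
          ring = solve-∀
        table true  true  false true  _ _ = ring
          where
          ring : ∀ s t d → 0ℤ + - 0ℤ * (d * s) + - s * (0ℤ + - 0ℤ * d) ≡ 0ℤ
          ring = solve-∀
        table true  true  false false _ _ = ring
          where
          ring : ∀ s t d → 0ℤ + - t * (d * s) + - s * (0ℤ + - t * d) ≡ 0ℤ
          ring = solve-∀
        table false true  true  true  _ _ = ring
          where
          ring : ∀ s t d → 0ℤ + - 0ℤ * 0ℤ + - s * (0ℤ + - 0ℤ * d) ≡ 0ℤ
          ring = solve-∀
        table false true  false true  _ _ = ring
          where
          ring : ∀ s t d → 0ℤ + - 0ℤ * 0ℤ + - 0ℤ * (0ℤ + - 0ℤ * d) ≡ 0ℤ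
          ring = solve-∀
        table false true  false false _ _ = ring
          where
          ring : ∀ s t d → 0ℤ + - t * 0ℤ + - 0ℤ * (0ℤ + - t * d) ≡ 0ℤ
          ring = solve-∀
        table false false true  true  _ _ = ring
          where
          ring : ∀ s t d → 0ℤ + - t * 0ℤ + - s * (d * t + - t * d) ≡ 0ℤ
          ring = solve-∀
        table false false false true  _ _ = ring
          where
          ring : ∀ s t d → 0ℤ + - t * 0ℤ + - 0ℤ * (d * t + - t * d) ≡ 0ℤ
          ring = solve-∀
        table false false false false _ _ = ring
          where
          ring : ∀ s t d → 0ℤ + - 0ℤ * 0ℤ + - 0ℤ * (d * t + - 0ℤ * d) ≡ 0ℤ
          ring = solve-∀

      E-newʳ : ∀ y → E κ₀ y (r J' j) ≡ - E κ₀ y (r J i)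
      E-newʳ y = trans (E-cong κ₀ (λ _ → refl) r-flip-new) (at-neg (E-linʳ κ₀ y) (r J i))

      E-newˡ : ∀ y → E κ₀ (r J' j) y ≡ - E κ₀ (r J i) y
      E-newˡ y = trans (E-cong κ₀ r-flip-new (λ _ → refl)) (at-neg (E-linˡ κ₀ y) (r J i))

      ring₁ : ∀ s d → d * s + - s * d ≡ 0ℤ
      ring₁ = solve-∀

      ring₀ : ∀ d → 0ℤ + - 0ℤ * d ≡ 0ℤ
      ring₀ = solve-∀

      old-new : ∀ {k} → k ℕ.< j → k ℕ.< L → J k ≡ true → k ≢ i → E κ₀ (r J' k) (r J' j) ≡ 0ℤ
      old-new {k} k<j k<L Jk k≢i = trans (E-newʳ (r J' k)) (cong -_ (trans (E-r'ˡ k (r J i))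
        (trans (cong₂ (λ s t → s + - c k * t) (E-left k<L Jk k≢i) Erᵢrᵢ) (by (i ℕ.<ᵇ k) (j ℕ.<ᵇ k) (<ᵇ-false (ℕP.<⇒≤ k<j))))))
        where
        by : ∀ x y → y ≡ false → only x (d * Aᵢ k) + - only (x xor y) (Aᵢ k) * d ≡ 0ℤ
        by true  false refl = ring₁ (Aᵢ k) d
        by false false refl = ring₀ d

      new-old : ∀ {k} → j ℕ.< k → k ℕ.< L → J k ≡ true → k ≢ i → E κ₀ (r J' j) (r J' k) ≡ 0ℤ
      new-old {k} j<k k<L Jk k≢i = trans (E-newˡ (r J' k)) (cong -_ (trans (E-r'ʳ (r J i) k)
        (trans (cong₂ (λ s t → s + - c k * t) (E-right k<L Jk k≢i) Erᵢrᵢ) (by (i ℕ.<ᵇ k) (j ℕ.<ᵇ k) (<ᵇ-true j<k)))))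
        where
        by : ∀ x y → y ≡ true → only (not x) (d * Aᵢ k) + - only (x xor y) (Aᵢ k) * d ≡ 0ℤ
        by true  true refl = ring₀ d
        by false true refl = ring₁ (Aᵢ k) d

    skew-b : ∀ {k} → k ℕ.< L → J k ≡ true → k ≢ i → E κ₀ (r J i) (r J k) - E κ₀ (r J k) (r J i) ≡ d * bᵢ k
    skew-b {k} k<L Jk k≢i = trans (cong₂ _-_ (E-right k<L Jk k≢i) (E-left k<L Jk k≢i)) (by (i ℕ.<ᵇ k))
      where
      by : ∀ x → only (not x) (d * Aᵢ k) - only x (d * Aᵢ k) ≡ d * sg (not x) (Aᵢ k)
      by true  = arith d (Aᵢ k)
        where
        arith : ∀ d α → 0ℤ - d * α ≡ d * - α
        arith = solve-∀
      by false = ℤP.+-identityʳ (d * Aᵢ k)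

    J'-≢i : ∀ {k} → J' k ≡ true → k ≢ i
    J'-≢i h refl = case trans (sym h) J'i of λ ()

    J'-old : ∀ {k} → J' k ≡ true → k ≢ j → J k ≡ true
    J'-old h k≢j = trans (sym (J'k (J'-≢i h) k≢j)) h

    triangular-flip : Triangular J'
    triangular-flip {x} {y} x<y y<L J'x J'y = go (x ℕ.≟ j) (y ℕ.≟ j)
      where
      go : Dec (x ≡ j) → Dec (y ≡ j) → E κ₀ (r J' x) (r J' y) ≡ 0ℤ
      go (yes refl) (yes refl) = ⊥-elim (ℕP.<-irrefl refl x<y)
      go (yes refl) (no y≢j) = new-old x<y y<L (J'-old J'y y≢j) (J'-≢i J'y)
      go (no x≢j) (yes refl) = old-new x<y (ℕP.<-trans x<y y<L) (J'-old J'x x≢j) (J'-≢i J'x)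
      go (no x≢j) (no y≢j) = old-old x<y (ℕP.<-trans x<y y<L) y<L (J'-old J'x x≢j) (J'-old J'y y≢j) (J'-≢i J'x) (J'-≢i J'y)

-- Rotations

sg-0 : ∀ b → sg b 0ℤ ≡ 0ℤ
sg-0 true = refl
sg-0 false = refl

sg-linear : ∀ b x m y → sg b (x + m * y) ≡ sg b x + m * sg b y
sg-linear true  x m y = refl
sg-linear false x m y = arith x m y
  where
  arith : ∀ x m y → - (x + m * y) ≡ - x + m * - y
  arith = solve-∀

sg-square : ∀ b x → sg b (sg b x) ≡ x
sg-square true  x = refl
sg-square false x = ℤP.neg-involutive x

sg-* : ∀ b x y → sg b x * sg b y ≡ x * y
sg-* true  x y = refl
sg-* false x y = arith x y
  where
  arith : ∀ x y → - x * - y ≡ x * y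
  arith = solve-∀

Linear-sg : ∀ {n} b {φ : Vect n → ℤ} → Linear φ → Linear (λ v → sg b (φ v))
Linear-sg b l .resp h = cong (sg b) (resp l h)
Linear-sg b {φ} l .lin x m y = trans (cong (sg b) (lin l x m y)) (sg-linear b (φ x) m (φ y))

at-sgV : ∀ {n} {φ : Vect n → ℤ} → Linear φ → ∀ b v → φ (sgV b v) ≡ sg b (φ v)
at-sgV l true  v = refl
at-sgV l false v = at-neg l v

-- The skew form, dual functionals and the values of ψ

module Clusters {n : ℕ} (a : CartanMatrix n) (fin : IsFiniteCartan a) (q : ℕ → Fin n) (κ₀ : Fin n → ℕ) (L : ℕ)
  (steps : ∀ p → p ℕ.< L → Euler.Step a fin (orient a q κ₀ p) (q p)) (sep : Euler.Separating a fin κ₀)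
  (n≤L : n ℕ.≤ L) (q-initial : ∀ k → k ℕ.< n → toℕ (q k) ≡ k) where

  open Roots a fin
  open ReducedWords a fin
  open Euler a fin
  open Sorting a fin using (A-≤0)
  open Facets a fin q
  open Frames a fin q κ₀ L steps sep

  q-letter : ∀ i → q (toℕ i) ≡ i
  q-letter i = FinP.toℕ-injective (q-initial (toℕ i) (FinP.toℕ<n i))

  -- The skew form of the exchange matrix, in every rotation

  ω : ℕ → Vect n → Vect n → ℤ
  ω p x y = E (κ p) x y - E (κ p) y x

  ω-anti : ∀ p x y → ω p x y ≡ - ω p y x
  ω-anti p x y = arith (E (κ p) x y) (E (κ p) y x)
    where
    arith : ∀ s t → s - t ≡ - (t - s)
    arith = solve-∀

  ω-linʳ : ∀ p x → Linear (ω p x)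
  ω-linʳ p x .resp h = cong₂ _-_ (resp (E-linʳ (κ p) x) h) (resp (E-linˡ (κ p) x) h)
  ω-linʳ p x .lin y m z = trans (cong₂ _-_ (lin (E-linʳ (κ p) x) y m z) (lin (E-linˡ (κ p) x) y m z))
    (arith (E (κ p) x y) m (E (κ p) x z) (E (κ p) y x) (E (κ p) z x))
    where
    arith : ∀ s m t s' t' → s + m * t - (s' + m * t') ≡ s - s' + m * (t - t')
    arith = solve-∀

  ω-linˡ : ∀ p y → Linear (λ x → ω p x y)
  ω-linˡ p y .resp {x} {x'} h = trans (ω-anti p x y) (trans (cong -_ (resp (ω-linʳ p y) h)) (sym (ω-anti p x' y)))
  ω-linˡ p y .lin x m z = trans (ω-anti p _ y) (trans (cong -_ (lin (ω-linʳ p y) x m z)) (trans (arith (ω p y x) m (ω p y z))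
      (sym (cong₂ (λ s t → s + m * t) (ω-anti p x y) (ω-anti p z y)))))
    where
    arith : ∀ s m t → - (s + m * t) ≡ - s + m * - t
    arith = solve-∀

  ω-cong : ∀ p {x x' y y'} → x ≗ x' → y ≗ y' → ω p x y ≡ ω p x' y'
  ω-cong p {x} {x'} {y} {y'} h k = trans (resp (ω-linˡ p y) h) (resp (ω-linʳ p x') k)

  ω-self : ∀ p x → ω p x x ≡ 0ℤ
  ω-self p x = ℤP.+-inverseʳ (E (κ p) x x)

  module Facet-data {J : ℕ → Bool} (T : Triangular J) where
    open Rotations T

    private
      ω-bump : ∀ {p} → p ℕ.< L → ∀ x y → ω (suc p) x y ≡ ω p x y + int 2 * (dZ (q p) * (x (q p) * A (q p) y - y (q p) * A (q p) x))
      ω-bump {p} p<L x y = trans (cong₂ _-_ (E-bump (steps p p<L) x y) (E-bump (steps p p<L) y x))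
        (arith (E (κ p) x y) (E (κ p) y x) (dZ (q p)) (x (q p) * A (q p) y) (y (q p) * A (q p) x))
        where
        arith : ∀ s t d f g → s + d * (f - g) - (t + d * (g - f)) ≡ s - t + int 2 * (d * (f - g))
        arith = solve-∀

      ρ-stay : ∀ {p x} → x ≢ p → (x ℕ.<ᵇ suc p) ≡ (x ℕ.<ᵇ p)
      ρ-stay {p} {x} x≢p with ℕP.<-cmp x p
      ... | tri< l _ _ = trans (<ᵇ-true (ℕP.m≤n⇒m≤1+n l)) (sym (<ᵇ-true l))
      ... | tri≈ _ z _ = ⊥-elim (x≢p z)
      ... | tri> _ _ l = trans (<ᵇ-false l) (sym (<ᵇ-false (ℕP.<⇒≤ l)))

      ρ-step : ∀ {p} x → x ≢ p → ρ J (suc p) x ≗ move (J p) (q p) (ρ J p x)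
      ρ-step {p} x x≢p t = trans (cong (λ b → sg (not b) (move (J p) (q p) (u J p (r J x)) t)) (ρ-stay x≢p))
        (sym (at-sgV (move-linear (J p) (q p) t) (not (x ℕ.<ᵇ p)) (u J p (r J x))))

      ρ-coef : ∀ {p} → p ℕ.< L → J p ≡ true → ∀ {x} → x ℕ.< L → J x ≡ true → x ≢ p → ρ J p x (q p) ≡ 0ℤ
      ρ-coef {p} p<L Jp {x} x<L Jx x≢p = trans (cong (sg (not (x ℕ.<ᵇ p))) (coef p<L Jp x<L Jx x≢p)) (sg-0 (not (x ℕ.<ᵇ p)))

      ρ-here : ∀ p → ρ J p p ≗ δ (q p)
      ρ-here p t = trans (cong (λ b → sg (not b) (u J p (r J p) t)) (<ᵇ-false (ℕP.≤-refl {p}))) (u-r J p t)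

      ρ-gone : ∀ {p} → J p ≡ true → ρ J (suc p) p ≗ neg (δ (q p))
      ρ-gone {p} Jp t = trans (cong (λ b → sg (not b) (move (J p) (q p) (u J p (r J p)) t)) (<ᵇ-true (ℕP.≤-refl {suc p})))
        (cong -_ (trans (cong (λ b → move b (q p) (u J p (r J p)) t) Jp) (u-r J p t)))

    -- The correction at a position of J vanishes on the roots without coefficient at its letter.
    -- For the root at that position itself, the passage from source to sink changes the sign of the
    -- form and `ρ` changes the sign of the root.
    ω-invariant : ∀ p → p ℕ.≤ L → ∀ {x y} → x ℕ.< L → y ℕ.< L → J x ≡ true → J y ≡ true →
      ω p (ρ J p x) (ρ J p y) ≡ ω 0 (r J x) (r J y)
    ω-invariant zero _ _ _ _ _ = refl
    ω-invariant (suc p) p<L {x} {y} x<L y<L Jx Jy = trans (step (x ℕ.≟ p) (y ℕ.≟ p)) (ω-invariant p (ℕP.<⇒≤ p<L) x<L y<L Jx Jy)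
      where
      s : Fin n
      s = q p
      pass : ∀ {y} → J p ≡ true → y ℕ.< L → J y ≡ true → y ≢ p → ω (suc p) (ρ J (suc p) p) (ρ J (suc p) y) ≡ ω p (ρ J p p) (ρ J p y)
      pass {y} Jp y<L Jy y≢p = begin
        ω (suc p) (ρ J (suc p) p) (ρ J (suc p) y)
          ≡⟨ ω-cong (suc p) (ρ-gone Jp) (λ t → trans (ρ-step y y≢p t) (cong (λ b → move b s Y t) Jp)) ⟩
        ω (suc p) (neg (δ s)) Y ≡⟨ at-neg (ω-linˡ (suc p) Y) (δ s) ⟩
        - ω (suc p) (δ s) Y ≡⟨ cong -_ (ω-bump p<L (δ s) Y) ⟩
        - (ω p (δ s) Y + int 2 * (dZ s * (δ s s * A s Y - Y s * A s (δ s))))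
          ≡⟨ cong₂ (λ o f → - (o + int 2 * (dZ s * f))) ω-value (cong₂ (λ o z → o * A s Y - z * A s (δ s)) (δ-same s) Ys≡0) ⟩
        - (- (dZ s * A s Y) + int 2 * (dZ s * (1ℤ * A s Y - 0ℤ * A s (δ s)))) ≡⟨ arith (dZ s) (A s Y) (A s (δ s)) ⟩
        - (dZ s * A s Y) ≡⟨ sym ω-value ⟩
        ω p (δ s) Y ≡⟨ sym (ω-cong p (ρ-here p) (λ _ → refl)) ⟩
        ω p (ρ J p p) Y ∎
        where
        open ≡-Reasoning
        Y : Vect n
        Y = ρ J p y
        Ys≡0 : Y s ≡ 0ℤ
        Ys≡0 = ρ-coef p<L Jp y<L Jy y≢p
        arith : ∀ d o z → - (- (d * o) + int 2 * (d * (1ℤ * o - 0ℤ * z))) ≡ - (d * o)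
        arith = solve-∀
        arith' : ∀ d o → d * 0ℤ - d * (o - 0ℤ) ≡ - (d * o)
        arith' = solve-∀
        ω-value : ω p (δ s) Y ≡ - (dZ s * A s Y)
        ω-value = trans (cong₂ _-_ (E-source (source (steps p p<L)) Y) (E-sourceʳ (source (steps p p<L)) Y))
          (trans (cong (λ z → dZ s * z - dZ s * (A s Y - z)) Ys≡0) (arith' (dZ s) (A s Y)))
      stay : ∀ b → J p ≡ b → x ≢ p → y ≢ p → ω (suc p) (move b s (ρ J p x)) (move b s (ρ J p y)) ≡ ω p (ρ J p x) (ρ J p y)
      stay false _ _ _ = cong₂ _-_ (E-reflect (steps p p<L) _ _) (E-reflect (steps p p<L) _ _)
      stay true Jp x≢p y≢p = trans (ω-bump p<L (ρ J p x) (ρ J p y))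
        (trans (cong₂ (λ o z → ω p (ρ J p x) (ρ J p y) + int 2 * (dZ s * (o * A s (ρ J p y) - z * A s (ρ J p x))))
                      (ρ-coef p<L Jp x<L Jx x≢p) (ρ-coef p<L Jp y<L Jy y≢p))
               (arith (ω p (ρ J p x) (ρ J p y)) (dZ s) (A s (ρ J p y)) (A s (ρ J p x))))
        where
        arith : ∀ o d f g → o + int 2 * (d * (0ℤ * f - 0ℤ * g)) ≡ o
        arith = solve-∀
      step : Dec (x ≡ p) → Dec (y ≡ p) → ω (suc p) (ρ J (suc p) x) (ρ J (suc p) y) ≡ ω p (ρ J p x) (ρ J p y)
      step (yes refl) (yes refl) = trans (ω-self (suc p) _) (sym (ω-self p _))
      step (yes refl) (no y≢p) = pass Jx y<L Jy y≢p
      step (no x≢p) (yes refl) = trans (ω-anti (suc p) _ _) (trans (cong -_ (pass Jy x<L Jx x≢p)) (sym (ω-anti p _ _)))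
      step (no x≢p) (no y≢p) = trans (ω-cong (suc p) (ρ-step x x≢p) (ρ-step y y≢p)) (stay (J p) refl x≢p y≢p)

    -- The functional dual to the rotated root at k.
    G : ℕ → ℕ → Vect n → ℤ
    G p k v = sg (not (k ℕ.<ᵇ p)) (u J k (w J p v) (q k))

    G-linear : ∀ p k → Linear (G p k)
    G-linear p k = Linear-sg (not (k ℕ.<ᵇ p)) (u-linear J k (q k) ∘L w-linear J p)

    private
      G-ρ : ∀ p k x → G p k (ρ J p x) ≡ sg (not (k ℕ.<ᵇ p)) (sg (not (x ℕ.<ᵇ p)) (u J k (r J x) (q k)))
      G-ρ p k x = cong (sg (not (k ℕ.<ᵇ p))) (trans (at-sgV (u-linear J k (q k) ∘L w-linear J p) (not (x ℕ.<ᵇ p)) (u J p (r J x)))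
        (cong (sg (not (x ℕ.<ᵇ p))) (u-cong J k (w-u J p (r J x)) (q k))))

    G-same : ∀ p k → G p k (ρ J p k) ≡ 1ℤ
    G-same p k = trans (G-ρ p k k) (trans (sg-square (not (k ℕ.<ᵇ p)) _) (trans (u-r J k (q k)) (δ-same (q k))))

    G-diff : ∀ p {k x} → k ℕ.< L → x ℕ.< L → J k ≡ true → J x ≡ true → x ≢ k → G p k (ρ J p x) ≡ 0ℤ
    G-diff p {k} {x} k<L x<L Jk Jx x≢k = trans (G-ρ p k x) (trans (cong (λ z → sg (not (k ℕ.<ᵇ p)) (sg (not (x ℕ.<ᵇ p)) z)) (coef k<L Jk x<L Jx x≢k))
      (trans (cong (sg (not (k ℕ.<ᵇ p))) (sg-0 (not (x ℕ.<ᵇ p)))) (sg-0 (not (k ℕ.<ᵇ p)))))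

  J₀ : ℕ → Bool
  J₀ k = k ℕ.<ᵇ n

  -- The positive roots in the image of ψ are values of the root function of the initial facet.
  ψℕ : ℕ → Vect n
  ψℕ k = if k ℕ.<ᵇ n then neg (δ (q k)) else r J₀ k

  all : ℕ → Bool
  all _ = false

  E-all : ∀ {p} m → m ℕ.+ p ℕ.≤ L → ∀ x y → E (κ (m ℕ.+ p)) (u all (m ℕ.+ p) x) (u all (m ℕ.+ p) y) ≡ E (κ p) (u all p x) (u all p y)
  E-all zero _ x y = refl
  E-all {p} (suc m) l x y = trans (E-reflect (steps (m ℕ.+ p) l) _ _) (E-all m (ℕP.<⇒≤ l) x y)

  E-all-≤ : ∀ {p k} → p ℕ.≤ k → k ℕ.≤ L → ∀ x y → E (κ k) (u all k x) (u all k y) ≡ E (κ p) (u all p x) (u all p y)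
  E-all-≤ {p} {k} p≤k k≤L x y = subst (λ z → E (κ z) (u all z x) (u all z y) ≡ E (κ p) (u all p x) (u all p y)) (ℕP.m∸n+n≡m p≤k)
    (E-all (k ℕ.∸ p) (subst (ℕ._≤ L) (sym (ℕP.m∸n+n≡m p≤k)) k≤L) x y)

  w-J₀-initial : ∀ p → p ℕ.≤ n → ∀ v → w J₀ p v ≗ v
  w-J₀-initial zero _ v t = refl
  w-J₀-initial (suc p) p<n v t rewrite <ᵇ-true p<n = w-J₀-initial p (ℕP.<⇒≤ p<n) v t

  w-J₀ : ∀ m v → w J₀ (m ℕ.+ n) v ≗ u all n (w all (m ℕ.+ n) v)
  w-J₀ zero v t = trans (w-J₀-initial n ℕP.≤-refl v t) (sym (u-w all n v t))
  w-J₀ (suc m) v t rewrite <ᵇ-false (ℕP.m≤n+m n m) = w-J₀ m (reflect (q (m ℕ.+ n)) v) t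

  move-off : ∀ b {s c} v → c ≢ s → move b s v c ≡ v c
  move-off true  v _ = refl
  move-off false v c≢s = reflect-off v c≢s

  q-distinct : ∀ {k l} → k ℕ.< n → l ℕ.< n → k ≢ l → q k ≢ q l
  q-distinct {k} {l} k<n l<n k≢l h = k≢l (trans (sym (q-initial k k<n)) (trans (cong toℕ h) (q-initial l l<n)))

  -- Each letter occurs once in the first copy of c, so other letters there leave the coordinate at
  -- `q k` alone.
  untouched-u : ∀ J {k} → k ℕ.< n → ∀ m p → (∀ l → p ℕ.≤ l → l ℕ.< m ℕ.+ p → l ≢ k) → m ℕ.+ p ℕ.≤ n → ∀ v →
    u J (m ℕ.+ p) v (q k) ≡ u J p v (q k)
  untouched-u J k<n zero p _ _ v = refl
  untouched-u J k<n (suc m) p avoid l v = trans (move-off (J (m ℕ.+ p)) _ (q-distinct k<n l λ z → avoid (m ℕ.+ p) (ℕP.m≤n+m p m) ℕP.≤-refl (sym z)))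
    (untouched-u J k<n m p (λ l l₁ l₂ → avoid l l₁ (ℕP.m≤n⇒m≤1+n l₂)) (ℕP.<⇒≤ l) v)

  untouched-w : ∀ J {k} → k ℕ.< n → J k ≡ true → ∀ m → m ℕ.+ suc k ℕ.≤ n → ∀ v → u J k (w J (m ℕ.+ suc k) v) (q k) ≡ v (q k)
  untouched-w J {k} k<n Jk zero _ v = trans (cong (λ b → u J k (w J k (move b (q k) v)) (q k)) Jk) (u-w J k v (q k))
  untouched-w J {k} k<n Jk (suc m) l v = trans (untouched-w J k<n Jk m (ℕP.<⇒≤ l) _) (move-off (J (m ℕ.+ suc k)) v
    (q-distinct k<n l (ℕP.<⇒≢ (ℕP.≤-trans (ℕP.m≤n+m (suc k) m) ℕP.≤-refl))))

  module ψ-values {J : ℕ → Bool} (T : Triangular J) where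
    open Rotations T
    open Facet-data T

    -- The value of the dual functional on the first simple root of a rotation depends only on the position.
    ψ-G : ∀ (b : Fin n) {k} → k ℕ.< L → J k ≡ true → dZ (q k) * G (toℕ b) k (δ b) ≡ - (dZ b * ψℕ k b)
    ψ-G b {k} k<L Jk with k ℕ.<? n
    ... | yes k<n = trans (cong (dZ (q k) *_) value) (trans (minus (q k) b) (cong (λ z → - (dZ b * (if z then neg (δ (q k)) else r J₀ k) b)) (sym (<ᵇ-true k<n))))
      where
      p : ℕ
      p = toℕ b
      p<n : p ℕ.< n
      p<n = FinP.toℕ<n b
      minus : ∀ s b → dZ s * δ b s ≡ - (dZ b * - δ s b)
      minus s b with s ≟ b | b ≟ s
      ... | yes refl | yes _ = arith (dZ s)
        where
        arith : ∀ d → d * 1ℤ ≡ - (d * - 1ℤ)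
        arith = solve-∀
      ... | yes z | no nz = ⊥-elim (nz (sym z))
      ... | no nz | yes z = ⊥-elim (nz (sym z))
      ... | no _ | no _ = trans (ℤP.*-zeroʳ (dZ s)) (sym (cong -_ (ℤP.*-zeroʳ (dZ b))))
      other : k ≢ p → δ b (q k) ≡ 0ℤ
      other k≢p = δ-diff λ z → q-distinct k<n p<n k≢p (trans z (sym (q-letter b)))
      value : G p k (δ b) ≡ δ b (q k)
      value with ℕP.<-cmp k p
      ... | tri< k<p _ _ = trans (cong (sg (not (k ℕ.<ᵇ p))) (trans (subst (λ z → u J k (w J z (δ b)) (q k) ≡ δ b (q k)) (ℕP.m∸n+n≡m k<p)
              (untouched-w J k<n Jk (p ℕ.∸ suc k) (subst (ℕ._≤ n) (sym (ℕP.m∸n+n≡m k<p)) (ℕP.<⇒≤ p<n)) (δ b))) (other (ℕP.<⇒≢ k<p))))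
              (trans (sg-0 (not (k ℕ.<ᵇ p))) (sym (other (ℕP.<⇒≢ k<p))))
      ... | tri≈ _ refl _ = trans (cong (λ z → sg (not z) (u J k (w J k (δ b)) (q k))) (<ᵇ-false (ℕP.≤-refl {k}))) (u-w J k (δ b) (q k))
      ... | tri> _ _ p<k = trans (cong (λ z → sg (not z) (u J k (w J p (δ b)) (q k))) (<ᵇ-false (ℕP.<⇒≤ p<k)))
              (trans (subst (λ z → u J z (w J p (δ b)) (q k) ≡ u J p (w J p (δ b)) (q k)) (ℕP.m∸n+n≡m (ℕP.<⇒≤ p<k))
                (untouched-u J k<n (k ℕ.∸ p) p (λ l _ l<k z → ℕP.<-irrefl z (subst (l ℕ.<_) (ℕP.m∸n+n≡m (ℕP.<⇒≤ p<k)) l<k))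
                  (subst (ℕ._≤ n) (sym (ℕP.m∸n+n≡m (ℕP.<⇒≤ p<k))) (ℕP.<⇒≤ k<n)) (w J p (δ b))))
                (u-w J p (δ b) (q k)))
    -- With all letters applied, E is invariant. The value is carried from k, where `q k` is a
    -- source, back to just after the letter b, where b is a sink and E reads off a coordinate of
    -- `r J₀ k`.
    ... | no k≮n = begin
        dZ (q k) * sg (not (k ℕ.<ᵇ p)) (u J k (w J p (δ b)) (q k))
          ≡⟨ cong (λ z → dZ (q k) * sg (not z) (u J k (w J p (δ b)) (q k))) (<ᵇ-false p≤k) ⟩
        dZ (q k) * u J k (w J p (δ b)) (q k) ≡⟨ cong (dZ (q k) *_) (sym (all-letters k<L Jk p≤k (δ b))) ⟩
        dZ (q k) * u all k z (q k) ≡⟨ sym (E-source (source (steps k k<L)) (u all k z)) ⟩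
        E (κ k) (δ (q k)) (u all k z) ≡⟨ sym (E-cong (κ k) (u-w all k (δ (q k))) (λ _ → refl)) ⟩
        E (κ k) (u all k x₀) (u all k z) ≡⟨ E-all-≤ p<k (ℕP.<⇒≤ k<L) x₀ z ⟩
        E (κ (suc p)) y (reflect (q p) (u all p z)) ≡⟨ E-cong (κ (suc p)) (λ _ → refl) z-reflected ⟩
        E (κ (suc p)) y (neg (δ (q p))) ≡⟨ at-neg (E-linʳ (κ (suc p)) y) (δ (q p)) ⟩
        - E (κ (suc p)) y (δ (q p)) ≡⟨ cong -_ (E-sink (sink (steps p (ℕP.<-≤-trans p<n n≤L))) y) ⟩
        - (dZ (q p) * y (q p)) ≡⟨ cong (λ s → - (dZ s * y s)) (q-letter b) ⟩
        - (dZ b * y b) ≡⟨ cong (λ o → - (dZ b * o)) coordinate ⟩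
        - (dZ b * r J₀ k b) ≡⟨ cong (λ z → - (dZ b * (if z then neg (δ (q k)) else r J₀ k) b)) (sym (<ᵇ-false n≤k)) ⟩
        - (dZ b * ψℕ k b) ∎
      where
      open ≡-Reasoning
      p : ℕ
      p = toℕ b
      p<n : p ℕ.< n
      p<n = FinP.toℕ<n b
      n≤k : n ℕ.≤ k
      n≤k = ℕP.≮⇒≥ k≮n
      p<k : p ℕ.< k
      p<k = ℕP.<-≤-trans p<n n≤k
      p≤k : p ℕ.≤ k
      p≤k = ℕP.<⇒≤ p<k
      z x₀ y : Vect n
      z = w all p (δ b)
      x₀ = w all k (δ (q k))
      y = u all (suc p) x₀
      z-reflected : reflect (q p) (u all p z) ≗ neg (δ (q p))
      z-reflected t = trans (reflect-cong (q p) (λ s → trans (u-w all p (δ b) s) (cong (λ c → δ c s) (sym (q-letter b)))) t) (reflect-δ (q p) t)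
      coordinate : y b ≡ r J₀ k b
      coordinate = begin
        y b ≡⟨ cong y (sym (q-letter b)) ⟩
        y (q p) ≡⟨ sym (untouched-u all p<n (n ℕ.∸ suc p) (suc p) (λ l p<l _ z → ℕP.<-irrefl (sym z) p<l) (ℕP.≤-reflexive (ℕP.m∸n+n≡m p<n)) x₀) ⟩
        u all (n ℕ.∸ suc p ℕ.+ suc p) x₀ (q p) ≡⟨ cong (λ m → u all m x₀ (q p)) (ℕP.m∸n+n≡m p<n) ⟩
        u all n x₀ (q p) ≡⟨ cong (u all n x₀) (q-letter b) ⟩
        u all n x₀ b ≡⟨ sym (subst (λ m → w J₀ m (δ (q k)) b ≡ u all n (w all m (δ (q k))) b) (ℕP.m∸n+n≡m n≤k) (w-J₀ (k ℕ.∸ n) (δ (q k)) b)) ⟩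
        r J₀ k b ∎

-- Denominator vectors

private
  Term : ℕ → Set
  Term n = ℕ × Mono n

  expo : ∀ {n} → Fin n → Term n → ℕ
  expo i t = proj₁ (proj₂ t) i

  live : ∀ {n} → Term n → Bool
  live t = not (proj₁ t ℕ.≡ᵇ 0)

  -- Terms with coefficient 0 are ignored. As coefficients are natural numbers, the least exponent
  -- is additive under products.
  record Ord {n} (i : Fin n) (p : Poly n) (m : ℕ) : Set where
    constructor ord
    field
      attained : ∃ λ t → t ∈ p × proj₁ t ≢ 0 × expo i t ≡ m
      lower    : ∀ {t} → t ∈ p → proj₁ t ≢ 0 → m ℕ.≤ expo i t

  open Ord

  Ord-unique : ∀ {n} {i : Fin n} {p m k} → Ord i p m → Ord i p k → m ≡ k
  Ord-unique {i = i} {p} o o' = ℕP.≤-antisym (le o o') (le o' o)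
    where
    le : ∀ {m k} → Ord i p m → Ord i p k → m ℕ.≤ k
    le {m} o o' with attained o'
    ... | t , t∈ , nz , e = subst (m ℕ.≤_) e (lower o t∈ nz)

  least : ∀ {n} → Fin n → List (Term n) → ℕ
  least i [] = 0
  least i (t ∷ []) = expo i t
  least i (t ∷ t' ∷ ts) = expo i t ℕ.⊓ least i (t' ∷ ts)

  -- The recursion inside `ordx` is local and has no name here, so it is characterised by its
  -- equations.
  least-unique : ∀ {n} (i : Fin n) (g : List (Term n) → ℕ) → g [] ≡ 0 → (∀ t → g (t ∷ []) ≡ expo i t) →
    (∀ t t' ts → g (t ∷ t' ∷ ts) ≡ expo i t ℕ.⊓ g (t' ∷ ts)) → ∀ ts → g ts ≡ least i ts
  least-unique i g g₀ g₁ g₂ [] = g₀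
  least-unique i g g₀ g₁ g₂ (t ∷ []) = g₁ t
  least-unique i g g₀ g₁ g₂ (t ∷ t' ∷ ts) = trans (g₂ t t' ts) (cong (expo i t ℕ.⊓_) (least-unique i g g₀ g₁ g₂ (t' ∷ ts)))

  ordx-least : ∀ {n} (i : Fin n) (p : Poly n) → ordx i p ≡ least i (filterᵇ live p)
  ordx-least i p with filterᵇ live p | least-unique i _ refl (λ _ → refl) (λ _ _ _ → refl)
  ... | ts | h = h ts

  least-Ord : ∀ {n} (i : Fin n) (p : Poly n) → (filterᵇ live p ≡ [] × (∀ {t} → t ∈ p → proj₁ t ≡ 0)) ⊎
    (∃₂ λ s ts → filterᵇ live p ≡ s ∷ ts × Ord i p (least i (s ∷ ts)))
  least-Ord i [] = inj₁ (refl , λ ())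
  least-Ord i ((zero , μ) ∷ p) with least-Ord i p
  ... | inj₁ (e , z) = inj₁ (e , λ { (here refl) → refl ; (there t∈) → z t∈ })
  ... | inj₂ (s , ts , e , ord (t , t∈ , nz , m) l) = inj₂ (s , ts , e , ord (t , there t∈ , nz , m)
          λ { (here refl) nz → ⊥-elim (nz refl) ; (there t∈) nz → l t∈ nz })
  least-Ord i ((suc c , μ) ∷ p) with least-Ord i p
  ... | inj₁ (e , z) = inj₂ ((suc c , μ) , [] , cong ((suc c , μ) ∷_) e , ord ((suc c , μ) , here refl , (λ ()) , refl)
          λ { (here refl) _ → ℕP.≤-refl ; (there t∈) nz → ⊥-elim (nz (z t∈)) })
  ... | inj₂ (s , ts , e , ord (t , t∈ , nz , m) l) = inj₂ ((suc c , μ) , s ∷ ts , cong ((suc c , μ) ∷_) e , ord found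
          λ { (here refl) _ → ℕP.m⊓n≤m _ _ ; (there t∈) nz → ℕP.≤-trans (ℕP.m⊓n≤n (proj₁ μ i) _) (l t∈ nz) })
    where
    found : ∃ λ t' → t' ∈ ((suc c , μ) ∷ p) × proj₁ t' ≢ 0 × expo i t' ≡ proj₁ μ i ℕ.⊓ least i (s ∷ ts)
    found with ℕP.≤-total (proj₁ μ i) (least i (s ∷ ts))
    ... | inj₁ le = (suc c , μ) , here refl , (λ ()) , sym (ℕP.m≤n⇒m⊓n≡m le)
    ... | inj₂ ge = t , there t∈ , nz , trans m (sym (ℕP.m≥n⇒m⊓n≡n ge))

  ordx-Ord : ∀ {n} {i : Fin n} {p m} → Ord i p m → ordx i p ≡ m
  ordx-Ord {i = i} {p} o with least-Ord i p
  ... | inj₁ (e , z) = ⊥-elim (proj₁ (proj₂ (proj₂ (attained o))) (z (proj₁ (proj₂ (attained o)))))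
  ... | inj₂ (s , ts , e , o') = trans (ordx-least i p) (trans (cong (least i) e) (Ord-unique o' o))

  Ord-⊕ : ∀ {n} {i : Fin n} {p p' m m'} → Ord i p m → Ord i p' m' → Ord i (p ⊕ p') (m ℕ.⊓ m')
  Ord-⊕ {i = i} {p} {p'} {m} {m'} (ord (t , t∈ , nz , e) l) (ord (t' , t'∈ , nz' , e') l') = ord found bound
    where
    found : ∃ λ s → s ∈ (p ++ p') × proj₁ s ≢ 0 × expo i s ≡ m ℕ.⊓ m'
    found with ℕP.≤-total m m'
    ... | inj₁ le = t , ∈-++⁺ˡ t∈ , nz , trans e (sym (ℕP.m≤n⇒m⊓n≡m le))
    ... | inj₂ ge = t' , ∈-++⁺ʳ p t'∈ , nz' , trans e' (sym (ℕP.m≥n⇒m⊓n≡n ge))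
    bound : ∀ {s} → s ∈ (p ++ p') → proj₁ s ≢ 0 → m ℕ.⊓ m' ℕ.≤ expo i s
    bound s∈ nz with ∈-++⁻ p s∈
    ... | inj₁ s∈p = ℕP.≤-trans (ℕP.m⊓n≤m m m') (l s∈p nz)
    ... | inj₂ s∈p' = ℕP.≤-trans (ℕP.m⊓n≤n m m') (l' s∈p' nz)

  times : ∀ {n} → Term n → Term n → Term n
  times s t = (proj₁ s ℕ.* proj₁ t , monoMul (proj₂ s) (proj₂ t))

  ⊗-∈⁺ : ∀ {n} (p q : Poly n) {s t} → s ∈ p → t ∈ q → times s t ∈ (p ⊗ q)
  ⊗-∈⁺ (s ∷ p) q (here refl) t∈ = ∈-++⁺ˡ (∈-map⁺ (times s) t∈)
  ⊗-∈⁺ (s' ∷ p) q (there s∈) t∈ = ∈-++⁺ʳ (Data.List.map (times s') q) (⊗-∈⁺ p q s∈ t∈)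
    where import Data.List

  ⊗-∈⁻ : ∀ {n} (p q : Poly n) {r} → r ∈ (p ⊗ q) → ∃₂ λ s t → s ∈ p × t ∈ q × r ≡ times s t
  ⊗-∈⁻ (s ∷ p) q r∈ with ∈-++⁻ (Data.List.map (times s) q) r∈
    where import Data.List
  ... | inj₂ r∈' with ⊗-∈⁻ p q r∈'
  ...   | s' , t , s∈ , t∈ , e = s' , t , there s∈ , t∈ , e
  ⊗-∈⁻ (s ∷ p) q r∈ | inj₁ r∈' with ∈-map⁻ (times s) r∈'
  ... | t , t∈ , e = s , t , here refl , t∈ , e

  Ord-⊗ : ∀ {n} {i : Fin n} {p p' m m'} → Ord i p m → Ord i p' m' → Ord i (p ⊗ p') (m ℕ.+ m')
  Ord-⊗ {i = i} {p} {p'} {m} {m'} (ord (t , t∈ , nz , e) l) (ord (t' , t'∈ , nz' , e') l') =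
    ord (times t t' , ⊗-∈⁺ p p' t∈ t'∈ , nonzero , cong₂ ℕ._+_ e e') bound
    where
    nonzero : proj₁ t ℕ.* proj₁ t' ≢ 0
    nonzero z with ℕP.m*n≡0⇒m≡0∨n≡0 (proj₁ t) z
    ... | inj₁ z' = nz z'
    ... | inj₂ z' = nz' z'
    bound : ∀ {r} → r ∈ (p ⊗ p') → proj₁ r ≢ 0 → m ℕ.+ m' ℕ.≤ expo i r
    bound r∈ nzr with ⊗-∈⁻ p p' r∈
    ... | s , s' , s∈ , s'∈ , refl = ℕP.+-mono-≤ (l s∈ λ z → nzr (cong (ℕ._* proj₁ s') z))
            (l' s'∈ λ z → nzr (trans (cong (proj₁ s ℕ.*_) z) (ℕP.*-zeroʳ (proj₁ s))))

  Ord-single : ∀ {n} {i : Fin n} {μ} → Ord i ((1 , μ) ∷ []) (proj₁ μ i)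
  Ord-single {μ = μ} = ord ((1 , μ) , here refl , (λ ()) , refl) λ { (here refl) _ → ℕP.≤-refl }

-- z is the i-th component of the denominator vector of f. The fields exclude the junk value of ordx at 0.
record Den {n} (i : Fin n) (f : Frac n) (z : ℤ) : Set where
  constructor den
  field
    {ordNum ordDen} : ℕ
    num   : Ord i (proj₁ f) ordNum
    denom : Ord i (proj₂ f) ordDen
    value : z ≡ int ordDen - int ordNum

module _ {n : ℕ} {i : Fin n} where

  Den-dvec : ∀ {f z} → Den i f z → dvec f i ≡ z
  Den-dvec (den o o' v) = trans (cong₂ (λ s t → int s - int t) (ordx-Ord o') (ordx-Ord o)) (sym v)

  Den-cong : ∀ {f z z'} → z ≡ z' → Den i f z → Den i f z'
  Den-cong refl d = d

  Den-one : Den i fOne 0ℤ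
  Den-one = den Ord-single Ord-single refl

  Den-mul : ∀ {f g z z'} → Den i f z → Den i g z' → Den i (fMul f g) (z + z')
  Den-mul (den {a} {b} o p refl) (den {c} {d} o' p' refl) = den (Ord-⊗ o o') (Ord-⊗ p p')
    (trans (arith (int b) (int a) (int d) (int c)) (sym (cong₂ _-_ (ℤP.pos-+ b d) (ℤP.pos-+ a c))))
    where
    arith : ∀ b a d c → b - a + (d - c) ≡ b + d - (a + c)
    arith = solve-∀

  Den-div : ∀ {f g z z'} → Den i f z → Den i g z' → Den i (fDiv f g) (z - z')
  Den-div (den {a} {b} o p refl) (den {c} {d} o' p' refl) = den (Ord-⊗ o p') (Ord-⊗ p o')
    (trans (arith (int b) (int a) (int d) (int c)) (sym (cong₂ _-_ (ℤP.pos-+ b c) (ℤP.pos-+ a d))))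
    where
    arith : ∀ b a d c → b - a - (d - c) ≡ b + c - (a + d)
    arith = solve-∀

  Den-add : ∀ {f g z z'} → Den i f z → Den i g z' → Den i (fAdd f g) (z ⊔ z')
  Den-add (den {a} {b} o p refl) (den {c} {d} o' p' refl) = den (Ord-⊕ (Ord-⊗ o p') (Ord-⊗ o' p)) (Ord-⊗ p p') (maximum (ℕP.≤-total (a ℕ.+ d) (c ℕ.+ b)))
    where
    first : int (b ℕ.+ d) - int (a ℕ.+ d) ≡ int b - int a
    first = trans (cong₂ _-_ (ℤP.pos-+ b d) (ℤP.pos-+ a d)) (arith (int b) (int a) (int d))
      where
      arith : ∀ b a d → b + d - (a + d) ≡ b - a
      arith = solve-∀
    second : int (b ℕ.+ d) - int (c ℕ.+ b) ≡ int d - int c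
    second = trans (cong₂ _-_ (ℤP.pos-+ b d) (ℤP.pos-+ c b)) (arith (int b) (int c) (int d))
      where
      arith : ∀ b c d → b + d - (c + b) ≡ d - c
      arith = solve-∀
    maximum : a ℕ.+ d ℕ.≤ c ℕ.+ b ⊎ c ℕ.+ b ℕ.≤ a ℕ.+ d →
      (int b - int a) ⊔ (int d - int c) ≡ int (b ℕ.+ d) - int ((a ℕ.+ d) ℕ.⊓ (c ℕ.+ b))
    maximum (inj₁ le) = trans (ℤP.i≥j⇒i⊔j≡i (subst₂ _≤_ second first (ℤP.+-monoʳ-≤ (int (b ℕ.+ d)) (ℤP.neg-mono-≤ (+≤+ le)))))
      (trans (sym first) (cong (λ m → int (b ℕ.+ d) - int m) (sym (ℕP.m≤n⇒m⊓n≡m le))))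
    maximum (inj₂ le) = trans (ℤP.i≤j⇒i⊔j≡j (subst₂ _≤_ first second (ℤP.+-monoʳ-≤ (int (b ℕ.+ d)) (ℤP.neg-mono-≤ (+≤+ le)))))
      (trans (sym second) (cong (λ m → int (b ℕ.+ d) - int m) (sym (ℕP.m≥n⇒m⊓n≡n le))))

  Den-pow : ∀ {f z} k → Den i f z → Den i (fPow f k) (int k * z)
  Den-pow {z = z} zero D = Den-cong {f = fOne} (sym (ℤP.*-zeroˡ z)) Den-one
  Den-pow {f} {z} (suc k) D = Den-cong {f = fPow f (suc k)} (trans (arith z (int k)) (cong (_* z) (sym (ℤP.pos-+ 1 k)))) (Den-mul {f = f} {g = fPow f k} D (Den-pow {f = f} k D))
    where
    arith : ∀ z k → z + k * z ≡ (1ℤ + k) * z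
    arith = solve-∀

  Den-prod : ∀ {f z} → (∀ l → Den i (f l) (z l)) → Den i (fProd f) (∑ z)
  Den-prod {f} D = go (λ l → l) {f} D
    where
    open import Data.List using (foldr; tabulate)
    go : ∀ {m} (g : Fin m → Fin n) {f : Fin n → Frac n} {z : Fin m → ℤ} → (∀ l → Den i (f (g l)) (z l)) →
      Den i (foldr (λ l acc → fMul (f l) acc) fOne (tabulate g)) (∑ z)
    go {zero} g D = Den-one
    go {suc m} g {f} D = Den-mul {f = f (g Fin.zero)} {g = foldr (λ l acc → fMul (f l) acc) fOne (tabulate (λ l → g (Fin.suc l)))}
      (D Fin.zero) (go (λ l → g (Fin.suc l)) {f} (λ l → D (Fin.suc l)))

  Den-x : ∀ j → Den i (xVar j , pOne) (- δ j i)
  Den-x j = den Ord-single Ord-single value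
    where
    value : - δ j i ≡ int 0 - int (if ⌊ i ≟ j ⌋ then 1 else 0)
    value with i ≟ j
    ... | yes _ = refl
    ... | no _ = refl

  Den-y : ∀ j → Den i (yVar j , pOne) 0ℤ
  Den-y j = den Ord-single Ord-single refl

  -- The tropical form of the exchange relation; the coefficient variables contribute 0.
  Den-mutate : ∀ {S : Seed n} {z : Fin n → ℤ} (k : Fin n) → (∀ l → Den i (x S l) (z l)) →
    Den i (x (mutate k S) k) ((∑ (λ l → int [ B S l k ]₊ * z l) ⊔ ∑ (λ l → int [ - B S l k ]₊ * z l)) - z k)
  Den-mutate {S} {z} k D with k ≟ k
  ... | no k≢k = ⊥-elim (k≢k refl)
  ... | yes _ = Den-div {f = fAdd (side [B]₊ [C]₊) (side [-B]₊ [-C]₊)} {g = x S k}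
        (Den-add {f = side [B]₊ [C]₊} {g = side [-B]₊ [-C]₊} (half [B]₊ [C]₊) (half [-B]₊ [-C]₊)) (D k)
    where
    [B]₊ [C]₊ [-B]₊ [-C]₊ : Fin n → ℕ
    [B]₊ l = [ B S l k ]₊
    [C]₊ l = [ Seed.C S l k ]₊
    [-B]₊ l = [ - B S l k ]₊
    [-C]₊ l = [ - Seed.C S l k ]₊
    side : (Fin n → ℕ) → (Fin n → ℕ) → Frac n
    side e e' = fMul (fProd (λ l → fPow (x S l) (e l))) (fProd (λ l → fPow (yVar l , pOne) (e' l)))
    half : ∀ e e' → Den i (side e e') (∑ (λ l → int (e l) * z l))
    half e e' = Den-cong {f = side e e'} (trans (cong (∑ (λ l → int (e l) * z l) +_) (∑-0 λ l → ℤP.*-zeroʳ (int (e' l)))) (ℤP.+-identityʳ _))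
      (Den-mul {f = fProd (λ l → fPow (x S l) (e l))} {g = fProd (λ l → fPow (yVar l , pOne) (e' l))}
        (Den-prod {f = λ l → fPow (x S l) (e l)} (λ l → Den-pow {f = x S l} (e l) (D l)))
        (Den-prod {f = λ l → fPow (yVar l , pOne) (e' l)} (λ l → Den-pow {f = yVar l , pOne} (e' l) (Den-y l))))

  Den-mutate-other : ∀ {S : Seed n} {z} {k j : Fin n} → j ≢ k → Den i (x S j) z → Den i (x (mutate k S) j) z
  Den-mutate-other {k = k} {j} j≢k D with j ≟ k
  ... | yes e = ⊥-elim (j≢k e)
  ... | no _ = D

-- Seeds of facets

cancel-≤ : ∀ {c x y} → 0ℤ < c → c * x ≤ c * y → x ≤ y
cancel-≤ {int (suc m)} {x} {y} _ h = ℤP.*-cancelˡ-≤-pos x y (int (suc m)) h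
cancel-≤ {int zero} (+<+ ())

scale-[]₊ : ∀ {c} → 0ℤ < c → ∀ z → c * int [ z ]₊ ≡ int [ c * z ]₊
scale-[]₊ {int zero} (+<+ ())
scale-[]₊ {c@(int (suc m))} 0<c z with total0 z
... | inj₁ p = trans (cong (c *_) ([]₊-pos p)) (sym ([]₊-pos (0≤* (<⇒≤ 0<c) p)))
... | inj₂ l = trans (cong (c *_) (vanish z (<⇒≤ l))) (trans (ℤP.*-zeroʳ c) (sym (vanish (c * z) (*≤0 (<⇒≤ 0<c) (<⇒≤ l)))))
  where
  vanish : ∀ y → y ≤ 0ℤ → int [ y ]₊ ≡ 0ℤ
  vanish y h = trans (cong (λ x → int [ x ]₊) (sym (ℤP.neg-involutive y))) ([]₊-neg (0≤- h))

split-[]₊ : ∀ z → z ≡ int [ z ]₊ - int [ - z ]₊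
split-[]₊ (int zero) = refl
split-[]₊ (int (suc m)) = sym (ℤP.+-identityʳ _)
split-[]₊ -[1+ m ] = refl

-- A known sign of `x` kills one of the two products and makes the other linear in `x`. The implicit
-- index of `mutEntry` is a phantom, set to 0.
mutEntry-linear : ∀ b y {c x} → 0ℤ ≤ sg b x → mutEntry {0} c x y ≡ c + int [ sg b y ]₊ * x
mutEntry-linear b y {c} {x} p = trans (cong₂ (λ s t → c + s - t) (ℤP.pos-* [ x ]₊ [ y ]₊) (ℤP.pos-* [ - x ]₊ [ - y ]₊)) (go b p)
  where
  go : ∀ b → 0ℤ ≤ sg b x → c + int [ x ]₊ * int [ y ]₊ - int [ - x ]₊ * int [ - y ]₊ ≡ c + int [ sg b y ]₊ * x
  go true p = trans (cong₂ (λ s t → c + s * int [ y ]₊ - t * int [ - y ]₊) ([]₊-pos p) ([]₊-neg p)) (arith c x (int [ y ]₊) (int [ - y ]₊))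
    where
    arith : ∀ c x s t → c + x * s - 0ℤ * t ≡ c + s * x
    arith = solve-∀
  go false p = trans (cong₂ (λ s t → c + s * int [ y ]₊ - t * int [ - y ]₊)
      (trans (cong (λ z → int [ z ]₊) (sym (ℤP.neg-involutive x))) ([]₊-neg p)) ([]₊-pos p)) (arith c x (int [ y ]₊) (int [ - y ]₊))
    where
    arith : ∀ c x s t → c + 0ℤ * s - - x * t ≡ c + t * x
    arith = solve-∀

-- Mutation written as a change of basis, valid for either sign; the tropical sign will make it
-- match the change of c-vectors.
mutEntry-signed : ∀ b c x y → mutEntry {0} c x y ≡ c + int [ sg b y ]₊ * x + int [ - sg b x ]₊ * y
mutEntry-signed b c x y = trans (cong₂ (λ s t → c + s - t) (ℤP.pos-* [ x ]₊ [ y ]₊) (ℤP.pos-* [ - x ]₊ [ - y ]₊)) (go b)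
  where
  X X' Y Y' : ℤ
  X = int [ x ]₊
  X' = int [ - x ]₊
  Y = int [ y ]₊
  Y' = int [ - y ]₊
  go : ∀ b → c + X * Y - X' * Y' ≡ c + int [ sg b y ]₊ * x + int [ - sg b x ]₊ * y
  go true = trans (arith c X X' Y Y') (sym (cong₂ (λ s t → c + Y * s + X' * t) (split-[]₊ x) (split-[]₊ y)))
    where
    arith : ∀ c X X' Y Y' → c + X * Y - X' * Y' ≡ c + Y * (X - X') + X' * (Y - Y')
    arith = solve-∀
  go false = trans (arith c X X' Y Y') (trans (sym (cong₂ (λ s t → c + Y' * s + X * t) (split-[]₊ x) (split-[]₊ y)))
      (cong (λ s → c + Y' * x + int [ s ]₊ * y) (sym (ℤP.neg-involutive x))))
    where
    arith : ∀ c X X' Y Y' → c + X * Y - X' * Y' ≡ c + Y' * (X - X') + X * (Y - Y')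
    arith = solve-∀

module Seeds {n : ℕ} (a : CartanMatrix n) (fin : IsFiniteCartan a) (q : ℕ → Fin n) (κ₀ : Fin n → ℕ) (L : ℕ)
  (steps : ∀ p → p ℕ.< L → Euler.Step a fin (orient a q κ₀ p) (q p)) (sep : Euler.Separating a fin κ₀)
  (n≤L : n ℕ.≤ L) (q-initial : ∀ k → k ℕ.< n → toℕ (q k) ≡ k) where

  open Roots a fin
  open ReducedWords a fin
  open Euler a fin
  open Sorting a fin using (A-≤0)
  open Facets a fin q
  open Frames a fin q κ₀ L steps sep
  open Clusters a fin q κ₀ L steps sep n≤L q-initial

  -- The invariant of mutation. Its facet `J` is built by flips, with `at` labelling the columns of
  -- the seed by positions. `d-at` keeps the symmetrizer compatible with this labelling, and only
  -- spanning is recorded, since independence follows from the functionals `G`.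
  record SeedOf (S : Seed n) : Set where
    field
      J     : ℕ → Bool
      facet : Facet L J
      tri   : Triangular J
      at    : Fin n → ℕ
      at<L  : ∀ k → at k ℕ.< L
      J-at  : ∀ k → J (at k) ≡ true
      at-injective  : ∀ {k l} → at k ≡ at l → k ≡ l
      at-surjective : ∀ {p} → p ℕ.< L → J p ≡ true → ∃ λ k → at k ≡ p
      c-root : ∀ k → cvec S k ≗ r J (at k)
      d-at   : ∀ k → dZ (q (at k)) ≡ dZ k
      b-skew : ∀ j k → dZ j * B S j k ≡ ω 0 (r J (at j)) (r J (at k))
      spans  : ∀ v → ∃ λ c → v ≗ comb c (λ k → r J (at k))
      d-vector : ∀ k i → Den i (x S k) (ψℕ (at k) i)

  module Seed-data {S : Seed n} (I : SeedOf S) where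
    open SeedOf I public
    open Facet-data tri public
    open ψ-values tri public

    G-δ : ∀ p k l → G p (at k) (ρ J p (at l)) ≡ δ k l
    G-δ p k l with l ≟ k
    ... | yes refl = G-same p (at l)
    ... | no l≢k = G-diff p (at<L k) (at<L l) (J-at k) (J-at l) (λ z → l≢k (at-injective z))

    G-comb : ∀ p c k → G p (at k) (comb c (λ l → ρ J p (at l))) ≡ c k
    G-comb p c k = trans (at-comb (G-linear p (at k)) c (λ l → ρ J p (at l)))
      (trans (∑-cong λ l → trans (cong (c l *_) (G-δ p k l)) (ℤP.*-comm (c l) (δ k l))) (∑-δ k c))

    -- Spanning only provides some coefficients; the dual functionals identify them.
    expansion : ∀ p v → v ≗ comb (λ k → G p (at k) v) (λ k → ρ J p (at k))
    expansion p v t = trans (v≗ t) (∑-cong λ k → cong (_* ρ J p (at k) t) (sym (trans (resp (G-linear p (at k)) v≗) (G-comb p c k))))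
      where
      c₀ c : Fin n → ℤ
      c₀ = proj₁ (spans (w J p v))
      c k = sg (not (at k ℕ.<ᵇ p)) (c₀ k)
      v≗ : v ≗ comb c (λ k → ρ J p (at k))
      v≗ t = trans (sym (u-w J p v t)) (trans (u-cong J p (proj₂ (spans (w J p v))) t) (trans (at-comb (u-linear J p t) c₀ (λ k → r J (at k)))
        (∑-cong λ k → sym (sg-* (not (at k ℕ.<ᵇ p)) (c₀ k) (u J p (r J (at k)) t)))))

  module Step-data {S : Seed n} (I : SeedOf S) (i₀ : Fin n) where
    open Seed-data I

    i : ℕ
    i = at i₀

    j : ℕ
    j = proj₁ (flip-exists L facet (at<L i₀) (J-at i₀))

    open Mutation facet tri (proj₂ (flip-exists L facet (at<L i₀) (J-at i₀)))

    at' : Fin n → ℕ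
    at' k = if ⌊ k ≟ i₀ ⌋ then j else at k

    at'-new : at' i₀ ≡ j
    at'-new with i₀ ≟ i₀
    ... | yes _ = refl
    ... | no z = ⊥-elim (z refl)

    at'-old : ∀ {k} → k ≢ i₀ → at' k ≡ at k
    at'-old {k} k≢ with k ≟ i₀
    ... | yes z = ⊥-elim (k≢ z)
    ... | no _ = refl

    at≢i : ∀ {k} → k ≢ i₀ → at k ≢ i
    at≢i k≢ z = k≢ (at-injective z)

    at≢j : ∀ k → at k ≢ j
    at≢j k z = case trans (sym (J-at k)) (trans (cong J z) Jj) of λ ()

    at'<L : ∀ k → at' k ℕ.< L
    at'<L k with k ≟ i₀
    ... | yes _ = j<L
    ... | no _ = at<L k

    J'-at' : ∀ k → J' (at' k) ≡ true
    J'-at' k with k ≟ i₀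
    ... | yes _ = J'j
    ... | no k≢ = trans (J'k (at≢i k≢) (at≢j k)) (J-at k)

    at'-injective : ∀ {k l} → at' k ≡ at' l → k ≡ l
    at'-injective {k} {l} h with k ≟ i₀ | l ≟ i₀
    ... | yes refl | yes refl = refl
    ... | yes _ | no _ = ⊥-elim (at≢j l (sym h))
    ... | no _ | yes _ = ⊥-elim (at≢j k h)
    ... | no _ | no _ = at-injective h

    at'-surjective : ∀ {p} → p ℕ.< L → J' p ≡ true → ∃ λ k → at' k ≡ p
    at'-surjective {p} p<L J'p = go (p ℕ.≟ j)
      where
      go : Dec (p ≡ j) → ∃ λ k → at' k ≡ p
      go (yes z) = i₀ , trans at'-new (sym z)
      go (no p≢j) with at-surjective p<L (J'-old J'p p≢j)
      ... | k , z = k , trans (at'-old k≢) z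
        where
        k≢ : k ≢ i₀
        k≢ refl = J'-≢i J'p (sym z)

    BB : Fin n → Fin n → ℤ
    BB = B S

    b-anti : ∀ k l → dZ k * BB k l ≡ - (dZ l * BB l k)
    b-anti k l = trans (b-skew k l) (trans (ω-anti 0 _ _) (cong -_ (sym (b-skew l k))))

    b-diag : BB i₀ i₀ ≡ 0ℤ
    b-diag = cancel-pos (0<d i₀) (trans (b-skew i₀ i₀) (trans (ω-self 0 _) (sym (ℤP.*-zeroʳ (dZ i₀)))))

    b-flip : ∀ {k} → k ≢ i₀ → bᵢ (at k) ≡ BB i₀ k
    b-flip {k} k≢ = cancel-pos (0<d (q i)) (trans (sym (skew-b (at<L k) (J-at k) (at≢i k≢)))
      (trans (sym (b-skew i₀ k)) (cong (_* BB i₀ k) (sym (d-at i₀)))))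

    M : ℕ → Fin n → ℤ
    M p k = int [ sg (ε p) (BB i₀ k) ]₊

    M-diag : ∀ p → M p i₀ ≡ 0ℤ
    M-diag p = cong (λ z → int [ z ]₊) (trans (cong (sg (ε p)) b-diag) (sg-0 (ε p)))

    ρ'-new : ∀ p → ρ J' p (at' i₀) ≗ neg (ρ J p i)
    ρ'-new p t = trans (cong (λ z → ρ J' p z t) at'-new) (ρ-flip-new p t)

    ρ'-old : ∀ p {k} → k ≢ i₀ → ρ J' p (at' k) ≗ (ρ J p (at k) +⟨ M p k ⟩ ρ J p i)
    ρ'-old p {k} k≢ t = trans (cong (λ z → ρ J' p z t) (at'-old k≢)) (trans (ρ-flip {p} (at<L k) (J-at k) (at≢i k≢) t)
      (cong (λ z → ρ J p (at k) t + int [ sg (ε p) z ]₊ * ρ J p i t) (b-flip k≢)))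

    c c' : Fin n → Vect n
    c k = r J (at k)
    c' k = r J' (at' k)

    S' : Seed n
    S' = mutate i₀ S

    c-root' : ∀ k → cvec S' k ≗ c' k
    c-root' k t with k ≟ i₀
    ... | yes refl = trans (cong -_ (c-root k t)) (sym (r-flip-new t))
    ... | no k≢ = trans (mutEntry-linear (ε 0) (BB i₀ k) {Seed.C S t k} {Seed.C S t i₀} (subst (λ z → 0ℤ ≤ sg (ε 0) z) (sym (c-root i₀ t)) (ρ-sign {0} ℕ.z≤n t)))
            (trans (cong₂ (λ s z → s + M 0 k * z) (c-root k t) (c-root i₀ t))
              (sym (trans (ρ-flip {0} (at<L k) (J-at k) (at≢i k≢) t) (cong (λ z → c k t + int [ sg (ε 0) z ]₊ * c i₀ t) (b-flip k≢)))))

    d-at' : ∀ k → dZ (q (at' k)) ≡ dZ k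
    d-at' k with k ≟ i₀
    ... | yes refl = trans d-flip (d-at k)
    ... | no _ = d-at k

    -- With the sign `ε 0`, matrix mutation is the congruence induced by the change of c-vectors, so
    -- it follows from bilinearity of `ω 0`.
    b-skew' : ∀ k l → dZ k * B S' k l ≡ ω 0 (c' k) (c' l)
    b-skew' k l = go (k ≟ i₀) (l ≟ i₀)
      where
      neg-b : ∀ k l → (⌊ k ≟ i₀ ⌋ ∨ ⌊ l ≟ i₀ ⌋) ≡ true → ω 0 (c' k) (c' l) ≡ - ω 0 (c k) (c l) → dZ k * B S' k l ≡ ω 0 (c' k) (c' l)
      neg-b k l e h = trans (cong (λ z → dZ k * (if z then - BB k l else mutEntry {n} (BB k l) (BB k i₀) (BB i₀ l))) e)
        (trans (sym (ℤP.neg-distribʳ-* (dZ k) (BB k l))) (trans (cong -_ (b-skew k l)) (sym h)))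
      row : ∀ l → l ≢ i₀ → ω 0 (c' i₀) (c' l) ≡ - ω 0 (c i₀) (c l)
      row l l≢ = trans (ω-cong 0 (ρ'-new 0) (ρ'-old 0 l≢)) (trans (at-neg (ω-linˡ 0 _) (c i₀)) (cong -_
        (trans (lin (ω-linʳ 0 (c i₀)) (c l) (M 0 l) (c i₀)) (trans (cong (λ z → ω 0 (c i₀) (c l) + M 0 l * z) (ω-self 0 (c i₀)))
          (trans (cong (ω 0 (c i₀) (c l) +_) (ℤP.*-zeroʳ (M 0 l))) (ℤP.+-identityʳ _))))))
      is-yes : ∀ (k : Fin n) → ⌊ k ≟ k ⌋ ≡ true
      is-yes k with k ≟ k
      ... | yes _ = refl
      ... | no z = ⊥-elim (z refl)
      is-no : ∀ {k : Fin n} → k ≢ i₀ → ⌊ k ≟ i₀ ⌋ ≡ false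
      is-no {k} k≢ with k ≟ i₀
      ... | yes z = ⊥-elim (k≢ z)
      ... | no _ = refl
      rescale : ∀ k → M 0 k * dZ i₀ ≡ dZ k * int [ - sg (ε 0) (BB k i₀) ]₊
      rescale k = trans (ℤP.*-comm (M 0 k) (dZ i₀)) (trans (scale-[]₊ (0<d i₀) (sg (ε 0) (BB i₀ k)))
        (trans (cong (λ z → int [ z ]₊) (by (ε 0))) (sym (scale-[]₊ (0<d k) _))))
        where
        by : ∀ s → dZ i₀ * sg s (BB i₀ k) ≡ dZ k * - sg s (BB k i₀)
        by true = trans (b-anti i₀ k) (ℤP.neg-distribʳ-* (dZ k) (BB k i₀))
        by false = trans (sym (ℤP.neg-distribʳ-* (dZ i₀) (BB i₀ k))) (trans (cong -_ (b-anti i₀ k))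
          (trans (ℤP.neg-involutive _) (cong (dZ k *_) (sym (ℤP.neg-involutive (BB k i₀))))))
      go : Dec (k ≡ i₀) → Dec (l ≡ i₀) → dZ k * B S' k l ≡ ω 0 (c' k) (c' l)
      go (yes refl) (yes refl) = neg-b k k (cong (_∨ ⌊ k ≟ k ⌋) (is-yes k)) (trans (ω-self 0 (c' k)) (sym (cong -_ (ω-self 0 (c k)))))
      go (yes refl) (no l≢) = neg-b k l (cong (_∨ ⌊ l ≟ k ⌋) (is-yes k)) (row l l≢)
      go (no k≢) (yes refl) = neg-b k l (cong₂ _∨_ (is-no k≢) (is-yes l))
        (trans (ω-anti 0 (c' k) (c' l)) (cong -_ (trans (row k k≢) (sym (ω-anti 0 (c k) (c l))))))
      go (no k≢) (no l≢) = begin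
        dZ k * B S' k l
          ≡⟨ cong (λ z → dZ k * (if z then - BB k l else mutEntry {n} (BB k l) (BB k i₀) (BB i₀ l))) (cong₂ _∨_ (is-no k≢) (is-no l≢)) ⟩
        dZ k * mutEntry {n} (BB k l) (BB k i₀) (BB i₀ l) ≡⟨ cong (dZ k *_) (mutEntry-signed (ε 0) (BB k l) (BB k i₀) (BB i₀ l)) ⟩
        dZ k * (BB k l + M 0 l * BB k i₀ + int [ - sg (ε 0) (BB k i₀) ]₊ * BB i₀ l)
          ≡⟨ arith (dZ k) (BB k l) (M 0 l) (BB k i₀) (int [ - sg (ε 0) (BB k i₀) ]₊) (BB i₀ l) ⟩
        dZ k * BB k l + M 0 l * (dZ k * BB k i₀) + (dZ k * int [ - sg (ε 0) (BB k i₀) ]₊) * BB i₀ l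
          ≡⟨ cong (λ z → dZ k * BB k l + M 0 l * (dZ k * BB k i₀) + z * BB i₀ l) (sym (rescale k)) ⟩
        dZ k * BB k l + M 0 l * (dZ k * BB k i₀) + M 0 k * dZ i₀ * BB i₀ l
          ≡⟨ cong (dZ k * BB k l + M 0 l * (dZ k * BB k i₀) +_) (ℤP.*-assoc (M 0 k) (dZ i₀) (BB i₀ l)) ⟩
        dZ k * BB k l + M 0 l * (dZ k * BB k i₀) + M 0 k * (dZ i₀ * BB i₀ l)
          ≡⟨ cong₂ _+_ (cong₂ (λ s t → s + M 0 l * t) (b-skew k l) (b-skew k i₀)) (cong (M 0 k *_) (b-skew i₀ l)) ⟩
        ω 0 (c k) (c l) + M 0 l * ω 0 (c k) (c i₀) + M 0 k * ω 0 (c i₀) (c l)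
          ≡⟨ arith' (ω 0 (c k) (c l)) (M 0 l) (ω 0 (c k) (c i₀)) (M 0 k) (ω 0 (c i₀) (c l)) ⟩
        ω 0 (c k) (c l) + M 0 l * ω 0 (c k) (c i₀) + M 0 k * (ω 0 (c i₀) (c l) + M 0 l * 0ℤ)
          ≡⟨ cong (λ z → ω 0 (c k) (c l) + M 0 l * ω 0 (c k) (c i₀) + M 0 k * (ω 0 (c i₀) (c l) + M 0 l * z)) (sym (ω-self 0 (c i₀))) ⟩
        ω 0 (c k) (c l) + M 0 l * ω 0 (c k) (c i₀) + M 0 k * (ω 0 (c i₀) (c l) + M 0 l * ω 0 (c i₀) (c i₀))
          ≡⟨ sym (cong₂ (λ s t → s + M 0 k * t) (lin (ω-linʳ 0 (c k)) (c l) (M 0 l) (c i₀)) (lin (ω-linʳ 0 (c i₀)) (c l) (M 0 l) (c i₀))) ⟩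
        ω 0 (c k) (c l +⟨ M 0 l ⟩ c i₀) + M 0 k * ω 0 (c i₀) (c l +⟨ M 0 l ⟩ c i₀)
          ≡⟨ sym (lin (ω-linˡ 0 (c l +⟨ M 0 l ⟩ c i₀)) (c k) (M 0 k) (c i₀)) ⟩
        ω 0 (c k +⟨ M 0 k ⟩ c i₀) (c l +⟨ M 0 l ⟩ c i₀) ≡⟨ sym (ω-cong 0 (ρ'-old 0 k≢) (ρ'-old 0 l≢)) ⟩
        ω 0 (c' k) (c' l) ∎
        where
        open ≡-Reasoning
        arith : ∀ d b m s t o → d * (b + m * s + t * o) ≡ d * b + m * (d * s) + (d * t) * o
        arith = solve-∀
        arith' : ∀ o m s k t → o + m * s + k * t ≡ o + m * s + k * (t + m * 0ℤ)
        arith' = solve-∀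

    -- The -2 covers the index `i₀`, where adding -2 times the root negates it, so that one formula
    -- holds for all indices.
    μ : Fin n → ℤ
    μ k = M 0 k + - int 2 * δ i₀ k

    c'-μ : ∀ k → c' k ≗ (c k +⟨ μ k ⟩ c i₀)
    c'-μ k t = go (k ≟ i₀)
      where
      go : Dec (k ≡ i₀) → c' k t ≡ c k t + μ k * c i₀ t
      go (yes refl) = trans (ρ'-new 0 t) (trans (arith (c k t)) (sym (cong₂ (λ s z → c k t + (s + - int 2 * z) * c k t) (M-diag 0) (δ-same k))))
        where
        arith : ∀ y → - y ≡ y + (0ℤ + - int 2 * 1ℤ) * y
        arith = solve-∀
      go (no k≢) = trans (ρ'-old 0 k≢ t) (cong (λ z → c k t + z * c i₀ t) (sym (trans (cong (λ z → M 0 k + - int 2 * z) (δ-diff k≢)) (ℤP.+-identityʳ (M 0 k)))))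

    spans' : ∀ v → ∃ λ γ → v ≗ comb γ c'
    -- The old coefficients on the new roots overshoot by `s` times the root at i, and the new root
    -- at index `i₀` is its negative.
    spans' v = (λ k → γ k + δ i₀ k * s) , λ t → trans (h t) (sym (value t))
      where
      γ : Fin n → ℤ
      γ = proj₁ (spans v)
      h : v ≗ comb γ c
      h = proj₂ (spans v)
      s : ℤ
      s = ∑ (λ k → γ k * μ k)
      arith : ∀ γ δ s c' → (γ + δ * s) * c' ≡ γ * c' + s * (δ * c')
      arith = solve-∀
      arith₂ : ∀ γ c m o → γ * (c + m * o) ≡ γ * c + o * (γ * m)
      arith₂ = solve-∀
      arith₃ : ∀ y o s → y + o * s + s * - o ≡ y
      arith₃ = solve-∀
      value : ∀ t → comb (λ k → γ k + δ i₀ k * s) c' t ≡ comb γ c t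
      value t = begin
        comb (λ k → γ k + δ i₀ k * s) c' t ≡⟨ ∑-cong (λ k → arith (γ k) (δ i₀ k) s (c' k t)) ⟩
        ∑ (λ k → γ k * c' k t + s * (δ i₀ k * c' k t)) ≡⟨ ∑-+ (λ k → γ k * c' k t) (λ k → s * (δ i₀ k * c' k t)) ⟩
        ∑ (λ k → γ k * c' k t) + ∑ (λ k → s * (δ i₀ k * c' k t))
          ≡⟨ cong₂ _+_ (∑-cong λ k → trans (cong (γ k *_) (c'-μ k t)) (arith₂ (γ k) (c k t) (μ k) (c i₀ t)))
              (trans (∑-*ˡ s (λ k → δ i₀ k * c' k t)) (cong (s *_) (trans (∑-δ i₀ (λ k → c' k t)) (ρ'-new 0 t)))) ⟩
        ∑ (λ k → γ k * c k t + c i₀ t * (γ k * μ k)) + s * - c i₀ t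
          ≡⟨ cong (_+ s * - c i₀ t) (trans (∑-+ (λ k → γ k * c k t) (λ k → c i₀ t * (γ k * μ k))) (cong (comb γ c t +_) (∑-*ˡ (c i₀ t) (λ k → γ k * μ k)))) ⟩
        comb γ c t + c i₀ t * s + s * - c i₀ t ≡⟨ arith₃ (comb γ c t) (c i₀ t) s ⟩
        comb γ c t ∎
        where open ≡-Reasoning

    -- The exchange relation for the b-th components of ψ, read off in the rotation in which b is the first letter.
    module Exchange (b : Fin n) where

      p : ℕ
      p = toℕ b

      p<L : p ℕ.< L
      p<L = ℕP.<-≤-trans (FinP.toℕ<n b) n≤L

      Λ : Fin n → ℤ
      Λ k = G p (at k) (δ b)

      module New = Facet-data triangular-flip

      Λ' : ℤ
      Λ' = New.G p j (δ b)

      G'-new : New.G p j (ρ J p i) ≡ - 1ℤ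
      G'-new = trans (sym (ℤP.neg-involutive _)) (cong -_ (trans (sym (at-neg (New.G-linear p j) (ρ J p i)))
        (trans (sym (resp (New.G-linear p j) (ρ-flip-new p))) (New.G-same p j))))

      G'-old : ∀ {k} → k ≢ i₀ → New.G p j (ρ J p (at k)) ≡ M p k
      G'-old {k} k≢ = trans (arith (New.G p j (ρ J p (at k))) (M p k)) (trans (cong (_+ M p k) zero-sum) (ℤP.+-identityˡ (M p k)))
        where
        arith : ∀ g m → g ≡ g + m * - 1ℤ + m
        arith = solve-∀
        zero-sum : New.G p j (ρ J p (at k)) + M p k * - 1ℤ ≡ 0ℤ
        zero-sum = trans (cong (λ z → New.G p j (ρ J p (at k)) + M p k * z) (sym G'-new))
          (trans (sym (lin (New.G-linear p j) (ρ J p (at k)) (M p k) (ρ J p i)))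
          (trans (sym (resp (New.G-linear p j) (ρ'-old p k≢)))
          (New.G-diff p j<L (at'<L k) J'j (J'-at' k) λ z → k≢ (at'-injective (trans z (sym at'-new))))))

      -- The functional dual to the new root at j takes the value -1 at the old root at i and
      -- `M p k` at the others; it is applied to the expansion of α_b.
      linear-exchange : Λ' ≡ ∑ (λ k → M p k * Λ k) - Λ i₀
      linear-exchange = begin
        Λ' ≡⟨ resp (New.G-linear p j) (expansion p (δ b)) ⟩
        New.G p j (comb Λ (λ k → ρ J p (at k))) ≡⟨ at-comb (New.G-linear p j) Λ (λ k → ρ J p (at k)) ⟩
        ∑ (λ k → Λ k * New.G p j (ρ J p (at k))) ≡⟨ ∑-cong (λ k → term k (k ≟ i₀)) ⟩
        ∑ (λ k → M p k * Λ k + -1ℤ * (δ i₀ k * Λ k)) ≡⟨ ∑-+ (λ k → M p k * Λ k) (λ k → -1ℤ * (δ i₀ k * Λ k)) ⟩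
        ∑ (λ k → M p k * Λ k) + ∑ (λ k → -1ℤ * (δ i₀ k * Λ k))
          ≡⟨ cong (∑ (λ k → M p k * Λ k) +_) (trans (∑-*ˡ -1ℤ (λ k → δ i₀ k * Λ k)) (trans (cong (-1ℤ *_) (∑-δ i₀ Λ)) (ℤP.-1*i≡-i (Λ i₀)))) ⟩
        ∑ (λ k → M p k * Λ k) - Λ i₀ ∎
        where
        open ≡-Reasoning
        arith₁ : ∀ y → y * - 1ℤ ≡ 0ℤ * y + -1ℤ * (1ℤ * y)
        arith₁ = solve-∀
        arith₂ : ∀ y m → y * m ≡ m * y + -1ℤ * (0ℤ * y)
        arith₂ = solve-∀
        term : ∀ k → Dec (k ≡ i₀) → Λ k * New.G p j (ρ J p (at k)) ≡ M p k * Λ k + -1ℤ * (δ i₀ k * Λ k)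
        term k (yes refl) = trans (cong (Λ k *_) G'-new) (trans (arith₁ (Λ k))
          (sym (cong₂ (λ m z → m * Λ k + -1ℤ * (z * Λ k)) (M-diag p) (δ-same k))))
        term k (no k≢) = trans (cong (Λ k *_) (G'-old k≢)) (trans (arith₂ (Λ k) (M p k))
          (cong (λ z → M p k * Λ k + -1ℤ * (z * Λ k)) (sym (δ-diff k≢))))

      -- The difference of the two candidates for the maximum; its sign decides between them.
      H : ℤ
      H = ∑ (λ k → BB i₀ k * Λ k)

      -- The `Λ k` are the coordinates of α_b, so the sum is a value of the skew form, and b is a
      -- source in this rotation.
      H-value : dZ i₀ * H ≡ dZ b * (A b (ρ J p i) + - int 2 * ρ J p i b)
      H-value = begin
        dZ i₀ * H ≡⟨ sym (∑-*ˡ (dZ i₀) (λ k → BB i₀ k * Λ k)) ⟩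
        ∑ (λ k → dZ i₀ * (BB i₀ k * Λ k)) ≡⟨ ∑-cong (λ k → trans (arith (dZ i₀) (BB i₀ k) (Λ k)) (cong (Λ k *_) (trans (b-skew i₀ k)
              (sym (ω-invariant p (ℕP.<⇒≤ p<L) (at<L i₀) (at<L k) (J-at i₀) (J-at k)))))) ⟩
        ∑ (λ k → Λ k * ω p (ρ J p i) (ρ J p (at k))) ≡⟨ sym (at-comb (ω-linʳ p (ρ J p i)) Λ (λ k → ρ J p (at k))) ⟩
        ω p (ρ J p i) (comb Λ (λ k → ρ J p (at k))) ≡⟨ sym (resp (ω-linʳ p (ρ J p i)) (expansion p (δ b))) ⟩
        ω p (ρ J p i) (δ b) ≡⟨ cong (λ s → ω p (ρ J p i) (δ s)) (sym (q-letter b)) ⟩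
        ω p (ρ J p i) (δ (q p)) ≡⟨ cong₂ _-_ (E-sourceʳ (source (steps p p<L)) (ρ J p i)) (E-source (source (steps p p<L)) (ρ J p i)) ⟩
        dZ (q p) * (A (q p) (ρ J p i) - ρ J p i (q p)) - dZ (q p) * ρ J p i (q p) ≡⟨ arith' (dZ (q p)) (A (q p) (ρ J p i)) (ρ J p i (q p)) ⟩
        dZ (q p) * (A (q p) (ρ J p i) + - int 2 * ρ J p i (q p)) ≡⟨ cong (λ s → dZ s * (A s (ρ J p i) + - int 2 * ρ J p i s)) (q-letter b) ⟩
        dZ b * (A b (ρ J p i) + - int 2 * ρ J p i b) ∎
        where
        open ≡-Reasoning
        arith : ∀ d b l → d * (b * l) ≡ l * (d * b)
        arith = solve-∀
        arith' : ∀ d α y → d * (α - y) - d * y ≡ d * (α + - int 2 * y)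
        arith' = solve-∀

      -- The left hand side is A b (v − v_b α_b), and v − v_b α_b is positive without coefficient at b.
      A-off : ∀ {v : Vect n} → Pos v → A b v + - int 2 * v b ≤ 0ℤ
      A-off {v} P = subst (_≤ 0ℤ) (trans (lin (A-linear b) v (- v b) (δ b)) (trans (cong (λ z → A b v + - v b * z) (trans (A-δ b b) (IsFiniteCartan.diag fin b)))
          (arith (A b v) (v b)))) (A-≤0 rest-Pos rest-b)
        where
        arith : ∀ α y → α + - y * int 2 ≡ α + - int 2 * y
        arith = solve-∀
        cancel : ∀ y → y + - y * 1ℤ ≡ 0ℤ
        cancel = solve-∀
        rest-b : (v +⟨ - v b ⟩ δ b) b ≡ 0ℤ
        rest-b = trans (cong (λ z → v b + - v b * z) (δ-same b)) (cancel (v b))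
        rest-Pos : Pos (v +⟨ - v b ⟩ δ b)
        rest-Pos t = go (t ≟ b)
          where
          go : Dec (t ≡ b) → 0ℤ ≤ (v +⟨ - v b ⟩ δ b) t
          go (yes refl) = ℤP.≤-reflexive (sym rest-b)
          go (no t≢b) = subst (0ℤ ≤_) (sym (trans (cong (λ z → v t + - v b * z) (δ-diff t≢b)) (trans (cong (v t +_) (ℤP.*-zeroʳ (- v b))) (ℤP.+-identityʳ (v t))))) (P t)

      H-sign : sg (ε p) H ≤ 0ℤ
      H-sign = cancel-≤0 (0<d i₀) (subst (_≤ 0ℤ) (trans (cong (dZ b *_) (pull (ε p))) (trans (sg-out (ε p) (dZ b) _) (trans (cong (sg (ε p)) (sym H-value)) (sym (sg-out (ε p) (dZ i₀) H)))))
          (*≤0 (<⇒≤ (0<d b)) (A-off (ρ-sign {p} (ℕP.<⇒≤ p<L)))))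
        where
        sg-out : ∀ s d y → d * sg s y ≡ sg s (d * y)
        sg-out true  d y = refl
        sg-out false d y = sym (ℤP.neg-distribʳ-* d y)
        pull : ∀ s → A b (sgV s (ρ J p i)) + - int 2 * sgV s (ρ J p i) b ≡ sg s (A b (ρ J p i) + - int 2 * ρ J p i b)
        pull s = trans (cong (_+ - int 2 * sgV s (ρ J p i) b) (at-sgV (A-linear b) s (ρ J p i))) (sym (sg-linear s (A b (ρ J p i)) (- int 2) (ρ J p i b)))

      -- U and V belong to the two monomials of the exchange relation. Passing from ψ to Λ changes
      -- signs, and skew-symmetrizability pairs U with N and V with P.
      P N U V : ℤ
      P = ∑ (λ k → int [ BB i₀ k ]₊ * Λ k)
      N = ∑ (λ k → int [ - BB i₀ k ]₊ * Λ k)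
      U = ∑ (λ k → int [ BB k i₀ ]₊ * ψℕ (at k) b)
      V = ∑ (λ k → int [ - BB k i₀ ]₊ * ψℕ (at k) b)

      H-split : H ≡ P - N
      H-split = trans (∑-cong λ k → trans (cong (_* Λ k) (split-[]₊ (BB i₀ k))) (arith (int [ BB i₀ k ]₊) (int [ - BB i₀ k ]₊) (Λ k)))
        (trans (∑-+ (λ k → int [ BB i₀ k ]₊ * Λ k) (λ k → -1ℤ * (int [ - BB i₀ k ]₊ * Λ k)))
        (cong (P +_) (trans (∑-*ˡ -1ℤ (λ k → int [ - BB i₀ k ]₊ * Λ k)) (ℤP.-1*i≡-i N))))
        where
        arith : ∀ s t l → (s - t) * l ≡ s * l + -1ℤ * (t * l)
        arith = solve-∀

      private
        ψ-Λ : ∀ k → dZ b * ψℕ (at k) b ≡ - (dZ k * Λ k)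
        ψ-Λ k = trans (sym (ℤP.neg-involutive _)) (cong -_ (trans (sym (ψ-G b (at<L k) (J-at k))) (cong (_* Λ k) (d-at k))))

        side : ∀ (f g : ℤ → ℤ) → (∀ k → dZ k * f (BB k i₀) ≡ dZ i₀ * g (BB i₀ k)) →
          dZ b * ∑ (λ k → int [ f (BB k i₀) ]₊ * ψℕ (at k) b) ≡ - (dZ i₀ * ∑ (λ k → int [ g (BB i₀ k) ]₊ * Λ k))
        side f g h = begin
          dZ b * ∑ (λ k → int [ f (BB k i₀) ]₊ * ψℕ (at k) b) ≡⟨ sym (∑-*ˡ (dZ b) (λ k → int [ f (BB k i₀) ]₊ * ψℕ (at k) b)) ⟩
          ∑ (λ k → dZ b * (int [ f (BB k i₀) ]₊ * ψℕ (at k) b)) ≡⟨ ∑-cong term ⟩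
          ∑ (λ k → - dZ i₀ * (int [ g (BB i₀ k) ]₊ * Λ k)) ≡⟨ ∑-*ˡ (- dZ i₀) (λ k → int [ g (BB i₀ k) ]₊ * Λ k) ⟩
          - dZ i₀ * ∑ (λ k → int [ g (BB i₀ k) ]₊ * Λ k) ≡⟨ sym (ℤP.neg-distribˡ-* (dZ i₀) _) ⟩
          - (dZ i₀ * ∑ (λ k → int [ g (BB i₀ k) ]₊ * Λ k)) ∎
          where
          open ≡-Reasoning
          arith₁ : ∀ d s y → d * (s * y) ≡ s * (d * y)
          arith₁ = solve-∀
          arith₂ : ∀ s d l → s * - (d * l) ≡ - (d * s) * l
          arith₂ = solve-∀
          arith₃ : ∀ d s l → - (d * s) * l ≡ - d * (s * l)
          arith₃ = solve-∀
          term : ∀ k → dZ b * (int [ f (BB k i₀) ]₊ * ψℕ (at k) b) ≡ - dZ i₀ * (int [ g (BB i₀ k) ]₊ * Λ k)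
          term k = trans (arith₁ (dZ b) (int [ f (BB k i₀) ]₊) (ψℕ (at k) b)) (trans (cong (int [ f (BB k i₀) ]₊ *_) (ψ-Λ k))
            (trans (arith₂ (int [ f (BB k i₀) ]₊) (dZ k) (Λ k))
            (trans (cong (λ z → - z * Λ k) (trans (scale-[]₊ (0<d k) (f (BB k i₀))) (trans (cong (λ z → int [ z ]₊) (h k)) (sym (scale-[]₊ (0<d i₀) (g (BB i₀ k)))))))
              (arith₃ (dZ i₀) (int [ g (BB i₀ k) ]₊) (Λ k)))))

      U-N : dZ b * U ≡ - (dZ i₀ * N)
      U-N = side (λ z → z) -_ λ k → trans (b-anti k i₀) (ℤP.neg-distribʳ-* (dZ i₀) (BB i₀ k))

      V-P : dZ b * V ≡ - (dZ i₀ * P)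
      V-P = side -_ (λ z → z) λ k → trans (sym (ℤP.neg-distribʳ-* (dZ k) (BB k i₀))) (trans (cong -_ (b-anti k i₀)) (ℤP.neg-involutive _))

      ψ-new : dZ b * ψℕ j b ≡ - (dZ i₀ * Λ')
      ψ-new = trans (sym (ℤP.neg-involutive _)) (cong -_ (trans (sym (ψ-values.ψ-G triangular-flip b j<L J'j)) (cong (_* Λ') (trans d-flip (d-at i₀)))))

      from-Λ : ∀ {X Y} → dZ b * X ≡ - (dZ i₀ * Y) → Λ' ≡ Y - Λ i₀ → ψℕ j b ≡ X - ψℕ i b
      from-Λ {X} {Y} h e = cancel-pos (0<d b) (begin
        dZ b * ψℕ j b ≡⟨ ψ-new ⟩
        - (dZ i₀ * Λ') ≡⟨ cong (λ z → - (dZ i₀ * z)) e ⟩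
        - (dZ i₀ * (Y - Λ i₀)) ≡⟨ arith (dZ i₀) Y (Λ i₀) ⟩
        - (dZ i₀ * Y) - - (dZ i₀ * Λ i₀) ≡⟨ cong₂ _-_ (sym h) (sym (ψ-Λ i₀)) ⟩
        dZ b * X - dZ b * ψℕ i b ≡⟨ arith' (dZ b) X (ψℕ i b) ⟩
        dZ b * (X - ψℕ i b) ∎)
        where
        open ≡-Reasoning
        arith : ∀ d y l → - (d * (y - l)) ≡ - (d * y) - - (d * l)
        arith = solve-∀
        arith' : ∀ d y l → d * y - d * l ≡ d * (y - l)
        arith' = solve-∀

      compare : ∀ {X Y X' Y'} → dZ b * X ≡ - (dZ i₀ * Y) → dZ b * X' ≡ - (dZ i₀ * Y') → Y' - Y ≤ 0ℤ → X ≤ X'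
      compare {X} {Y} {X'} {Y'} h h' l = cancel-≤ (0<d b) (subst₂ _≤_ (sym h) (sym h')
        (ℤP.neg-mono-≤ (ℤP.*-monoˡ-≤-nonNeg (dZ i₀) (ℤP.i-j≤0⇒i≤j l))))

      -- `ε p` selects a side in `linear-exchange`, and `H-sign` shows that this side is the larger
      -- one.
      exchange-ψ : ψℕ j b ≡ (U ⊔ V) - ψℕ i b
      exchange-ψ = go (ε p) refl
        where
        go : ∀ s → ε p ≡ s → ψℕ j b ≡ (U ⊔ V) - ψℕ i b
        go true  e = trans (from-Λ V-P (trans linear-exchange (cong (λ s → ∑ (λ k → int [ sg s (BB i₀ k) ]₊ * Λ k) - Λ i₀) e)))
          (cong (_- ψℕ i b) (sym (ℤP.i≤j⇒i⊔j≡j (compare U-N V-P (subst (_≤ 0ℤ) H-split (subst (λ s → sg s H ≤ 0ℤ) e H-sign))))))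
        go false e = trans (from-Λ U-N (trans linear-exchange (cong (λ s → ∑ (λ k → int [ sg s (BB i₀ k) ]₊ * Λ k) - Λ i₀) e)))
          (cong (_- ψℕ i b) (sym (ℤP.i≥j⇒i⊔j≡i (compare V-P U-N (subst (_≤ 0ℤ) (trans (cong -_ H-split) (arith P N)) (subst (λ s → sg s H ≤ 0ℤ) e H-sign))))))
          where
          arith : ∀ s t → - (s - t) ≡ t - s
          arith = solve-∀

    d-vector' : ∀ k b → Den b (x S' k) (ψℕ (at' k) b)
    d-vector' k b = go (k ≟ i₀)
      where
      go : Dec (k ≡ i₀) → Den b (x S' k) (ψℕ (at' k) b)
      go (yes refl) = subst (λ m → Den b (x S' k) (ψℕ m b)) (sym at'-new)
        (Den-cong {f = x S' k} (sym (Exchange.exchange-ψ b)) (Den-mutate {S = S} k (λ l → d-vector l b)))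
      go (no k≢) = subst (λ m → Den b (x S' k) (ψℕ m b)) (sym (at'-old k≢)) (Den-mutate-other {S = S} k≢ (d-vector k b))

    mutated : SeedOf S'
    mutated = record
      { J = J' ; facet = facet-flip ; tri = triangular-flip ; at = at' ; at<L = at'<L ; J-at = J'-at'
      ; at-injective = at'-injective ; at-surjective = at'-surjective ; c-root = c-root' ; d-at = d-at'
      ; b-skew = b-skew' ; spans = spans' ; d-vector = d-vector' }

  SeedOf-mutations : ∀ {S} ks → SeedOf S → SeedOf (foldl (λ S k → mutate k S) S ks)
  SeedOf-mutations [] I = I
  SeedOf-mutations (k ∷ ks) I = SeedOf-mutations ks (Step-data.mutated I k)

-- Positions of Q as natural numbers

nth : ∀ {X : Set} → X → List X → ℕ → X
nth x [] k = x
nth x (y ∷ ys) zero = y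
nth x (y ∷ ys) (suc k) = nth x ys k

nth-lookup : ∀ {X : Set} (x : X) ys (i : Fin (length ys)) → nth x ys (toℕ i) ≡ lookup ys i
nth-lookup x (y ∷ ys) Fin.zero = refl
nth-lookup x (y ∷ ys) (Fin.suc i) = nth-lookup x ys i

nth-tabulate : ∀ {X : Set} {n} (x : X) (f : Fin n → X) ys i → nth x (tabulate f ++ ys) (toℕ i) ≡ f i
nth-tabulate x f ys Fin.zero = refl
nth-tabulate x f ys (Fin.suc i) = nth-tabulate x (f ∘ Fin.suc) ys i

nth-after : ∀ {X : Set} {n} (x : X) (f : Fin n → X) ys m → nth x (tabulate f ++ ys) (n ℕ.+ m) ≡ nth x ys m
nth-after {n = zero} x f ys m = refl
nth-after {n = suc n} x f ys m = nth-after x (f ∘ Fin.suc) ys m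

-- The default `true` means that positions beyond the end contribute no letter to a word.
extend : ∀ {m} → (Fin m → Bool) → ℕ → Bool
extend {zero} I k = true
extend {suc m} I zero = I Fin.zero
extend {suc m} I (suc k) = extend (I ∘ Fin.suc) k

extend-toℕ : ∀ {m} (I : Fin m → Bool) i → extend I (toℕ i) ≡ I i
extend-toℕ I Fin.zero = refl
extend-toℕ I (Fin.suc i) = extend-toℕ (I ∘ Fin.suc) i

pick : ∀ {X : Set} (ys : List X) → (Fin (length ys) → Bool) → List X
pick [] P = []
pick (y ∷ ys) P = if P Fin.zero then y ∷ pick ys (P ∘ Fin.suc) else pick ys (P ∘ Fin.suc)

filterᵇ-map : ∀ {X Y : Set} (P : Y → Bool) (f : X → Y) xs → filterᵇ P (map f xs) ≡ map f (filterᵇ (P ∘ f) xs)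
filterᵇ-map P f [] = refl
filterᵇ-map P f (x ∷ xs) with P (f x)
... | true = cong (f x ∷_) (filterᵇ-map P f xs)
... | false = filterᵇ-map P f xs

filterᵇ-cong : ∀ {X : Set} {P P' : X → Bool} → P ≗ P' → ∀ xs → filterᵇ P xs ≡ filterᵇ P' xs
filterᵇ-cong h [] = refl
filterᵇ-cong {P = P} {P'} h (x ∷ xs) with P x | P' x | h x
... | true | true | _ = cong (x ∷_) (filterᵇ-cong h xs)
... | false | false | _ = filterᵇ-cong h xs

pick-filter : ∀ {X : Set} (ys : List X) P → map (lookup ys) (filterᵇ P (allFin (length ys))) ≡ pick ys P
pick-filter [] P = refl
pick-filter (y ∷ ys) P = by (P Fin.zero) refl
  where
  rest : map (lookup (y ∷ ys)) (filterᵇ P (tabulate Fin.suc)) ≡ pick ys (P ∘ Fin.suc)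
  rest = trans (cong (map (lookup (y ∷ ys)) ∘ filterᵇ P) (sym (ListP.map-tabulate (λ i → i) Fin.suc)))
    (trans (cong (map (lookup (y ∷ ys))) (filterᵇ-map P Fin.suc (allFin (length ys))))
    (trans (sym (ListP.map-∘ (filterᵇ (P ∘ Fin.suc) (allFin (length ys))))) (pick-filter ys (P ∘ Fin.suc))))
  by : ∀ b → P Fin.zero ≡ b → map (lookup (y ∷ ys)) (filterᵇ P (Fin.zero ∷ tabulate Fin.suc)) ≡ pick (y ∷ ys) P
  by b h with P Fin.zero
  ... | true = cong (y ∷_) rest
  ... | false = rest

pick-none : ∀ {X : Set} (ys : List X) → pick ys (λ _ → false) ≡ []
pick-none [] = refl
pick-none (y ∷ ys) = pick-none ys

module Words {n : ℕ} (a : CartanMatrix n) (fin : IsFiniteCartan a) where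

  -- `word` grows at its right end while `pick` recurses from the left; this is the bridge.
  word-head : ∀ q J p → Facets.word a fin q J (suc p) ≡
    (if J 0 then Facets.word a fin (q ∘ suc) (J ∘ suc) p else q 0 ∷ Facets.word a fin (q ∘ suc) (J ∘ suc) p)
  word-head q J zero = refl
  word-head q J (suc p) with word-head q J p | J (suc p)
  ... | h | true = h
  ... | h | false with J 0
  ...   | true = cong (_++ q (suc p) ∷ []) h
  ...   | false = cong (_++ q (suc p) ∷ []) h

  pick-word : ∀ x Q (I : Fin (length Q) → Bool) p → p ℕ.≤ length Q →
    pick Q (λ y → (toℕ y ℕ.<ᵇ p) ∧ not (I y)) ≡ Facets.word a fin (nth x Q) (extend I) p
  pick-word x Q I zero l = pick-none Q
  pick-word x (y ∷ Q) I (suc p) (ℕ.s≤s l) = trans (by (I Fin.zero)) (sym (word-head (nth x (y ∷ Q)) (extend I) p))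
    where
    IH : pick Q (λ y → (toℕ y ℕ.<ᵇ p) ∧ not (I (Fin.suc y))) ≡ Facets.word a fin (nth x Q) (extend (I ∘ Fin.suc)) p
    IH = pick-word x Q (I ∘ Fin.suc) p l
    by : ∀ b → (if not b then y ∷ pick Q (λ y → (toℕ y ℕ.<ᵇ p) ∧ not (I (Fin.suc y))) else pick Q (λ y → (toℕ y ℕ.<ᵇ p) ∧ not (I (Fin.suc y)))) ≡
      (if b then Facets.word a fin (nth x Q) (extend (I ∘ Fin.suc)) p else y ∷ Facets.word a fin (nth x Q) (extend (I ∘ Fin.suc)) p)
    by true = IH
    by false = cong (y ∷_) IH

-- The initial seed, and the comparison with the given facet

module Final {m : ℕ} (a : CartanMatrix (suc m)) (fin : IsFiniteCartan a) (ps : List (ℕ × Fin (suc m))) (wo : IsWoC a ps) where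

  n : ℕ
  n = suc m

  open Roots a fin
  open ReducedWords a fin
  open Euler a fin
  open Sorting a fin using (letters; κ₁; sorting-chain)

  W Q : List (Fin n)
  W = letters ps
  Q = Qword a ps

  ℓ : ℕ
  ℓ = length Q

  -- Positive rank provides the default letter beyond the end of Q.
  q : ℕ → Fin n
  q = nth Fin.zero Q

  κ₀ : Fin n → ℕ
  κ₀ = toℕ

  sep : Separating κ₀
  sep s t (t≢s , _) e = t≢s (sym (FinP.toℕ-injective e))

  ℓ≡ : ℓ ≡ length W ℕ.+ n
  ℓ≡ = trans (ListP.length-++ (allFin n)) (trans (cong (ℕ._+ length W) (ListP.length-tabulate {n = n} (λ i → i))) (ℕP.+-comm n (length W)))

  n≤ℓ : n ℕ.≤ ℓ
  n≤ℓ = subst (n ℕ.≤_) (sym ℓ≡) (ℕP.m≤n+m n (length W))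

  q-toℕ : ∀ i → q (toℕ i) ≡ i
  q-toℕ i = nth-tabulate Fin.zero (λ i → i) W i

  q-initial : ∀ k → k ℕ.< n → toℕ (q k) ≡ k
  q-initial k k<n = trans (cong (toℕ ∘ q) (sym (FinP.toℕ-fromℕ< k<n))) (trans (cong toℕ (q-toℕ (Fin.fromℕ< k<n))) (FinP.toℕ-fromℕ< k<n))

  q-later : ∀ k → q (k ℕ.+ n) ≡ nth Fin.zero W k
  q-later k = trans (cong q (ℕP.+-comm k n)) (nth-after Fin.zero (λ i → i) W k)

  κ : ℕ → Fin n → ℕ
  κ = orient a q κ₀

  Step-resp : ∀ {κ κ' s} → (∀ t → κ t ≡ κ' t) → Step κ' s → Step κ s
  Step-resp h st .source t adj = subst₂ ℕ._<_ (sym (h _)) (sym (h t)) (source st t adj)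
  Step-resp {κ} {κ'} {s} h st .sink t adj = subst₂ ℕ._<_ (sym (bumped t)) (sym (bumped s)) (sink st t adj)
    where
    bumped : ∀ t → bump s κ t ≡ bump s κ' t
    bumped t = cong (λ y → if ⌊ t ≟ s ⌋ then y ℕ.+ n else y) (h t)

  κ-before : ∀ p t → p ℕ.≤ n → p ℕ.≤ toℕ t → κ p t ≡ toℕ t
  κ-before zero t _ _ = refl
  κ-before (suc p) t p<n p<t = trans (bump-diff (κ p) λ e → ℕP.<-irrefl (trans (sym (q-initial p p<n)) (cong toℕ (sym e))) p<t)
    (κ-before p t (ℕP.<⇒≤ p<n) (ℕP.<⇒≤ p<t))

  κ-after : ∀ p t → p ℕ.≤ n → toℕ t ℕ.< p → κ p t ≡ toℕ t ℕ.+ n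
  κ-after (suc p) t p<n t<p = go (t ≟ q p)
    where
    go : Dec (t ≡ q p) → κ (suc p) t ≡ toℕ t ℕ.+ n
    go (yes e) = trans (cong (λ z → bump (q p) (κ p) z) e) (trans (bump-same (q p) (κ p)) (trans (cong (ℕ._+ n)
      (κ-before p (q p) (ℕP.<⇒≤ p<n) (ℕP.≤-reflexive (sym (q-initial p p<n))))) (cong (λ z → toℕ z ℕ.+ n) (sym e))))
    go (no ne) = trans (bump-diff (κ p) ne) (κ-after p t (ℕP.<⇒≤ p<n)
      (ℕP.≤∧≢⇒< (ℕP.≤-pred t<p) λ e → ne (FinP.toℕ-injective (trans e (sym (q-initial p p<n))))))

  -- In the first copy of c, a letter t has value t + n if it was read and t if not; apart from the
  -- current letter, both lie strictly between p and p + n.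
  steps-initial : ∀ p → p ℕ.< n → Step (κ p) (q p)
  steps-initial p p<n = step-intro λ t adj → go t (proj₁ adj) (ℕP.<-cmp (toℕ t) p)
    where
    κq : κ p (q p) ≡ p
    κq = trans (κ-before p (q p) (ℕP.<⇒≤ p<n) (ℕP.≤-reflexive (sym (q-initial p p<n)))) (q-initial p p<n)
    go : ∀ t → t ≢ q p → _ → κ p (q p) ℕ.< κ p t × κ p t ℕ.< κ p (q p) ℕ.+ n
    go t t≢ (tri≈ _ e _) = ⊥-elim (t≢ (FinP.toℕ-injective (trans e (sym (q-initial p p<n)))))
    go t t≢ (tri< l _ _) rewrite κq | κ-after p t (ℕP.<⇒≤ p<n) l = ℕP.≤-trans p<n (ℕP.m≤n+m n (toℕ t)) , ℕP.+-monoˡ-< n l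
    go t t≢ (tri> _ _ l) rewrite κq | κ-before p t (ℕP.<⇒≤ p<n) (ℕP.<⇒≤ l) = l , ℕP.<-≤-trans (FinP.toℕ<n t) (ℕP.m≤n+m n p)

  -- The orientations along Q and along the sorting word agree only pointwise, so each step is
  -- transported by `Step-resp`.
  steps-chain : ∀ w κ' p → (∀ t → κ p t ≡ κ' t) → (∀ k → k ℕ.< length w → q (k ℕ.+ p) ≡ nth Fin.zero w k) → Chain κ' w →
    ∀ k → k ℕ.< length w → Step (κ (k ℕ.+ p)) (q (k ℕ.+ p))
  steps-chain (s ∷ w) κ' p h e (st , c) zero l = subst (Step (κ p)) (sym (e 0 l)) (Step-resp h st)
  steps-chain (s ∷ w) κ' p h e (st , c) (suc k) (ℕ.s≤s l) = subst (λ z → Step (κ z) (q z)) (ℕP.+-suc k p)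
    (steps-chain w (bump s κ') (suc p) h' (λ k l → trans (cong q (ℕP.+-suc k p)) (e (suc k) (ℕ.s≤s l))) c k l)
    where
    h' : ∀ t → κ (suc p) t ≡ bump s κ' t
    h' t = trans (cong (λ z → bump z (κ p) t) (e 0 (ℕ.s≤s ℕ.z≤n))) (cong (λ y → if ⌊ t ≟ s ⌋ then y ℕ.+ n else y) (h t))

  steps : ∀ p → p ℕ.< ℓ → Step (κ p) (q p)
  steps p p<ℓ with p ℕ.<? n
  ... | yes p<n = steps-initial p p<n
  ... | no p≮n = subst (λ z → Step (κ z) (q z)) (ℕP.m∸n+n≡m n≤p) (steps-chain W (κ₁ wo) n
          (λ t → trans (κ-after n t ℕP.≤-refl (FinP.toℕ<n t)) (ℕP.+-comm (toℕ t) n)) (λ k _ → q-later k) (sorting-chain wo) (p ℕ.∸ n)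
          (ℕP.+-cancelʳ-< n (p ℕ.∸ n) (length W) (subst₂ ℕ._<_ (sym (ℕP.m∸n+n≡m n≤p)) ℓ≡ p<ℓ)))
    where
    n≤p : n ℕ.≤ p
    n≤p = ℕP.≮⇒≥ p≮n

  open Facets a fin q
  open Frames a fin q κ₀ ℓ steps sep using (Triangular)
  open Clusters a fin q κ₀ ℓ steps sep n≤ℓ q-initial
  open Seeds a fin q κ₀ ℓ steps sep n≤ℓ q-initial

  r-initial : ∀ k → k ℕ.≤ n → r J₀ k ≗ δ (q k)
  r-initial k k≤n = w-J₀-initial k k≤n (δ (q k))

  J₀-< : ∀ {k} → J₀ k ≡ true → k ℕ.< n
  J₀-< {k} h with k ℕ.<? n
  ... | yes l = l
  ... | no nl = case trans (sym h) (<ᵇ-false (ℕP.≮⇒≥ nl)) of λ ()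

  word-initial : ∀ p → p ℕ.≤ n → word J₀ p ≡ []
  word-initial zero _ = refl
  word-initial (suc p) p<n rewrite <ᵇ-true p<n = word-initial p (ℕP.<⇒≤ p<n)

  word-J₀ : ∀ k → k ℕ.≤ length W → word J₀ (k ℕ.+ n) ≡ take k W
  word-J₀ zero _ = word-initial n ℕP.≤-refl
  word-J₀ (suc k) k<W rewrite <ᵇ-false (ℕP.m≤n+m n k) = trans (cong₂ (λ w s → w ++ s ∷ []) (word-J₀ k (ℕP.<⇒≤ k<W)) (q-later k)) (take-suc W k k<W)
    where
    take-suc : ∀ w k → k ℕ.< length w → take k w ++ nth Fin.zero w k ∷ [] ≡ take (suc k) w
    take-suc (s ∷ w) zero _ = refl
    take-suc (s ∷ w) (suc k) (ℕ.s≤s l) = cong (s ∷_) (take-suc w k l)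

  facet₀ : Facet ℓ J₀
  facet₀ = subst (ReducedLongest a) (sym (trans (cong (word J₀) ℓ≡) (trans (word-J₀ (length W) ℕP.≤-refl) (ListP.take-all (length W) W ℕP.≤-refl)))) (proj₂ (proj₁ wo))

  triangular₀ : Triangular J₀
  triangular₀ {x} {y} x<y _ J₀x J₀y = trans (E-cong κ₀ (r-initial x (ℕP.<⇒≤ (J₀-< J₀x))) (r-initial y (ℕP.<⇒≤ (J₀-< J₀y))))
    (trans (E-δδ κ₀ (q x) (q y)) (EM-< κ₀ (λ e → ℕP.<-irrefl (trans (sym x≡) (trans (cong toℕ e) y≡)) x<y) (subst₂ ℕ._<_ (sym x≡) (sym y≡) x<y)))
    where
    x≡ : toℕ (q x) ≡ x
    x≡ = q-initial x (J₀-< J₀x)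
    y≡ : toℕ (q y) ≡ y
    y≡ = q-initial y (J₀-< J₀y)

  initial : SeedOf (initialSeed a)
  initial = record
    { J = J₀ ; facet = facet₀ ; tri = triangular₀ ; at = toℕ
    ; at<L = λ k → ℕP.<-≤-trans (FinP.toℕ<n k) n≤ℓ ; J-at = λ k → <ᵇ-true (FinP.toℕ<n k)
    ; at-injective = FinP.toℕ-injective
    ; at-surjective = λ _ J₀p → Fin.fromℕ< (J₀-< J₀p) , FinP.toℕ-fromℕ< (J₀-< J₀p)
    ; c-root = λ k → ≗-sym (root k) ; d-at = λ k → cong dZ (q-toℕ k)
    ; b-skew = λ j k → trans (entry j k) (sym (ω-cong 0 (root j) (root k)))
    ; spans = λ v → v , λ t → trans (simple-expansion v t) (∑-cong λ k → cong (v k *_) (sym (root k t)))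
    ; d-vector = λ k i → Den-cong {f = xVar k , pOne} (trans (cong (λ s → - δ s i) (sym (q-toℕ k)))
        (cong (λ b → (if b then neg (δ (q (toℕ k))) else r J₀ (toℕ k)) i) (sym (<ᵇ-true (FinP.toℕ<n k))))) (Den-x k) }
    where
    root : ∀ k → r J₀ (toℕ k) ≗ δ k
    root k t = trans (r-initial (toℕ k) (ℕP.<⇒≤ (FinP.toℕ<n k)) t) (cong (λ s → δ s t) (q-toℕ k))
    E-entry : ∀ j k → ω 0 (δ j) (δ k) ≡ EM κ₀ j k - EM κ₀ k j
    E-entry j k = cong₂ _-_ (E-δδ κ₀ j k) (E-δδ κ₀ k j)
    entry : ∀ j k → dZ j * B (initialSeed a) j k ≡ ω 0 (δ j) (δ k)
    entry j k with toℕ j ℕ.<? toℕ k | toℕ k ℕ.<? toℕ j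
    ... | yes l | _ = trans (sym (ℤP.neg-distribʳ-* (dZ j) (a j k))) (trans (cong -_ (IsFiniteCartan.symm fin j k)) (trans (sym (ℤP.+-identityˡ _))
            (sym (trans (E-entry j k) (cong₂ _-_ (EM-< κ₀ ne l) (EM-> κ₀ (λ e → ne (sym e)) l))))))
      where
      ne : j ≢ k
      ne e = ℕP.<-irrefl (cong toℕ e) l
    ... | no _ | yes l = sym (trans (E-entry j k) (trans (cong₂ _-_ (EM-> κ₀ ne l) (EM-< κ₀ (λ e → ne (sym e)) l)) (ℤP.+-identityʳ _)))
      where
      ne : j ≢ k
      ne e = ℕP.<-irrefl (cong toℕ (sym e)) l
    ... | no nl | no nl' = trans (ℤP.*-zeroʳ (dZ j)) (sym (trans (ω-cong 0 {x = δ j} {y = δ k} (λ _ → refl) (λ t → cong (λ s → δ s t) (sym j≡k))) (ω-self 0 (δ j))))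
      where
      j≡k : j ≡ k
      j≡k = FinP.toℕ-injective (ℕP.≤-antisym (ℕP.≮⇒≥ nl') (ℕP.≮⇒≥ nl))

  ψℕ-initial : ∀ {k} → k ℕ.< n → ψℕ k ≡ neg (δ (q k))
  ψℕ-initial {k} k<n = cong (λ b → if b then neg (δ (q k)) else r J₀ k) (<ᵇ-true k<n)

  ψℕ-later : ∀ {k} → n ℕ.≤ k → ψℕ k ≡ r J₀ k
  ψℕ-later {k} n≤k = cong (λ b → if b then neg (δ (q k)) else r J₀ k) (<ᵇ-false n≤k)

  -- The roots at positions outside the initial facet are distinct and positive, so they cannot meet
  -- negative simple roots.
  ψℕ-injective : ∀ {k l} → k ℕ.< ℓ → l ℕ.< ℓ → ψℕ k ≗ ψℕ l → k ≡ l
  ψℕ-injective {k} {l} k<ℓ l<ℓ h with k ℕ.<? n | l ℕ.<? n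
  ... | yes k<n | yes l<n = trans (sym (q-initial k k<n)) (trans (cong toℕ (same (q k ≟ q l))) (q-initial l l<n))
    where
    unit≢ : - 1ℤ ≢ - 0ℤ
    unit≢ ()
    same : Dec (q k ≡ q l) → q k ≡ q l
    same (yes e) = e
    same (no ne) = ⊥-elim (unit≢ (trans (cong -_ (sym (δ-same (q k)))) (trans (cong (λ v → v (q k)) (sym (ψℕ-initial k<n)))
      (trans (h (q k)) (trans (cong (λ v → v (q k)) (ψℕ-initial l<n)) (cong -_ (δ-diff ne)))))))
  ... | no k≮n | no l≮n = facet-unique ℓ facet₀ k<ℓ l<ℓ (<ᵇ-false (ℕP.≮⇒≥ k≮n)) (<ᵇ-false (ℕP.≮⇒≥ l≮n))
          (subst₂ _≗_ (ψℕ-later (ℕP.≮⇒≥ k≮n)) (ψℕ-later (ℕP.≮⇒≥ l≮n)) h)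
  ... | yes k<n | no l≮n = ⊥-elim (Root-not-both (Root-r J₀ l) (facet-Pos ℓ facet₀ l<ℓ (<ᵇ-false (ℕP.≮⇒≥ l≮n)))
          (Neg-cong (subst₂ _≗_ (ψℕ-initial k<n) (ψℕ-later (ℕP.≮⇒≥ l≮n)) h) (neg-Pos (δ-Pos (q k)))))
  ... | no k≮n | yes l<n = ⊥-elim (Root-not-both (Root-r J₀ k) (facet-Pos ℓ facet₀ k<ℓ (<ᵇ-false (ℕP.≮⇒≥ k≮n)))
          (Neg-cong (≗-sym (subst₂ _≗_ (ψℕ-later (ℕP.≮⇒≥ k≮n)) (ψℕ-initial l<n) h)) (neg-Pos (δ-Pos (q l)))))

  open Words a fin

  rootFn-r : ∀ I k → rootFn a Q I k ≗ r (extend I) (toℕ k)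
  rootFn-r I k t = trans (cong₂ (λ w s → act a w (δ s) t)
      (trans (pick-filter Q (λ y → (toℕ y ℕ.<ᵇ toℕ k) ∧ not (I y))) (pick-word Fin.zero Q I (toℕ k) (ℕP.<⇒≤ (FinP.toℕ<n k)))) (sym (nth-lookup Fin.zero Q k)))
    (act-word (extend I) (toℕ k) (δ (q (toℕ k))) t)

  ψ-ψℕ : ∀ k → ψ a Q k ≗ ψℕ (toℕ k)
  ψ-ψℕ k t with toℕ k ℕ.<ᵇ n
  ... | true = cong (λ s → - δ s t) (sym (nth-lookup Fin.zero Q k))
  ... | false = trans (cong₂ (λ w s → act a w (δ s) t)
      (trans (cong (map (lookup Q)) (filterᵇ-cong (λ y → swap (toℕ y)) (allFin ℓ)))
      (trans (pick-filter Q (λ y → (toℕ y ℕ.<ᵇ toℕ k) ∧ not (toℕ y ℕ.<ᵇ n)))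
      (trans (pick-word Fin.zero Q (λ y → toℕ y ℕ.<ᵇ n) (toℕ k) (ℕP.<⇒≤ (FinP.toℕ<n k)))
             (word-ext {extend {ℓ} (λ y → toℕ y ℕ.<ᵇ n)} {J₀} (toℕ k) λ l l<k → agree l (ℕP.<-trans l<k (FinP.toℕ<n k)))))) (sym (nth-lookup Fin.zero Q k)))
    (act-word J₀ (toℕ k) (δ (q (toℕ k))) t)
    where
    swap : ∀ y → ((n ℕ.≤ᵇ y) ∧ (y ℕ.<ᵇ toℕ k)) ≡ ((y ℕ.<ᵇ toℕ k) ∧ not (y ℕ.<ᵇ n))
    swap y = trans (∧-comm (n ℕ.≤ᵇ y) (y ℕ.<ᵇ toℕ k)) (cong ((y ℕ.<ᵇ toℕ k) ∧_) (opposite y))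
      where
      opposite : ∀ y → (n ℕ.≤ᵇ y) ≡ not (y ℕ.<ᵇ n)
      opposite y with y ℕ.<? n
      ... | yes l = trans (≤ᵇ-false l) (cong not (sym (<ᵇ-true l)))
        where
        ≤ᵇ-false : ∀ {y} → y ℕ.< n → (n ℕ.≤ᵇ y) ≡ false
        ≤ᵇ-false {y} l = <ᵇ-false {m} {y} (ℕP.≤-pred l)
      ... | no nl = trans (<ᵇ-true {m} {y} (ℕP.≮⇒≥ nl)) (cong not (sym (<ᵇ-false (ℕP.≮⇒≥ nl))))
    agree : ∀ l → l ℕ.< ℓ → extend {ℓ} (λ y → toℕ y ℕ.<ᵇ n) l ≡ J₀ l
    agree l l<ℓ = trans (cong (extend {ℓ} (λ y → toℕ y ℕ.<ᵇ n)) (sym (FinP.toℕ-fromℕ< l<ℓ)))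
      (trans (extend-toℕ (λ y → toℕ y ℕ.<ᵇ n) (Fin.fromℕ< l<ℓ)) (cong (ℕ._<ᵇ n) (FinP.toℕ-fromℕ< l<ℓ)))

  module Conclusion (I : Face a Q) (μ : List (Fin n)) (reaches : SeedOfFacet a Q I (seedAfter a μ)) where

    seed : Seed n
    seed = seedAfter a μ

    open Seed-data (SeedOf-mutations μ initial)

    position : ∀ i k → dvec (x seed k) ≗ ψ a Q i → toℕ i ≡ at k
    position i k h = ψℕ-injective (FinP.toℕ<n i) (at<L k) λ t →
      trans (sym (ψ-ψℕ i t)) (trans (sym (h t)) (Den-dvec (d-vector k t)))

    -- Both sets consist of the positions whose ψ is a d-vector of the seed, and `position` makes
    -- these positions unique.
    I≗J : ∀ p → p ℕ.< ℓ → J p ≡ extend I p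
    I≗J p p<ℓ = trans (cong J (sym i≡p)) (trans (agree (I i) refl (J (toℕ i)) refl) (trans (sym (extend-toℕ I i)) (cong (extend I) i≡p)))
      where
      i : Fin ℓ
      i = Fin.fromℕ< p<ℓ
      i≡p : toℕ i ≡ p
      i≡p = FinP.toℕ-fromℕ< p<ℓ
      agree : ∀ b → I i ≡ b → ∀ c → J (toℕ i) ≡ c → J (toℕ i) ≡ I i
      agree true Ii c _ with proj₂ reaches i Ii
      ... | k , h = trans (cong J (position i k h)) (trans (J-at k) (sym Ii))
      agree false Ii false Ji = trans Ji (sym Ii)
      agree false Ii true Ji with at-surjective (FinP.toℕ<n i) Ji
      ... | k , ek with proj₁ reaches k
      ...   | i' , Ii' , h = case trans (sym Ii) (trans (cong I (FinP.toℕ-injective (trans (sym ek) (sym (position i' k h))))) Ii') of λ ()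

    c-vector : ∀ i → ∀ k → dvec (x seed k) ≗ ψ a Q i → cvec seed k ≗ rootFn a Q I i
    c-vector i k h t = begin
      cvec seed k t ≡⟨ c-root k t ⟩
      r J (at k) t ≡⟨ cong (λ p → r J p t) (sym (position i k h)) ⟩
      r J (toℕ i) t ≡⟨ w-ext (toℕ i) (λ p p<i → I≗J p (ℕP.<-trans p<i (FinP.toℕ<n i))) (δ (q (toℕ i))) t ⟩
      r (extend I) (toℕ i) t ≡⟨ sym (rootFn-r I i t) ⟩
      rootFn a Q I i t ∎
      where open ≡-Reasoning

    c-vector-Root : ∀ k → Root (cvec seed k)
    c-vector-Root k = Root-cong (≗-sym (c-root k)) (Root-r J (at k))

    basis : IsLatticeBasis (cvec seed)
    basis = (λ v → proj₁ (spans v) , λ t → trans (∑-cong λ k → cong (proj₁ (spans v) k *_) (c-root k t)) (sym (proj₂ (spans v) t))) ,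
      -- Uniqueness of coefficients: the dual functionals of rotation 0 recover them.
      λ c c' h k → trans (sym (G-comb 0 c k)) (trans (resp (G-linear 0 (at k)) λ t → trans (∑-cong λ l → cong (c l *_) (sym (c-root l t)))
        (trans (h t) (∑-cong λ l → cong (c' l *_) (c-root l t)))) (G-comb 0 c' k))

theorem2p8 : (n : ℕ) (a : CartanMatrix n) → IsFiniteCartan a →
    (wc : List (ℕ × Fin n)) → IsWoC a wc →
    (I : Face a (Qword a wc)) → IsFacet a (Qword a wc) I →
    (μ : List (Fin n)) → SeedOfFacet a (Qword a wc) I (seedAfter a μ) →
    (∀ (i : Fin (L a (Qword a wc))) → I i ≡ true → ∀ (j : Fin n) →
    dvec (x (seedAfter a μ) j) ≗ ψ a (Qword a wc) i →
    cvec (seedAfter a μ) j ≗ rootFn a (Qword a wc) I i)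
    × (∀ (j : Fin n) → InPhi a (cvec (seedAfter a μ) j))
    × (∀ (j : Fin n) → SignCoherent (cvec (seedAfter a μ) j))
    × IsLatticeBasis (cvec (seedAfter a μ))
-- In rank zero every claim ranges over the empty type.
theorem2p8 zero a fin wc wo I _ μ reaches = (λ _ _ ()) , (λ ()) , (λ ()) , (λ _ → (λ ()) , λ ()) , λ _ _ _ ()
theorem2p8 (suc m) a fin wc wo I _ μ reaches = (λ i _ k → c-vector i k) , c-vector-Root , (λ k → Roots.Root-Signed a fin (c-vector-Root k)) , basis
  where open Final.Conclusion a fin wc wo I μ reaches
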